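{- Let $k,N\ge1$ be integers, let $\lambda\vdash N$ be an integer partition, and for $1\le l\le N$ let $m_l$ be the multiplicity of $l$ in $\lambda$. Let $X_1,\dots,X_k$ be pairwise disjoint finite nonempty sets with $|X_i|=n_i$, let $\mathrm{EC}(\lambda)$ be the set of eventually $\lambda$-cyclic $k$-tuples $f=(f_1,\dots,f_k)$ of functions $f_i:X_i\to X_{i+1}$ (indices modulo $k$), and let $P_\lambda(\mathbf x)=\sum_{f\in\mathrm{EC}(\lambda)}w(f)$. Then $$P_\lambda(\mathbf x)=\frac{(N!)^k}{\prod_{l=1}^N l^{m_l}m_l!}\prod_{i=1}^k e_1(X_i)^{n_{i-1}-(N+1)}\left(\prod_{j=1}^k e_1(X_j)e_N(X_j)-(N+1)^k\prod_{j=1}^k e_{N+1}(X_j)\right),$$ and $$\#\mathrm{EC}(\lambda)=\frac1{\prod_{l=1}^N l^{m_l}m_l!}\prod_{i=1}^k n_i^{\,n_{i-1}-(N+1)}\frac{n_i!}{(n_i-N)!}\left(\prod_{j=1}^k n_j-\prod_{j=1}^k(n_j-N)\right).$$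
   Context: Indices are modulo $k$, so $X_{k+1}=X_1$ and $n_0=n_k$. A $k$-tuple $(f_1,\dots,f_k)$ with $f_i:X_i\to X_{i+1}$ is eventually $\lambda$-cyclic if the iterated images $(f_k\cdots f_1)^m(X_1)$ of the composition $f_k\cdots f_1:X_1\to X_1$ eventually stabilize (for large $m$) to a subset of $X_1$ of cardinality $N$ on which $f_k\cdots f_1$ acts as a permutation of cycle type $\lambda$, i.e. with exactly $m_l$ disjoint cycles of length $l$ for each $l\le N$. There is one commuting variable $x_v$ for each $v\in\bigsqcup_iX_i$; $w(f)=\prod_{i=1}^k\prod_{v\in X_i}x_{f_i(v)}$; and $e_j(U)=\sum_{S\subseteq U,\,|S|=j}\prod_{v\in S}x_v$ (zero if $j>|U|$). The quotient $n!/(n-N)!$ denotes the falling factorial $n(n-1)\cdots(n-N+1)$, which is $0$ when $n<N$. In the cardinality formula the product $\prod_{i=1}^k$ covers both factors $n_i^{n_{i-1}-(N+1)}$ and $n_i!/(n_i-N)!$, the final parenthesis being outside it. Negative exponents are read in the field of rational functions in the $x_v$ (respectively in $\mathbb Q$). -}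

module Defs where

open import Level using (0ℓ; _⊔_)
open import Algebra.Bundles using (CommutativeRing)
open import Algebra.Structures using (IsCommutativeRing)
import Algebra.Properties.CommutativeMonoid.Sum as MonoidSum
import Algebra.Properties.Semiring.Exp as Exp
import Algebra.Properties.AbelianGroup as AbelianGroupProperties
import Algebra.Properties.Ring as RingProperties
import Algebra.Solver.Ring.NaturalCoefficients.Default as RingSolver
open import Data.Bool.Base using (true; false; if_then_else_)
open import Data.Fin.Base using (Fin; zero; suc; toℕ)
open import Data.Fin.Properties using (toℕ-injective; toℕ-fromℕ<; all?; any?; ∀-cons)
  renaming (_≟_ to _≟ᶠ_)
open import Data.Fin.Subset
  using (Subset; inside; outside; _∈_; _⊆_; _⊂_; ∣_∣; ⁅_⁆; ⋃; ⊥)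
open import Data.Fin.Subset.Properties
  using (_∈?_; _⊆?_; _⊂?_; ⊆-antisym; p⊂q⇒∣p∣<∣q∣; ∣p∣≤n; ∉⊥;
         x∈⁅x⁆; x∈⁅y⁆⇒x≡y; x∈p∪q⁻; p⊆p∪q; q⊆p∪q)
open import Data.Integer.Base using (ℤ; +_; -[1+_])
open import Data.List.Base
  using (List; []; _∷_; _++_; map; filter; foldr; length; allFin; upTo;
         cartesianProductWith)
open import Data.List.Membership.Propositional using () renaming (_∈_ to _∈ᴸ_)
open import Data.List.Membership.Propositional.Properties using (∈-allFin)
open import Data.List.Properties using (filter-++; map-++)
open import Data.List.Relation.Unary.All using (All)
open import Data.List.Relation.Unary.Any using (here; there)
open import Data.List.Relation.Unary.Linked using (Linked)
open import Data.Nat.Base as ℕ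
  using (ℕ; zero; suc; NonZero; _≤_; _<_; _≥_; z≤n; s≤s; _!)
open import Data.Nat.ListAction using () renaming (sum to sumℕ)
open import Data.Nat.DivMod
  using (_mod_; _%_; m%n<n; m%n%n≡m%n; %-distribˡ-+; n%n≡0; m<n⇒m%n≡m)
import Data.Nat.Properties as ℕₚ
open import Data.Product.Base using (Σ; ∃; _×_; _,_; proj₁; proj₂)
import Data.Product.Properties as Productₚ
open import Data.Rational.Base as ℚ using (ℚ; 0ℚ; 1ℚ)
open import Data.Sum.Base using (_⊎_; inj₁; inj₂)
import Data.Vec.Base as Vec
import Data.Vec.Properties as Vecₚ
import Data.Bool.Properties as Boolₚ
open import Function.Base using (_∘_; id)
import Function.Endo.Propositional as Endo
open import Relation.Binary.Definitions using (DecidableEquality)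
open import Relation.Binary.PropositionalEquality as ≡
  using (_≡_; refl; cong; subst; _≢_)
import Relation.Binary.Reasoning.Setoid as SetoidReasoning
open import Relation.Nullary using (¬_; Dec; yes; no; does; contradiction)
open import Relation.Nullary.Decidable
  using (map′; _×-dec_; _→-dec_; dec-true; dec-false)

subsets : ∀ n → List (Subset n)
subsets zero    = Vec.[] ∷ []
subsets (suc n) = map (inside Vec.∷_) (subsets n) ++ map (outside Vec.∷_) (subsets n)

-- All dependent functions on Fin k with values drawn from the given
-- lists; if each list has no repetitions, each function is listed exactly
-- once up to pointwise equality.
choices : ∀ {k} {A : Fin k → Set} → (∀ i → List (A i)) → List (∀ i → A i)
choices {zero}  xs = (λ ()) ∷ []
choices {suc k} xs = cartesianProductWith ∀-cons (xs zero) (choices (xs ∘ suc))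

module FiniteSums {c ℓ} (R : CommutativeRing c ℓ) where

  open CommutativeRing R hiding (zero; refl)
  open MonoidSum +-commutativeMonoid public using (sum)
  open MonoidSum *-commutativeMonoid public using () renaming (sum to product)

  sumᴸ : List Carrier → Carrier
  sumᴸ = foldr _+_ 0#

  monomial : ∀ {n} → (Fin n → Carrier) → Subset n → Carrier
  monomial x S = product λ v → if does (v ∈? S) then x v else 1#

  elementary : ∀ {n} → (Fin n → Carrier) → ℕ → Carrier
  elementary {n} x j = sumᴸ (map (monomial x) (filter (λ S → ∣ S ∣ ℕₚ.≟ j) (subsets n)))

  private
    open SetoidReasoning setoid

    restricted : ∀ {n} → (Fin n → Carrier) → ℕ → List (Subset n) → Carrier
    restricted x j Ss = sumᴸ (map (monomial x) (filter (λ S → ∣ S ∣ ℕₚ.≟ j) Ss))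

    sumᴸ-++ : ∀ xs ys → sumᴸ (xs ++ ys) ≈ sumᴸ xs + sumᴸ ys
    sumᴸ-++ []       ys = sym (+-identityˡ _)
    sumᴸ-++ (x ∷ xs) ys = trans (+-congˡ (sumᴸ-++ xs ys)) (sym (+-assoc _ _ _))

    restricted-++ : ∀ {n} (x : Fin n → Carrier) j Ss Ts →
                    restricted x j (Ss ++ Ts) ≈ restricted x j Ss + restricted x j Ts
    restricted-++ x j Ss Ts
      rewrite filter-++ (λ S → ∣ S ∣ ℕₚ.≟ j) Ss Ts
            | map-++ (monomial x) (filter (λ S → ∣ S ∣ ℕₚ.≟ j) Ss)
                                  (filter (λ S → ∣ S ∣ ℕₚ.≟ j) Ts)
      = sumᴸ-++ (map (monomial x) (filter (λ S → ∣ S ∣ ℕₚ.≟ j) Ss)) _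

    restricted-outside : ∀ {n} (x : Fin (suc n) → Carrier) j Ss →
                         restricted x j (map (outside Vec.∷_) Ss) ≈ restricted (x ∘ suc) j Ss
    restricted-outside x j [] = CommutativeRing.refl R
    restricted-outside x j (S ∷ Ss) with does (∣ S ∣ ℕₚ.≟ j)
    ... | true  = +-cong (*-identityˡ _) (restricted-outside x j Ss)
    ... | false = restricted-outside x j Ss

    restricted-inside-0 : ∀ {n} (x : Fin (suc n) → Carrier) Ss →
                          restricted x 0 (map (inside Vec.∷_) Ss) ≈ 0#
    restricted-inside-0 x []       = CommutativeRing.refl R
    restricted-inside-0 x (S ∷ Ss) = restricted-inside-0 x Ss

    restricted-inside : ∀ {n} (x : Fin (suc n) → Carrier) j Ss →
                        restricted x (suc j) (map (inside Vec.∷_) Ss)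
                        ≈ x zero * restricted (x ∘ suc) j Ss
    restricted-inside x j [] = sym (zeroʳ _)
    restricted-inside x j (S ∷ Ss) with does (∣ S ∣ ℕₚ.≟ j)
    ... | true  = trans (+-congˡ (restricted-inside x j Ss)) (sym (distribˡ _ _ _))
    ... | false = restricted-inside x j Ss

    elementary-0 : ∀ {n} (x : Fin n → Carrier) → elementary x 0 ≈ 1#
    elementary-0 {zero}  x = +-identityʳ _
    elementary-0 {suc n} x = begin
      elementary x 0
        ≈⟨ restricted-++ x 0 (map (inside Vec.∷_) (subsets n)) _ ⟩
      restricted x 0 (map (inside Vec.∷_) (subsets n)) + restricted x 0 (map (outside Vec.∷_) (subsets n))
        ≈⟨ +-cong (restricted-inside-0 x (subsets n)) (restricted-outside x 0 (subsets n)) ⟩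
      0# + elementary (x ∘ suc) 0
        ≈⟨ +-identityˡ _ ⟩
      elementary (x ∘ suc) 0
        ≈⟨ elementary-0 (x ∘ suc) ⟩
      1# ∎

  elementary-1 : ∀ {n} (x : Fin n → Carrier) → elementary x 1 ≈ sum x
  elementary-1 {zero}  x = CommutativeRing.refl R
  elementary-1 {suc n} x = begin
    elementary x 1
      ≈⟨ restricted-++ x 1 (map (inside Vec.∷_) (subsets n)) _ ⟩
    restricted x 1 (map (inside Vec.∷_) (subsets n)) + restricted x 1 (map (outside Vec.∷_) (subsets n))
      ≈⟨ +-cong (restricted-inside x 0 (subsets n)) (restricted-outside x 1 (subsets n)) ⟩
    x zero * elementary (x ∘ suc) 0 + elementary (x ∘ suc) 1
      ≈⟨ +-cong (trans (*-congˡ (elementary-0 (x ∘ suc))) (*-identityʳ _)) (elementary-1 (x ∘ suc)) ⟩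
    sum x ∎

-- The ring of fractions p / q of a commutative ring, q ranging over the
-- cancellable elements (non-zero-divisors).  In an integral domain these
-- are exactly the nonzero elements, so for R = ℚ[V] this is the field of
-- rational functions ℚ(V).

module Fractions {c ℓ} (R : CommutativeRing c ℓ) where

  open CommutativeRing R hiding (zero; refl; isCommutativeRing)
  open Exp semiring using (_^_)
  open RingProperties ring using (-‿distribˡ-*)

  Regular : Carrier → Set (c ⊔ ℓ)
  Regular q = ∀ {a b} → q * a ≈ q * b → a ≈ b

  regular-1 : Regular 1#
  regular-1 1a≈1b = trans (sym (*-identityˡ _)) (trans 1a≈1b (*-identityˡ _))

  regular-* : ∀ {p q} → Regular p → Regular q → Regular (p * q)
  regular-* rp rq pqa≈pqb =
    rq (rp (trans (sym (*-assoc _ _ _)) (trans pqa≈pqb (*-assoc _ _ _))))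

  regular-^ : ∀ {q} → Regular q → ∀ m → Regular (q ^ m)
  regular-^ rq zero    = regular-1
  regular-^ rq (suc m) = regular-* rq (regular-^ rq m)

  record Fraction : Set (c ⊔ ℓ) where
    constructor fraction
    field
      num     : Carrier
      den     : Carrier
      regular : Regular den

  open Fraction

  infix 4 _≈ᶠ_
  record _≈ᶠ_ (x y : Fraction) : Set ℓ where
    constructor cross
    field uncross : num x * den y ≈ num y * den x

  open _≈ᶠ_

  infixl 6 _+ᶠ_
  infixl 7 _*ᶠ_
  infix  8 -ᶠ_

  _+ᶠ_ _*ᶠ_ : Fraction → Fraction → Fraction
  x +ᶠ y = fraction (num x * den y + num y * den x) (den x * den y)
                    (regular-* (regular x) (regular y))
  x *ᶠ y = fraction (num x * num y) (den x * den y) (regular-* (regular x) (regular y))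

  -ᶠ_ : Fraction → Fraction
  -ᶠ x = fraction (- num x) (den x) (regular x)

  ι : Carrier → Fraction
  ι p = fraction p 1# regular-1

  -- Integer powers of ι q for cancellable q.
  power : ∀ q → Regular q → ℤ → Fraction
  power q rq (+ m)    = ι (q ^ m)
  power q rq -[1+ m ] = fraction 1# (q ^ suc m) (regular-^ rq (suc m))

  private
    open SetoidReasoning setoid
    open RingSolver commutativeSemiring using (solve; _:=_; _:+_; _:*_; con)
    r = CommutativeRing.refl R

    ≈ᶠ-trans : ∀ {x y z} → x ≈ᶠ y → y ≈ᶠ z → x ≈ᶠ z
    ≈ᶠ-trans {x} {y} {z} (cross xy) (cross yz) = cross (regular y (begin
      den y * (num x * den z)
        ≈⟨ solve 3 (λ a b c → a :* (b :* c) := (b :* a) :* c) r (den y) (num x) (den z) ⟩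
      (num x * den y) * den z
        ≈⟨ *-congʳ xy ⟩
      (num y * den x) * den z
        ≈⟨ solve 3 (λ a b c → (a :* b) :* c := (a :* c) :* b) r (num y) (den x) (den z) ⟩
      (num y * den z) * den x
        ≈⟨ *-congʳ yz ⟩
      (num z * den y) * den x
        ≈⟨ solve 3 (λ a b c → (a :* b) :* c := b :* (a :* c)) r (num z) (den y) (den x) ⟩
      den y * (num z * den x) ∎))

    +ᶠ-cong : ∀ {x x′ y y′} → x ≈ᶠ x′ → y ≈ᶠ y′ → x +ᶠ y ≈ᶠ x′ +ᶠ y′
    +ᶠ-cong {x} {x′} {y} {y′} (cross xx) (cross yy) = cross (begin
      (num x * den y + num y * den x) * (den x′ * den y′)
        ≈⟨ solve 6 (λ a b c d e f → (a :* d :+ c :* b) :* (e :* f)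
                                    := (a :* e) :* (d :* f) :+ (c :* f) :* (b :* e)) r
             (num x) (den x) (num y) (den y) (den x′) (den y′) ⟩
      (num x * den x′) * (den y * den y′) + (num y * den y′) * (den x * den x′)
        ≈⟨ +-cong (*-congʳ xx) (*-congʳ yy) ⟩
      (num x′ * den x) * (den y * den y′) + (num y′ * den y) * (den x * den x′)
        ≈⟨ solve 6 (λ a b c d e f → (a :* b) :* (d :* f) :+ (c :* d) :* (b :* e)
                                    := (a :* f :+ c :* e) :* (b :* d)) r
             (num x′) (den x) (num y′) (den y) (den x′) (den y′) ⟩
      (num x′ * den y′ + num y′ * den x′) * (den x * den y) ∎)

    *ᶠ-cong : ∀ {x x′ y y′} → x ≈ᶠ x′ → y ≈ᶠ y′ → x *ᶠ y ≈ᶠ x′ *ᶠ y′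
    *ᶠ-cong {x} {x′} {y} {y′} (cross xx) (cross yy) = cross (begin
      (num x * num y) * (den x′ * den y′)
        ≈⟨ solve 4 (λ a b c d → (a :* b) :* (c :* d) := (a :* c) :* (b :* d)) r
             (num x) (num y) (den x′) (den y′) ⟩
      (num x * den x′) * (num y * den y′)
        ≈⟨ *-cong xx yy ⟩
      (num x′ * den x) * (num y′ * den y)
        ≈⟨ solve 4 (λ a b c d → (a :* b) :* (c :* d) := (a :* c) :* (b :* d)) r
             (num x′) (den x) (num y′) (den y) ⟩
      (num x′ * num y′) * (den x * den y) ∎)

    -ᶠ-cong : ∀ {x y} → x ≈ᶠ y → -ᶠ x ≈ᶠ -ᶠ y
    -ᶠ-cong (cross xy) = cross
      (trans (sym (-‿distribˡ-* _ _)) (trans (-‿cong xy) (-‿distribˡ-* _ _)))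

    -ᶠ-inverseˡ : ∀ x → -ᶠ x +ᶠ x ≈ᶠ ι 0#
    -ᶠ-inverseˡ x = cross (begin
      (- num x * den x + num x * den x) * 1#  ≈⟨ *-identityʳ _ ⟩
      - num x * den x + num x * den x         ≈⟨ distribʳ _ _ _ ⟨
      (- num x + num x) * den x               ≈⟨ *-congʳ (-‿inverseˡ _) ⟩
      0# * den x                              ≈⟨ zeroˡ _ ⟩
      0#                                      ≈⟨ zeroˡ _ ⟨
      0# * (den x * den x)                    ∎)

    +ᶠ-comm : ∀ x y → x +ᶠ y ≈ᶠ y +ᶠ x
    +ᶠ-comm x y = cross
      (solve 4 (λ a b c d → (a :* d :+ c :* b) :* (d :* b)
                            := (c :* b :+ a :* d) :* (b :* d)) r
        (num x) (den x) (num y) (den y))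

    *ᶠ-comm : ∀ x y → x *ᶠ y ≈ᶠ y *ᶠ x
    *ᶠ-comm x y = cross
      (solve 4 (λ a b c d → (a :* c) :* (d :* b) := (c :* a) :* (b :* d)) r
        (num x) (den x) (num y) (den y))

    +ᶠ-identityˡ : ∀ x → ι 0# +ᶠ x ≈ᶠ x
    +ᶠ-identityˡ x = cross
      (solve 2 (λ a b → (con 0 :* b :+ a :* con 1) :* b := a :* (con 1 :* b)) r
        (num x) (den x))

    *ᶠ-identityˡ : ∀ x → ι 1# *ᶠ x ≈ᶠ x
    *ᶠ-identityˡ x = cross
      (solve 2 (λ a b → (con 1 :* a) :* b := a :* (con 1 :* b)) r (num x) (den x))

    *ᶠ-distribˡ : ∀ x y z → x *ᶠ (y +ᶠ z) ≈ᶠ x *ᶠ y +ᶠ x *ᶠ z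
    *ᶠ-distribˡ x y z = cross
      (solve 6 (λ a b c d e f →
         (a :* (c :* f :+ e :* d)) :* ((b :* d) :* (b :* f))
         := ((a :* c) :* (b :* f) :+ (a :* e) :* (b :* d)) :* (b :* (d :* f))) r
        (num x) (den x) (num y) (den y) (num z) (den z))

  isCommutativeRing : IsCommutativeRing _≈ᶠ_ _+ᶠ_ _*ᶠ_ -ᶠ_ (ι 0#) (ι 1#)
  isCommutativeRing = record
    { isRing = record
      { +-isAbelianGroup = record
        { isGroup = record
          { isMonoid = record
            { isSemigroup = record
              { isMagma = record
                { isEquivalence = record
                  { refl  = cross r
                  ; sym   = λ (cross xy) → cross (sym xy)
                  ; trans = ≈ᶠ-trans
                  }
                ; ∙-cong = +ᶠ-cong
                }
              ; assoc = λ x y z → cross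
                  (solve 6 (λ a b c d e f →
                     ((a :* d :+ c :* b) :* f :+ e :* (b :* d)) :* (b :* (d :* f))
                     := (a :* (d :* f) :+ (c :* f :+ e :* d) :* b) :* ((b :* d) :* f)) r
                    (num x) (den x) (num y) (den y) (num z) (den z))
              }
            ; identity = +ᶠ-identityˡ , λ x → ≈ᶠ-trans (+ᶠ-comm x (ι 0#)) (+ᶠ-identityˡ x)
            }
          ; inverse = -ᶠ-inverseˡ , λ x → ≈ᶠ-trans (+ᶠ-comm x (-ᶠ x)) (-ᶠ-inverseˡ x)
          ; ⁻¹-cong = -ᶠ-cong
          }
        ; comm = +ᶠ-comm
        }
      ; *-cong = *ᶠ-cong
      ; *-assoc = λ x y z → cross
          (solve 6 (λ a b c d e f →
             ((a :* c) :* e) :* (b :* (d :* f)) := (a :* (c :* e)) :* ((b :* d) :* f)) r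
            (num x) (den x) (num y) (den y) (num z) (den z))
      ; *-identity = *ᶠ-identityˡ , λ x → ≈ᶠ-trans (*ᶠ-comm x (ι 1#)) (*ᶠ-identityˡ x)
      ; distrib = *ᶠ-distribˡ , λ x y z →
          ≈ᶠ-trans (*ᶠ-comm (y +ᶠ z) x)
          (≈ᶠ-trans (*ᶠ-distribˡ x y z) (+ᶠ-cong (*ᶠ-comm x y) (*ᶠ-comm x z)))
      }
    ; *-comm = *ᶠ-comm
    }

  commutativeRing : CommutativeRing (c ⊔ ℓ) ℓ
  commutativeRing = record { isCommutativeRing = isCommutativeRing }

-- The polynomial ring ℚ[V], as the free commutative ℚ-algebra on V:
-- expressions modulo the congruence generated by the commutative ring
-- axioms and the arithmetic of constants.

module Polynomials (V : Set) where

  infix  4 _≈_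
  infixl 6 _+_
  infixl 7 _*_
  infix  8 -_

  data Polynomial : Set where
    con     : ℚ → Polynomial
    var     : V → Polynomial
    _+_ _*_ : Polynomial → Polynomial → Polynomial
    -_      : Polynomial → Polynomial

  0# 1# : Polynomial
  0# = con 0ℚ
  1# = con 1ℚ

  data _≈_ : Polynomial → Polynomial → Set where
    ≈-refl      : ∀ {p} → p ≈ p
    ≈-sym       : ∀ {p q} → p ≈ q → q ≈ p
    ≈-trans     : ∀ {p q r} → p ≈ q → q ≈ r → p ≈ r
    +-cong      : ∀ {p p′ q q′} → p ≈ p′ → q ≈ q′ → p + q ≈ p′ + q′
    *-cong      : ∀ {p p′ q q′} → p ≈ p′ → q ≈ q′ → p * q ≈ p′ * q′
    -‿cong      : ∀ {p q} → p ≈ q → - p ≈ - q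
    +-assoc     : ∀ p q r → (p + q) + r ≈ p + (q + r)
    +-comm      : ∀ p q → p + q ≈ q + p
    +-identityˡ : ∀ p → 0# + p ≈ p
    -‿inverseˡ  : ∀ p → - p + p ≈ 0#
    *-assoc     : ∀ p q r → (p * q) * r ≈ p * (q * r)
    *-comm      : ∀ p q → p * q ≈ q * p
    *-identityˡ : ∀ p → 1# * p ≈ p
    *-distribˡ  : ∀ p q r → p * (q + r) ≈ p * q + p * r
    con-+       : ∀ a b → con (a ℚ.+ b) ≈ con a + con b
    con-*       : ∀ a b → con (a ℚ.* b) ≈ con a * con b

  isCommutativeRing : IsCommutativeRing _≈_ _+_ _*_ -_ 0# 1#
  isCommutativeRing = record
    { isRing = record
      { +-isAbelianGroup = record
        { isGroup = record
          { isMonoid = record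
            { isSemigroup = record
              { isMagma = record
                { isEquivalence = record { refl = ≈-refl ; sym = ≈-sym ; trans = ≈-trans }
                ; ∙-cong = +-cong
                }
              ; assoc = +-assoc
              }
            ; identity = +-identityˡ , λ p → ≈-trans (+-comm p 0#) (+-identityˡ p)
            }
          ; inverse = -‿inverseˡ , λ p → ≈-trans (+-comm p (- p)) (-‿inverseˡ p)
          ; ⁻¹-cong = -‿cong
          }
        ; comm = +-comm
        }
      ; *-cong = *-cong
      ; *-assoc = *-assoc
      ; *-identity = *-identityˡ , λ p → ≈-trans (*-comm p 1#) (*-identityˡ p)
      ; distrib = *-distribˡ , λ p q r →
          ≈-trans (*-comm (q + r) p)
          (≈-trans (*-distribˡ p q r) (+-cong (*-comm p q) (*-comm p r)))
      }
    ; *-comm = *-comm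
    }

  commutativeRing : CommutativeRing 0ℓ 0ℓ
  commutativeRing = record { isCommutativeRing = isCommutativeRing }

  open Fractions commutativeRing using (Regular)

  -- Let σ be the endomorphism sending v₀ to v₀ - a and fixing the other
  -- variables, and ∂ the σ-twisted derivation (p - σ p) / a.  If ∂ a ≈ 1
  -- then σ a ≈ 0, hence ∂ (a * p) ≈ p and a is cancellable.
  module Division (_≟_ : DecidableEquality V) (v₀ : V) (a : Polynomial) where

    open CommutativeRing commutativeRing
      using (setoid; +-congʳ; +-congˡ; *-congʳ; *-congˡ; zeroˡ; +-identityʳ;
             -‿inverseʳ; +-abelianGroup; ring; commutativeSemiring)
    open SetoidReasoning setoid
    open AbelianGroupProperties +-abelianGroup
      using (⁻¹-∙-comm; identityˡ-unique; ε⁻¹≈ε)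
    open RingProperties ring using (-‿distribʳ-*)
    open RingSolver commutativeSemiring
      using (solve; _:=_; _:+_; _:*_) renaming (con to ⟨_⟩)

    σ : Polynomial → Polynomial
    σ (con c) = con c
    σ (var v) = if does (v ≟ v₀) then var v + - a else var v
    σ (p + q) = σ p + σ q
    σ (p * q) = σ p * σ q
    σ (- p)   = - σ p

    ∂ : Polynomial → Polynomial
    ∂ (con c) = 0#
    ∂ (var v) = if does (v ≟ v₀) then 1# else 0#
    ∂ (p + q) = ∂ p + ∂ q
    ∂ (p * q) = ∂ p * q + σ p * ∂ q
    ∂ (- p)   = - ∂ p

    expand : ∀ p → p ≈ σ p + a * ∂ p
    expand (con c) =
      solve 2 (λ c a → c := c :+ a :* ⟨ 0 ⟩) ≈-refl (con c) a
    expand (var v) with does (v ≟ v₀)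
    ... | false = solve 2 (λ x a → x := x :+ a :* ⟨ 0 ⟩) ≈-refl (var v) a
    ... | true  = begin
      var v                     ≈⟨ +-identityʳ _ ⟨
      var v + 0#                ≈⟨ +-congˡ (-‿inverseˡ a) ⟨
      var v + (- a + a)         ≈⟨ solve 3 (λ x b a → x :+ (b :+ a) := (x :+ b) :+ a :* ⟨ 1 ⟩) ≈-refl (var v) (- a) a ⟩
      (var v + - a) + a * 1#    ∎
    expand (p + q) = ≈-trans (+-cong (expand p) (expand q))
      (solve 5 (λ s t a x y → (s :+ a :* x) :+ (t :+ a :* y) := (s :+ t) :+ a :* (x :+ y))
        ≈-refl (σ p) (σ q) a (∂ p) (∂ q))
    expand (p * q) = begin
      p * q
        ≈⟨ *-congʳ (expand p) ⟩
      (σ p + a * ∂ p) * q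
        ≈⟨ solve 4 (λ s a x q → (s :+ a :* x) :* q := s :* q :+ a :* (x :* q)) ≈-refl (σ p) a (∂ p) q ⟩
      σ p * q + a * (∂ p * q)
        ≈⟨ +-congʳ (*-congˡ (expand q)) ⟩
      σ p * (σ q + a * ∂ q) + a * (∂ p * q)
        ≈⟨ solve 5 (λ s t a y z → s :* (t :+ a :* y) :+ a :* z := s :* t :+ a :* (z :+ s :* y))
             ≈-refl (σ p) (σ q) a (∂ q) (∂ p * q) ⟩
      σ p * σ q + a * (∂ p * q + σ p * ∂ q) ∎
    expand (- p) = begin
      - p                     ≈⟨ -‿cong (expand p) ⟩
      - (σ p + a * ∂ p)       ≈⟨ ⁻¹-∙-comm _ _ ⟨
      - σ p + - (a * ∂ p)     ≈⟨ +-congˡ (-‿distribʳ-* _ _) ⟩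
      - σ p + a * - ∂ p       ∎

    σ-cong : ∀ {p q} → p ≈ q → σ p ≈ σ q
    σ-cong ≈-refl            = ≈-refl
    σ-cong (≈-sym e)         = ≈-sym (σ-cong e)
    σ-cong (≈-trans e f)     = ≈-trans (σ-cong e) (σ-cong f)
    σ-cong (+-cong e f)      = +-cong (σ-cong e) (σ-cong f)
    σ-cong (*-cong e f)      = *-cong (σ-cong e) (σ-cong f)
    σ-cong (-‿cong e)        = -‿cong (σ-cong e)
    σ-cong (+-assoc _ _ _)   = +-assoc _ _ _
    σ-cong (+-comm _ _)      = +-comm _ _
    σ-cong (+-identityˡ _)   = +-identityˡ _
    σ-cong (-‿inverseˡ _)    = -‿inverseˡ _
    σ-cong (*-assoc _ _ _)   = *-assoc _ _ _
    σ-cong (*-comm _ _)      = *-comm _ _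
    σ-cong (*-identityˡ _)   = *-identityˡ _
    σ-cong (*-distribˡ _ _ _) = *-distribˡ _ _ _
    σ-cong (con-+ _ _)       = con-+ _ _
    σ-cong (con-* _ _)       = con-* _ _

    ∂-cong : ∀ {p q} → p ≈ q → ∂ p ≈ ∂ q
    ∂-cong ≈-refl          = ≈-refl
    ∂-cong (≈-sym e)       = ≈-sym (∂-cong e)
    ∂-cong (≈-trans e f)   = ≈-trans (∂-cong e) (∂-cong f)
    ∂-cong (+-cong e f)    = +-cong (∂-cong e) (∂-cong f)
    ∂-cong (*-cong e f)    = +-cong (*-cong (∂-cong e) f) (*-cong (σ-cong e) (∂-cong f))
    ∂-cong (-‿cong e)      = -‿cong (∂-cong e)
    ∂-cong (+-assoc _ _ _) = +-assoc _ _ _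
    ∂-cong (+-comm _ _)    = +-comm _ _
    ∂-cong (+-identityˡ _) = +-identityˡ _
    ∂-cong (-‿inverseˡ _)  = -‿inverseˡ _
    ∂-cong (*-assoc p q r) =
      solve 7 (λ x y z s t q r → (x :* q :+ s :* y) :* r :+ (s :* t) :* z
                                 := x :* (q :* r) :+ s :* (y :* r :+ t :* z))
        ≈-refl (∂ p) (∂ q) (∂ r) (σ p) (σ q) q r
    ∂-cong (*-comm p q)    = begin
      ∂ p * q + σ p * ∂ q
        ≈⟨ +-congʳ (*-congˡ (expand q)) ⟩
      ∂ p * (σ q + a * ∂ q) + σ p * ∂ q
        ≈⟨ solve 5 (λ x y s t a → x :* (t :+ a :* y) :+ s :* y := y :* (s :+ a :* x) :+ t :* x)
             ≈-refl (∂ p) (∂ q) (σ p) (σ q) a ⟩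
      ∂ q * (σ p + a * ∂ p) + σ q * ∂ p
        ≈⟨ +-congʳ (*-congˡ (expand p)) ⟨
      ∂ q * p + σ q * ∂ p ∎
    ∂-cong (*-identityˡ p) =
      solve 2 (λ x p → ⟨ 0 ⟩ :* p :+ ⟨ 1 ⟩ :* x := x) ≈-refl (∂ p) p
    ∂-cong (*-distribˡ p q r) =
      solve 6 (λ x y z s q r → x :* (q :+ r) :+ s :* (y :+ z)
                               := (x :* q :+ s :* y) :+ (x :* r :+ s :* z))
        ≈-refl (∂ p) (∂ q) (∂ r) (σ p) q r
    ∂-cong (con-+ _ _)     = ≈-sym (+-identityˡ 0#)
    ∂-cong (con-* c d)     =
      solve 2 (λ c d → ⟨ 0 ⟩ := ⟨ 0 ⟩ :* d :+ c :* ⟨ 0 ⟩) ≈-refl (con c) (con d)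

    cancellable : ∂ a ≈ 1# → Regular a
    cancellable ∂a≈1 {p} {q} ap≈aq =
      ≈-trans (≈-sym (∂a* p)) (≈-trans (∂-cong ap≈aq) (∂a* q))
      where
      σa≈0 : σ a ≈ 0#
      σa≈0 = identityˡ-unique _ _ (begin
        σ a + a        ≈⟨ solve 2 (λ s a → s :+ a := s :+ a :* ⟨ 1 ⟩) ≈-refl (σ a) a ⟩
        σ a + a * 1#   ≈⟨ +-congˡ (*-congˡ ∂a≈1) ⟨
        σ a + a * ∂ a  ≈⟨ expand a ⟨
        a              ∎)

      ∂a* : ∀ p → ∂ (a * p) ≈ p
      ∂a* p = begin
        ∂ a * p + σ a * ∂ p  ≈⟨ +-cong (*-congʳ ∂a≈1) (*-congʳ σa≈0) ⟩
        1# * p + 0# * ∂ p    ≈⟨ solve 2 (λ p x → ⟨ 1 ⟩ :* p :+ ⟨ 0 ⟩ :* x := p) ≈-refl p (∂ p) ⟩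
        p                    ∎

  elementary-regular : DecidableEquality V → ∀ m .{{_ : NonZero m}} (y : Fin m → V) →
                       (∀ {u v} → y u ≡ y v → u ≡ v) →
                       Regular (FiniteSums.elementary commutativeRing (var ∘ y) 1)
  elementary-regular _≟_ zero {{nz}} y inj = contradiction refl (ℕ.≢-nonZero⁻¹ 0 {{nz}})
  elementary-regular _≟_ (suc m)     y inj =
    cancellable (≈-trans (∂-cong (elementary-1 (var ∘ y))) ∂-sum)
    where
    open FiniteSums commutativeRing using (elementary; elementary-1; sum)
    open Division _≟_ (y zero) (elementary (var ∘ y) 1)

    ∂-others : ∀ {l} (z : Fin l → V) → (∀ v → z v ≢ y zero) → ∂ (sum (var ∘ z)) ≈ 0#
    ∂-others {zero}  z z≢ = ≈-refl
    ∂-others {suc l} z z≢ rewrite dec-false (z zero ≟ y zero) (z≢ zero) =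
      ≈-trans (+-identityˡ _) (∂-others (z ∘ suc) (z≢ ∘ suc))

    suc≢zero : ∀ v → y (suc v) ≢ y zero
    suc≢zero v eq with () ← inj eq

    ∂-sum : ∂ (sum (var ∘ y)) ≈ 1#
    ∂-sum rewrite dec-true (y zero ≟ y zero) refl =
      ≈-trans (+-cong ≈-refl (∂-others (y ∘ suc) suc≢zero))
              (≈-trans (+-comm 1# 0#) (+-identityˡ 1#))

record Partition (N : ℕ) : Set where
  field
    parts      : List ℕ
    positive   : All (1 ≤_) parts
    decreasing : Linked _≥_ parts
    total      : sumℕ parts ≡ N

multiplicity : ∀ {N} → Partition N → ℕ → ℕ
multiplicity lam l = length (filter (l ℕₚ.≟_) (Partition.parts lam))

productℕ : ∀ {n} → (Fin n → ℕ) → ℕ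
productℕ = MonoidSum.sum ℕₚ.*-1-commutativeMonoid

factor : ∀ {N} → Partition N → ℕ → ℕ
factor lam l = l ℕ.^ m ℕ.* m !
  where m = multiplicity lam l

-- ∏_{l=1}^N l^{m_l} m_l!, the centralizer order of a permutation of cycle type lam.
centralizer : ∀ {N} → Partition N → ℕ
centralizer {N} lam = productℕ {N} λ i → factor lam (suc (toℕ i))

centralizer-nonZero : ∀ {N} (lam : Partition N) → NonZero (centralizer lam)
centralizer-nonZero {N} lam =
  productℕ-nonZero {N} (λ i → factor lam (suc (toℕ i))) λ i →
    factor-nonZero (suc (toℕ i)) (multiplicity lam (suc (toℕ i)))
  where
  factor-nonZero : ∀ l m → .{{_ : NonZero l}} → NonZero (l ℕ.^ m ℕ.* m !)
  factor-nonZero l m = ℕₚ.m*n≢0 (l ℕ.^ m) (m !) {{ℕₚ.m^n≢0 l m}} {{m ℕₚ.!≢0}}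

  productℕ-nonZero : ∀ {n} (f : Fin n → ℕ) → (∀ i → NonZero (f i)) → NonZero (productℕ f)
  productℕ-nonZero {zero}  f nz = _
  productℕ-nonZero {suc n} f nz =
    ℕₚ.m*n≢0 (f zero) _ {{nz zero}} {{productℕ-nonZero (f ∘ suc) (nz ∘ suc)}}

module _ {n : ℕ} where

  open Endo (Fin n) using (_^_)

  image : (Fin n → Fin n) → Subset n
  image g = ⋃ (map (λ v → ⁅ g v ⁆) (allFin n))

  StabilizesTo : (Fin n → Fin n) → Subset n → Set
  StabilizesTo g S = ∃ λ M → ∀ m → M ≤ m → image (g ^ m) ≡ S

  PermutesOn : (Fin n → Fin n) → Subset n → Set
  PermutesOn g S = (∀ v → v ∈ S → g v ∈ S)
                 × (∀ u v → u ∈ S → v ∈ S → g u ≡ g v → u ≡ v)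
                 × (∀ v → v ∈ S → ∃ λ u → u ∈ S × g u ≡ v)

  -- The underlying set of a cycle of length l determines the cycle, so
  -- cycles can be counted as subsets.
  IsCycle : (Fin n → Fin n) → ℕ → Subset n → Set
  IsCycle g l C = ∣ C ∣ ≡ l
                × ∃ λ v → (g ^ l) v ≡ v × C ≡ ⋃ (map (λ j → ⁅ (g ^ j) v ⁆) (upTo l))

  _≟ˢ_ : DecidableEquality (Subset n)
  _≟ˢ_ = Vecₚ.≡-dec Boolₚ._≟_

  isCycle? : ∀ g l C → Dec (IsCycle g l C)
  isCycle? g l C =
    (∣ C ∣ ℕₚ.≟ l) ×-dec any? λ v → ((g ^ l) v ≟ᶠ v) ×-dec (C ≟ˢ _)

  cycleCount : (Fin n → Fin n) → Subset n → ℕ → ℕ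
  cycleCount g S l = length (filter (λ C → (C ⊆? S) ×-dec isCycle? g l C) (subsets n))

  HasCycleType : ∀ {N} → (Fin n → Fin n) → Subset n → Partition N → Set
  HasCycleType {N} g S lam =
    ∀ {l} → l < suc N → 1 ≤ l → cycleCount g S l ≡ multiplicity lam l

  CyclicOn : ∀ {N} → (Fin n → Fin n) → Partition N → Subset n → Set
  CyclicOn {N} g lam S = ∣ S ∣ ≡ N × PermutesOn g S × HasCycleType g S lam

  EventuallyCyclic : ∀ {N} → Partition N → (Fin n → Fin n) → Set
  EventuallyCyclic lam g = ∃ λ S → StabilizesTo g S × CyclicOn g lam S

  permutesOn? : ∀ g S → Dec (PermutesOn g S)
  permutesOn? g S =
    all? (λ v → (v ∈? S) →-dec (g v ∈? S))
    ×-dec all? (λ u → all? λ v →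
      (u ∈? S) →-dec ((v ∈? S) →-dec ((g u ≟ᶠ g v) →-dec (u ≟ᶠ v))))
    ×-dec all? (λ v → (v ∈? S) →-dec any? λ u → (u ∈? S) ×-dec (g u ≟ᶠ v))

  cyclicOn? : ∀ {N} g (lam : Partition N) S → Dec (CyclicOn g lam S)
  cyclicOn? {N} g lam S =
    (∣ S ∣ ℕₚ.≟ N) ×-dec permutesOn? g S
    ×-dec ℕₚ.allUpTo?
      (λ l → (1 ℕₚ.≤? l) →-dec (cycleCount g S l ℕₚ.≟ multiplicity lam l)) (suc N)

  -- The images of the powers of g are constant from the n-th one on.
  private
    ∈-⋃⁻ : ∀ (h : Fin n → Fin n) vs {x} → x ∈ ⋃ (map (λ v → ⁅ h v ⁆) vs) → ∃ λ v → h v ≡ x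
    ∈-⋃⁻ h []       x∈ = contradiction x∈ ∉⊥
    ∈-⋃⁻ h (v ∷ vs) x∈ with x∈p∪q⁻ ⁅ h v ⁆ _ x∈
    ... | inj₁ x∈v  = v , ≡.sym (x∈⁅y⁆⇒x≡y (h v) x∈v)
    ... | inj₂ x∈vs = ∈-⋃⁻ h vs x∈vs

    ∈-⋃⁺ : ∀ (h : Fin n → Fin n) {vs v} → v ∈ᴸ vs → h v ∈ ⋃ (map (λ v → ⁅ h v ⁆) vs)
    ∈-⋃⁺ h {v ∷ vs} (here refl) = p⊆p∪q _ (x∈⁅x⁆ (h v))
    ∈-⋃⁺ h {v ∷ vs} (there v∈)  = q⊆p∪q ⁅ h v ⁆ _ (∈-⋃⁺ h v∈)

    ^-commute : ∀ (g : Fin n → Fin n) m v → (g ^ m) (g v) ≡ g ((g ^ m) v)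
    ^-commute g zero    v = refl
    ^-commute g (suc m) v = cong g (^-commute g m v)

  ∈-image⁻ : ∀ h {x} → x ∈ image h → ∃ λ v → h v ≡ x
  ∈-image⁻ h = ∈-⋃⁻ h (allFin n)

  ∈-image⁺ : ∀ h v → h v ∈ image h
  ∈-image⁺ h v = ∈-⋃⁺ h (∈-allFin v)

  private
    module _ (g : Fin n → Fin n) where

      I : ℕ → Subset n
      I m = image (g ^ m)

      I-decreasing : ∀ m → I (suc m) ⊆ I m
      I-decreasing m x∈ with v , refl ← ∈-image⁻ (g ^ suc m) x∈ =
        subst (_∈ I m) (^-commute g m v) (∈-image⁺ (g ^ m) (g v))

      I-propagate : ∀ m → I m ⊆ I (suc m) → I (suc m) ⊆ I (suc (suc m))
      I-propagate m I⊆ x∈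
        with v , refl ← ∈-image⁻ (g ^ suc m) x∈
        with u , eq ← ∈-image⁻ (g ^ suc m) (I⊆ (∈-image⁺ (g ^ m) v)) =
        subst (_∈ I (suc (suc m))) (cong g eq) (∈-image⁺ (g ^ suc (suc m)) u)

      I-bound : ∀ m → I m ⊆ I (suc m) ⊎ ∣ I m ∣ ℕ.+ m ≤ n
      I-bound zero = inj₂ (subst (_≤ n) (≡.sym (ℕₚ.+-identityʳ _)) (∣p∣≤n (I 0)))
      I-bound (suc m) with I-bound m
      ... | inj₁ I⊆ = inj₁ (I-propagate m I⊆)
      ... | inj₂ bound with I (suc m) ⊂? I m
      ...   | yes I⊂ = inj₂ (ℕₚ.≤-trans
                (subst (_≤ ∣ I m ∣ ℕ.+ m) (≡.sym (ℕₚ.+-suc _ m))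
                  (ℕₚ.+-monoˡ-≤ m (p⊂q⇒∣p∣<∣q∣ I⊂)))
                bound)
      ...   | no  I⊄ = inj₁ (I-propagate m I⊆)
        where
        I⊆ : I m ⊆ I (suc m)
        I⊆ {x} x∈ with x ∈? I (suc m)
        ... | yes x∈′ = x∈′
        ... | no  x∉′ = contradiction ((λ {x} → I-decreasing m {x}) , x , x∈ , x∉′) I⊄

      I-stable-n : I n ⊆ I (suc n)
      I-stable-n with I-bound n
      ... | inj₁ I⊆    = I⊆
      ... | inj₂ bound = λ x∈ → contradiction
        (ℕₚ.≤-trans (ℕₚ.+-monoˡ-≤ n (nonempty x∈)) bound) (ℕₚ.<-irrefl refl)
        where
        nonempty : ∀ {x} → x ∈ I n → 1 ≤ ∣ I n ∣
        nonempty {x} x∈ = ℕₚ.≤-trans (s≤s z≤n)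
          (p⊂q⇒∣p∣<∣q∣ {p = ⊥} ((λ x∈⊥ → contradiction x∈⊥ ∉⊥) , x , x∈ , ∉⊥))

      I-stable : ∀ d → I (d ℕ.+ n) ⊆ I (suc d ℕ.+ n)
      I-stable zero    = I-stable-n
      I-stable (suc d) = I-propagate (d ℕ.+ n) (I-stable d)

      I-constant : ∀ d → I (d ℕ.+ n) ≡ I n
      I-constant zero    = refl
      I-constant (suc d) =
        ≡.trans (⊆-antisym (I-decreasing (d ℕ.+ n)) (I-stable d)) (I-constant d)

  stabilizes : ∀ g → StabilizesTo g (image (g ^ n))
  stabilizes g = n , λ m n≤m →
    subst (λ m → image (g ^ m) ≡ image (g ^ n)) (ℕₚ.m∸n+n≡m n≤m) (I-constant g (m ℕ.∸ n))

  stabilizesTo-unique : ∀ {g S T} → StabilizesTo g S → StabilizesTo g T → S ≡ T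
  stabilizesTo-unique (M , p) (M′ , q) =
    ≡.trans (≡.sym (p (M ℕ.⊔ M′) (ℕₚ.m≤m⊔n M M′))) (q (M ℕ.⊔ M′) (ℕₚ.m≤n⊔m M M′))

  eventuallyCyclic? : ∀ {N} (lam : Partition N) g → Dec (EventuallyCyclic lam g)
  eventuallyCyclic? lam g = map′
    (λ c → _ , stabilizes g , c)
    (λ (S , s , c) → subst (CyclicOn g lam) (stabilizesTo-unique {g} s (stabilizes g)) c)
    (cyclicOn? g lam (image (g ^ n)))

module _ {k : ℕ} .{{_ : NonZero k}} where

  first : Fin k
  first = 0 mod k

  next prev : Fin k → Fin k
  next i = suc (toℕ i) mod k
  prev i = (toℕ i ℕ.+ ℕ.pred k) mod k

  shift : ℕ → Fin k → Fin k
  shift zero    i = i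
  shift (suc m) i = next (shift m i)

  private
    mod-cong : ∀ a b → a % k ≡ b % k → a mod k ≡ b mod k
    mod-cong a b eq = toℕ-injective
      (≡.trans (toℕ-fromℕ< (m%n<n a k)) (≡.trans eq (≡.sym (toℕ-fromℕ< (m%n<n b k)))))

    shift-first : ∀ m → shift m first ≡ m mod k
    shift-first zero    = refl
    shift-first (suc m) = ≡.trans (cong next (shift-first m)) (mod-cong _ _ (begin
      suc (toℕ (m mod k)) % k      ≡⟨ cong (λ t → suc t % k) (toℕ-fromℕ< (m%n<n m k)) ⟩
      suc (m % k) % k              ≡⟨ %-distribˡ-+ 1 (m % k) k ⟩
      (1 % k ℕ.+ m % k % k) % k    ≡⟨ cong (λ t → (1 % k ℕ.+ t) % k) (m%n%n≡m%n m k) ⟩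
      (1 % k ℕ.+ m % k) % k        ≡⟨ %-distribˡ-+ 1 m k ⟨
      suc m % k                    ∎))
      where open ≡.≡-Reasoning

  shift-k-first : shift k first ≡ first
  shift-k-first = ≡.trans (shift-first k) (mod-cong k 0 (≡.trans (n%n≡0 k) (≡.sym (m<n⇒m%n≡m (ℕ.>-nonZero⁻¹ k)))))

-- X_{i+1} is Fin (n i) for i = 0, …, k-1, so that X_1 is indexed by first;
-- tagging with the index makes the sets disjoint.

module Tuples (k : ℕ) .{{_ : NonZero k}} (n : Fin k → ℕ) where

  Vertex : Set
  Vertex = Σ (Fin k) λ i → Fin (n i)

  Tuple : Set
  Tuple = ∀ i → Fin (n i) → Fin (n (next i))

  tuples : List Tuple
  tuples = choices λ i → choices λ _ → allFin (n (next i))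

  -- Apply m successive maps f_i, f_{i+1}, …, starting at index i.
  run : Tuple → ∀ m {i} → Fin (n i) → Fin (n (shift m i))
  run f zero    v = v
  run f (suc m) v = f _ (run f m v)

  -- The composition f_k ⋯ f_1 as a self-map of X_1.
  composite : Tuple → Fin (n first) → Fin (n first)
  composite f v = subst (Fin ∘ n) shift-k-first (run f k v)

  EC : ∀ {N} → Partition N → List Tuple
  EC lam = filter (λ f → eventuallyCyclic? lam (composite f)) tuples

  open Polynomials Vertex using (Polynomial; var)
  ℚ[x] = Polynomials.commutativeRing Vertex
  ℚ⟨x⟩ = Fractions.commutativeRing ℚ[x]

  open FiniteSums ℚ[x]
  open Fractions ℚ[x] public using (Fraction; Regular; ι; power)
  open CommutativeRing ℚ⟨x⟩ public using (_≈_; _*_; _-_)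

  x : ∀ i → Fin (n i) → Polynomial
  x i v = var (i , v)

  weight : Tuple → Polynomial
  weight f = product λ i → product λ v → x (next i) (f i v)

  weightSum : ∀ {N} → Partition N → Polynomial
  weightSum lam = sumᴸ (map weight (EC lam))

  e : ℕ → Fin k → Polynomial
  e j i = elementary (x i) j

  scalar : ℚ → Fraction
  scalar c = ι (Polynomials.con c)

  e₁-regular : (∀ i → NonZero (n i)) → ∀ i → Regular (e 1 i)
  e₁-regular nonempty i = Polynomials.elementary-regular Vertex
    (Productₚ.≡-dec _≟ᶠ_ _≟ᶠ_) (n i) {{nonempty i}} (i ,_) λ { refl → refl }

fromℕ : ℕ → ℚ
fromℕ m = (+ m) ℚ./ 1

infixr 8 _^ᶻ_
_^ᶻ_ : (n : ℕ) → ℤ → .{{_ : NonZero n}} → ℚ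
n ^ᶻ (+ m)    = fromℕ (n ℕ.^ m)
n ^ᶻ -[1+ m ] = ((+ 1) ℚ./ (n ℕ.^ suc m)) {{ℕₚ.m^n≢0 n (suc m)}}

{-# OPTIONS --safe #-}
module Submission where

-- Dividing the variables of X_i by e₁(X_i) turns the weight of f into a
-- probability: the values f_i(v) become independent random points.  Below, m(S)
-- is the monomial of a family S = (S_i), e_j(X_i) is formed from these normalized
-- variables, and F(R) is the probability that every vertex eventually enters R.
-- For fixed S every f has exactly one R ⊇ S such that f permutes R ∖ S and every
-- vertex eventually enters R: the family R ∖ S consists of the recurrent points
-- whose cycle avoids S.  The two events are independent, so summing over R gives
--   1 = Σ_{R ⊇ S} P(f permutes R ∖ S) F(R),
-- and P(f permutes T) = j!^k m(T) if |T_i| = j for all i.  Multiplying by m(S) and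
-- summing over the S with all |S_i| = N yields
--   N!^k ∏ e_N(X_i) = Σ_{j ≥ N} j!^k Σ_{|R_i| = j} m(R) F(R),
-- and subtracting the same identity for N + 1 isolates the term j = N.  The maps
-- with recurrent family R have composites of cycle type λ in the proportion
-- 1 / ∏ l^{m_l} m_l!, which follows by removing a marked cycle.

open import Defs
open import Level using (_⊔_)
open import Algebra.Bundles using (CommutativeRing)
import Algebra.Properties.CommutativeMonoid.Sum as MonoidSum
import Algebra.Properties.Ring as RingProperties
import Algebra.Properties.Semiring.Exp as Exp
import Algebra.Properties.Semiring.Mult as SemiringMult
import Algebra.Properties.Semiring.Sum as SemiringSum
import Algebra.Solver.Ring.NaturalCoefficients.Default as RingSolver
open import Data.Bool.Base using (Bool; true; false; if_then_else_)
open import Data.Fin.Base using (Fin; zero; suc; toℕ; fromℕ<; combine; inject≤)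
open import Data.Fin.Permutation using (permutation)
open import Data.Fin.Properties using (∀-cons; all?; any?; suc-injective; toℕ-fromℕ<; toℕ-injective; toℕ<n; pigeonhole; combine-injective; inject≤-injective; ¬∀⟶∃¬) renaming (_≟_ to _≟ᶠ_)
open import Data.Fin.Subset using (Subset; inside; outside; _∈_; _∉_; _⊆_; _─_; _∪_; ∣_∣; ⁅_⁆; ⊥; ⊤; ⋃) renaming (_-_ to _∖_)
open import Data.Fin.Subset.Properties
open import Data.Integer.Base as ℤ using (ℤ; +_; -[1+_])
import Data.Integer.Properties as ℤₚ
open import Data.Integer.Solver using () renaming (module +-*-Solver to ℤSolver)
open import Data.List.Base using (List; []; _∷_; _++_; map; filter; length; upTo; allFin; tabulate; cartesianProductWith)
open import Data.List.Membership.Propositional using () renaming (_∈_ to _∈ᴸ_)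
open import Data.List.Membership.Propositional.Properties using (∈-upTo⁺; ∈-upTo⁻)
open import Data.List.Properties using (filter-++; length-++; filter-accept; filter-reject)
open import Data.List.Relation.Unary.All using (All; []; _∷_)
open import Data.List.Relation.Unary.Any using (here; there)
open import Data.Nat.Base as ℕ using (ℕ; zero; suc; _!; z≤n; s≤s; _≤_; _<_; NonZero)
open import Data.Nat.Combinatorics using (_P_; nC1≡n; nCn≡1; nCk≡nC[n∸k]; nCk+nC[k+1]≡[n+1]C[k+1]; nCk≡n!/k![n-k]!; k![n∸k]!∣n!; k>n⇒nCk≡0; k>n⇒nPk≡0; nPk≡n!/[n∸k]!) renaming (_C_ to _choose_)
open import Data.Nat.DivMod using (_mod_; _%_; m/n*n≡m; m%n<n; m%n%n≡m%n; m≡m%n+[m/n]*n; m<n⇒m%n≡m; [m+n]%n≡m%n; %-distribˡ-+) renaming (_/_ to _div_)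
open import Data.Nat.Divisibility using (_∣_; divides; ∣-trans; m∣m*n; m≤n⇒m!∣n!)
open import Data.Nat.ListAction using () renaming (sum to sumℕ)
import Data.Nat.Properties as ℕₚ
open import Data.Nat.Solver using (module +-*-Solver)
open import Data.Product.Base using (∃; _×_; _,_; proj₁; proj₂)
import Data.Product.Properties as Productₚ
open import Data.Rational.Base as ℚ using (ℚ; 1ℚ)
import Data.Rational.Properties as ℚₚ
open import Data.Rational.Unnormalised.Base as ℚᵘ using (mkℚᵘ; *≡*)
import Data.Rational.Unnormalised.Properties as ℚᵘₚ
open import Data.Sum.Base using (_⊎_; inj₁; inj₂; [_,_]′)
import Data.Vec.Base as Vec
open import Data.Vec.Base using ([]; _∷_; here; there)
open import Data.Vec.Properties using (lookup∘tabulate; lookup⇒[]=; []=⇒lookup)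
open import Function.Base using (_∘_)
import Function.Endo.Propositional as Endo
open import Relation.Binary.Definitions using (tri<; tri≈; tri>)
open import Relation.Binary.PropositionalEquality as ≡ using (_≡_; _≢_; refl; sym; trans; cong; cong₂; subst; subst₂)
import Relation.Binary.Reasoning.Setoid as SetoidReasoning
open import Relation.Nullary using (¬_; Dec; yes; no; does; contradiction)
open import Relation.Nullary.Decidable using (_×-dec_; _→-dec_; ¬?; dec-true)
open import Relation.Unary using (Decidable)

-- Finite sums and product distributions

-- The coefficients in the sum over R are free of N because R with all |R_i| = j contains C(j,N)^k
-- families S and C(j,N) N! (j-N)! = j!. Consecutive values of N therefore give the same terms up to
-- a threshold, and F(R) never has to be evaluated: Φ, its sum against m(R), is eliminated. The
-- obstacle is the ring. The formula has negative powers of e₁(X_i), so everything is proved over an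
-- arbitrary commutative ring in which each e₁(X_i) comes with an inverse; probabilities are then
-- ring elements of total 1, and the centralizer order stays on the left as a factor until the very
-- end. The ring of fractions of the polynomial ring gives the weighted formula. The cardinality is
-- not an evaluation of that rational function but a second instance, over ℚ with every variable
-- equal to 1. Functions and families are enumerated only up to pointwise equality, so each random
-- quantity must be shown to depend on specified values alone; the same proofs supply independence.

module Sums {c ℓ} (R : CommutativeRing c ℓ) where

  open CommutativeRing R hiding (zero) renaming (refl to ≈-refl; sym to ≈-sym; trans to ≈-trans)
  open FiniteSums R
  open SemiringMult semiring using (×1-homo-*) renaming (_×_ to _·_; ×-homo-+ to ·-homo-+)
  open MonoidSum *-commutativeMonoid using () renaming (∑-distrib-+ to product-*)
  open RingSolver commutativeSemiring using (solve; _:=_; _:+_; _:*_)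
  open SetoidReasoning setoid

  nat : ℕ → Carrier
  nat m = m · 1#

  nat-* : ∀ m n → nat (m ℕ.* n) ≈ nat m * nat n
  nat-* = ×1-homo-*

  nat-+ : ∀ m n → nat (m ℕ.+ n) ≈ nat m + nat n
  nat-+ = ·-homo-+ 1#

  nat-1 : nat 1 ≈ 1#
  nat-1 = +-identityʳ 1#

  product-1 : ∀ {k} {φ : Fin k → Carrier} → (∀ i → φ i ≈ 1#) → product φ ≈ 1#
  product-1 {zero}  φ≈1 = ≈-refl
  product-1 {suc k} φ≈1 = ≈-trans (*-cong (φ≈1 zero) (product-1 (φ≈1 ∘ suc))) (*-identityˡ 1#)

  product-0 : ∀ {k} {φ : Fin k → Carrier} i → φ i ≈ 0# → product φ ≈ 0#
  product-0 zero    φ≈0 = ≈-trans (*-congʳ φ≈0) (zeroˡ _)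
  product-0 (suc i) φ≈0 = ≈-trans (*-congˡ (product-0 i φ≈0)) (zeroʳ _)

  ⟦_⟧ : ∀ {p} {P : Set p} → Dec P → Carrier
  ⟦ d ⟧ = if does d then 1# else 0#

  ⟦⟧-yes : ∀ {p} {P : Set p} (d : Dec P) → P → ⟦ d ⟧ ≈ 1#
  ⟦⟧-yes (yes _) p = ≈-refl
  ⟦⟧-yes (no ¬p) p = contradiction p ¬p

  ⟦⟧-no : ∀ {p} {P : Set p} (d : Dec P) → ¬ P → ⟦ d ⟧ ≈ 0#
  ⟦⟧-no (yes p) ¬p = contradiction p ¬p
  ⟦⟧-no (no _)  ¬p = ≈-refl

  ⟦⟧-⇔ : ∀ {p q} {P : Set p} {Q : Set q} (d : Dec P) (e : Dec Q) → (P → Q) → (Q → P) → ⟦ d ⟧ ≈ ⟦ e ⟧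
  ⟦⟧-⇔ (yes p) e f g = ≈-sym (⟦⟧-yes e (f p))
  ⟦⟧-⇔ (no ¬p) e f g = ≈-sym (⟦⟧-no e (¬p ∘ g))

  ⟦⟧-× : ∀ {p q} {P : Set p} {Q : Set q} (d : Dec P) (e : Dec Q) → ⟦ d ×-dec e ⟧ ≈ ⟦ d ⟧ * ⟦ e ⟧
  ⟦⟧-× (yes _) e = ≈-sym (*-identityˡ _)
  ⟦⟧-× (no _)  e = ≈-sym (zeroˡ _)

  ⟦⟧-all : ∀ {k p} {P : Fin k → Set p} (P? : Decidable P) → ⟦ all? P? ⟧ ≈ product (λ i → ⟦ P? i ⟧)
  ⟦⟧-all {zero}  P? = ≈-refl
  ⟦⟧-all {suc k} P? = begin
    ⟦ all? P? ⟧                     ≈⟨ ⟦⟧-⇔ (all? P?) (P? zero ×-dec all? (P? ∘ suc)) (λ f → f zero , f ∘ suc) (λ (a , b) → ∀-cons a b) ⟩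
    ⟦ P? zero ×-dec all? (P? ∘ suc) ⟧ ≈⟨ ⟦⟧-× (P? zero) (all? (P? ∘ suc)) ⟩
    ⟦ P? zero ⟧ * ⟦ all? (P? ∘ suc) ⟧ ≈⟨ *-congˡ (⟦⟧-all (P? ∘ suc)) ⟩
    product (λ i → ⟦ P? i ⟧)        ∎

  -- Lets a rewriting step inside a sum or an expectation assume the event whose indicator
  -- multiplies the term.
  ⟦⟧*-cong : ∀ {p} {P : Set p} (d : Dec P) {a b} → (P → a ≈ b) → ⟦ d ⟧ * a ≈ ⟦ d ⟧ * b
  ⟦⟧*-cong (yes p) a≈b = *-congˡ (a≈b p)
  ⟦⟧*-cong (no _)  a≈b = ≈-trans (zeroˡ _) (≈-sym (zeroˡ _))

  ∑ : ∀ {A : Set} → List A → (A → Carrier) → Carrier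
  ∑ xs φ = sumᴸ (map φ xs)

  module _ {A : Set} where

    ∑-cong : ∀ (xs : List A) {φ ψ} → (∀ a → φ a ≈ ψ a) → ∑ xs φ ≈ ∑ xs ψ
    ∑-cong []       φ≈ψ = ≈-refl
    ∑-cong (x ∷ xs) φ≈ψ = +-cong (φ≈ψ x) (∑-cong xs φ≈ψ)

    ∑-++ : ∀ (xs ys : List A) φ → ∑ (xs ++ ys) φ ≈ ∑ xs φ + ∑ ys φ
    ∑-++ []       ys φ = ≈-sym (+-identityˡ _)
    ∑-++ (x ∷ xs) ys φ = ≈-trans (+-congˡ (∑-++ xs ys φ)) (≈-sym (+-assoc _ _ _))

    ∑-*ˡ : ∀ (xs : List A) a φ → ∑ xs (λ x → a * φ x) ≈ a * ∑ xs φ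
    ∑-*ˡ []       a φ = ≈-sym (zeroʳ a)
    ∑-*ˡ (x ∷ xs) a φ = ≈-trans (+-congˡ (∑-*ˡ xs a φ)) (≈-sym (distribˡ _ _ _))

    ∑-*ʳ : ∀ (xs : List A) a φ → ∑ xs (λ x → φ x * a) ≈ ∑ xs φ * a
    ∑-*ʳ xs a φ = ≈-trans (∑-cong xs (λ x → *-comm _ _)) (≈-trans (∑-*ˡ xs a φ) (*-comm _ _))

    ∑-+ : ∀ (xs : List A) φ ψ → ∑ xs (λ x → φ x + ψ x) ≈ ∑ xs φ + ∑ xs ψ
    ∑-+ []       φ ψ = ≈-sym (+-identityˡ _)
    ∑-+ (x ∷ xs) φ ψ = ≈-trans (+-congˡ (∑-+ xs φ ψ))
      (solve 4 (λ a b c d → (a :+ b) :+ (c :+ d) := (a :+ c) :+ (b :+ d)) ≈-refl _ _ _ _)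

    ∑-0 : ∀ (xs : List A) {φ} → (∀ a → φ a ≈ 0#) → ∑ xs φ ≈ 0#
    ∑-0 []       φ≈0 = ≈-refl
    ∑-0 (x ∷ xs) φ≈0 = ≈-trans (+-cong (φ≈0 x) (∑-0 xs φ≈0)) (+-identityˡ _)

    ∑-map : ∀ {B : Set} (g : B → A) (ys : List B) φ → ∑ (map g ys) φ ≈ ∑ ys (φ ∘ g)
    ∑-map g []       φ = ≈-refl
    ∑-map g (y ∷ ys) φ = +-congˡ (∑-map g ys φ)

    ∑-filter : ∀ {p} {P : A → Set p} (P? : Decidable P) xs φ → ∑ (filter P? xs) φ ≈ ∑ xs (λ a → ⟦ P? a ⟧ * φ a)
    ∑-filter P? []       φ = ≈-refl
    ∑-filter P? (x ∷ xs) φ with P? x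
    ... | yes _ = +-cong (≈-sym (*-identityˡ _)) (∑-filter P? xs φ)
    ... | no  _ = ≈-trans (∑-filter P? xs φ) (≈-sym (≈-trans (+-congʳ (zeroˡ _)) (+-identityˡ _)))

  ∑-swap : ∀ {A B : Set} (xs : List A) (ys : List B) (φ : A → B → Carrier) →
           ∑ xs (λ a → ∑ ys (φ a)) ≈ ∑ ys (λ b → ∑ xs (λ a → φ a b))
  ∑-swap []       ys φ = ≈-sym (∑-0 ys λ _ → ≈-refl)
  ∑-swap (x ∷ xs) ys φ = ≈-trans (+-congˡ (∑-swap xs ys φ)) (≈-sym (∑-+ ys _ _))

  ∑-cartesian : ∀ {A B C : Set} (g : A → B → C) xs ys φ →
                ∑ (cartesianProductWith g xs ys) φ ≈ ∑ xs (λ a → ∑ ys (λ b → φ (g a b)))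
  ∑-cartesian g []       ys φ = ≈-refl
  ∑-cartesian g (x ∷ xs) ys φ = ≈-trans (∑-++ (map (g x) ys) _ φ) (+-cong (∑-map (g x) ys φ) (∑-cartesian g xs ys φ))

  ∑-choices : ∀ {k} {A : Fin (suc k) → Set} (xs : ∀ i → List (A i)) φ →
              ∑ (choices xs) φ ≈ ∑ (xs zero) (λ a → ∑ (choices (xs ∘ suc)) (λ g → φ (∀-cons a g)))
  ∑-choices xs φ = ∑-cartesian ∀-cons (xs zero) (choices (xs ∘ suc)) φ

  ∑-product : ∀ {k} {A : Fin k → Set} (xs : ∀ i → List (A i)) (φ : ∀ i → A i → Carrier) →
              ∑ (choices xs) (λ f → product (λ i → φ i (f i))) ≈ product (λ i → ∑ (xs i) (φ i))
  ∑-product {zero}  xs φ = +-identityʳ 1#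
  ∑-product {suc k} xs φ = begin
    ∑ (choices xs) (λ f → product (λ i → φ i (f i)))
      ≈⟨ ∑-choices xs _ ⟩
    ∑ (xs zero) (λ a → ∑ (choices (xs ∘ suc)) (λ g → φ zero a * product (λ i → φ (suc i) (g i))))
      ≈⟨ ∑-cong (xs zero) (λ a → ∑-*ˡ (choices (xs ∘ suc)) (φ zero a) _) ⟩
    ∑ (xs zero) (λ a → φ zero a * ∑ (choices (xs ∘ suc)) (λ g → product (λ i → φ (suc i) (g i))))
      ≈⟨ ∑-*ʳ (xs zero) _ (φ zero) ⟩
    ∑ (xs zero) (φ zero) * ∑ (choices (xs ∘ suc)) (λ g → product (λ i → φ (suc i) (g i)))
      ≈⟨ *-congˡ (∑-product (xs ∘ suc) (φ ∘ suc)) ⟩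
    product (λ i → ∑ (xs i) (φ i)) ∎

  ∑-tabulate : ∀ {A : Set} {m} (g : Fin m → A) φ → ∑ (tabulate g) φ ≈ sum (φ ∘ g)
  ∑-tabulate {m = zero}  g φ = ≈-refl
  ∑-tabulate {m = suc m} g φ = +-congˡ (∑-tabulate (g ∘ suc) φ)

  ∑-allFin : ∀ {m} (φ : Fin m → Carrier) → ∑ (allFin m) φ ≈ sum φ
  ∑-allFin φ = ∑-tabulate (λ v → v) φ

  -- Weights are ring elements of total 1, without order or positivity: they will be the rational
  -- functions x_v / e₁(X_i).
  record Distribution (Ω : Set) : Set (c ⊔ ℓ) where
    field
      support    : List Ω
      weight     : Ω → Carrier
      normalized : ∑ support weight ≈ 1#

  open Distribution

  𝔼 : ∀ {Ω} → Distribution Ω → (Ω → Carrier) → Carrier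
  𝔼 D φ = ∑ (support D) (λ ω → weight D ω * φ ω)

  module _ {Ω : Set} (D : Distribution Ω) where

    𝔼-cong : ∀ {φ ψ} → (∀ ω → φ ω ≈ ψ ω) → 𝔼 D φ ≈ 𝔼 D ψ
    𝔼-cong φ≈ψ = ∑-cong (support D) (λ ω → *-congˡ (φ≈ψ ω))

    𝔼-const : ∀ a → 𝔼 D (λ _ → a) ≈ a
    𝔼-const a = ≈-trans (∑-*ʳ (support D) a (weight D)) (≈-trans (*-congʳ (normalized D)) (*-identityˡ a))

    𝔼-∑ : ∀ {A : Set} (xs : List A) (φ : A → Ω → Carrier) →
          𝔼 D (λ ω → ∑ xs (λ a → φ a ω)) ≈ ∑ xs (λ a → 𝔼 D (φ a))
    𝔼-∑ xs φ = ≈-trans (∑-cong (support D) (λ ω → ≈-sym (∑-*ˡ xs (weight D ω) (λ a → φ a ω)))) (∑-swap (support D) xs (λ ω a → weight D ω * φ a ω))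

    𝔼-*ˡ : ∀ a φ → 𝔼 D (λ ω → a * φ ω) ≈ a * 𝔼 D φ
    𝔼-*ˡ a φ = ≈-trans (∑-cong (support D) (λ ω → solve 3 (λ w a f → w :* (a :* f) := a :* (w :* f)) ≈-refl (weight D ω) a (φ ω)))
                       (∑-*ˡ (support D) a _)

    𝔼-*ʳ : ∀ a φ → 𝔼 D (λ ω → φ ω * a) ≈ 𝔼 D φ * a
    𝔼-*ʳ a φ = ≈-trans (𝔼-cong (λ ω → *-comm _ _)) (≈-trans (𝔼-*ˡ a φ) (*-comm _ _))

    𝔼-swap : ∀ {Ω′ : Set} (D′ : Distribution Ω′) (φ : Ω → Ω′ → Carrier) →
             𝔼 D (λ ω → 𝔼 D′ (φ ω)) ≈ 𝔼 D′ (λ ω′ → 𝔼 D (λ ω → φ ω ω′))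
    𝔼-swap D′ φ = ≈-trans (𝔼-∑ (support D′) (λ ω′ ω → weight D′ ω′ * φ ω ω′))
                          (∑-cong (support D′) (λ ω′ → 𝔼-*ˡ (weight D′ ω′) (λ ω → φ ω ω′)))

  Πᴰ : ∀ {k} {Ω : Fin k → Set} → (∀ i → Distribution (Ω i)) → Distribution (∀ i → Ω i)
  Πᴰ D = record
    { support    = choices (λ i → support (D i))
    ; weight     = λ f → product (λ i → weight (D i) (f i))
    ; normalized = ≈-trans (∑-product (λ i → support (D i)) (λ i → weight (D i))) (product-1 (λ i → normalized (D i)))
    }

  𝔼-Π-suc : ∀ {k} {Ω : Fin (suc k) → Set} (D : ∀ i → Distribution (Ω i)) φ →
            𝔼 (Πᴰ D) φ ≈ 𝔼 (D zero) (λ a → 𝔼 (Πᴰ (D ∘ suc)) (λ g → φ (∀-cons a g)))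
  𝔼-Π-suc D φ = begin
    𝔼 (Πᴰ D) φ
      ≈⟨ ∑-choices (λ i → support (D i)) _ ⟩
    ∑ (support (D zero)) (λ a → ∑ gs (λ g → (weight (D zero) a * w g) * φ (∀-cons a g)))
      ≈⟨ ∑-cong (support (D zero)) (λ a → ≈-trans (∑-cong gs (λ g → *-assoc _ _ _)) (∑-*ˡ gs _ _)) ⟩
    𝔼 (D zero) (λ a → 𝔼 (Πᴰ (D ∘ suc)) (λ g → φ (∀-cons a g))) ∎
    where
    gs = support (Πᴰ (D ∘ suc))
    w  = weight (Πᴰ (D ∘ suc))

  𝔼-product : ∀ {k} {Ω : Fin k → Set} (D : ∀ i → Distribution (Ω i)) (φ : ∀ i → Ω i → Carrier) →
              𝔼 (Πᴰ D) (λ f → product (λ i → φ i (f i))) ≈ product (λ i → 𝔼 (D i) (φ i))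
  𝔼-product D φ = ≈-trans (∑-cong (support (Πᴰ D)) (λ f → ≈-sym (product-* (λ i → weight (D i) (f i)) (λ i → φ i (f i)))))
                          (∑-product (λ i → support (D i)) (λ i a → weight (D i) a * φ i a))

  -- The relation says which data of an outcome may be read. It takes the place of measurability,
  -- and it copes with outcomes that are functions, which `choices` lists only up to pointwise
  -- equality.
  Respects : ∀ {Ω : Set} → (Ω → Ω → Set) → (Ω → Carrier) → Set ℓ
  Respects {Ω} _∼_ φ = ∀ ω ω′ → ω ∼ ω′ → φ ω ≈ φ ω′

  Independent : ∀ {Ω : Set} → Distribution Ω → (_∼₁_ _∼₂_ : Ω → Ω → Set) → Set (c ⊔ ℓ)
  Independent D _∼₁_ _∼₂_ = ∀ {φ ψ} → Respects _∼₁_ φ → Respects _∼₂_ ψ →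
    𝔼 D (λ ω → φ ω * ψ ω) ≈ 𝔼 D φ * 𝔼 D ψ

  independent-sym : ∀ {Ω : Set} (D : Distribution Ω) {_∼₁_ _∼₂_ : Ω → Ω → Set} →
                    Independent D _∼₁_ _∼₂_ → Independent D _∼₂_ _∼₁_
  independent-sym D ind {φ} {ψ} φ∼ ψ∼ = ≈-trans (𝔼-cong D (λ ω → *-comm _ _)) (≈-trans (ind {ψ} {φ} ψ∼ φ∼) (*-comm _ _))

  -- A function of ω that respects the total relation is constant.
  independent-total : ∀ {Ω : Set} (D : Distribution Ω) {_∼₁_ _∼₂_ : Ω → Ω → Set} →
                      (∀ ω ω′ → ω ∼₂ ω′) → Independent D _∼₁_ _∼₂_
  independent-total D total {φ} {ψ} φ∼ ψ∼ = begin
    𝔼 D (λ ω → φ ω * ψ ω)             ≈⟨ 𝔼-cong D (λ ω → *-congˡ (≈-trans (≈-sym (𝔼-const D (ψ ω))) (𝔼-cong D (λ ω′ → ψ∼ ω ω′ (total ω ω′))))) ⟩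
    𝔼 D (λ ω → φ ω * 𝔼 D ψ)           ≈⟨ 𝔼-*ʳ D (𝔼 D ψ) φ ⟩
    𝔼 D φ * 𝔼 D ψ                     ∎

  -- Induction on the number of coordinates: for each fixed first value the tail expectations
  -- factor, and by reflexivity on the tail the two factors, as functions of the first value,
  -- respect the first relations again.
  independent-Π : ∀ {k} {Ω : Fin k → Set} (D : ∀ i → Distribution (Ω i)) {_∼₁_ _∼₂_ : ∀ i → Ω i → Ω i → Set} →
                  (∀ i {ω} → _∼₁_ i ω ω) → (∀ i {ω} → _∼₂_ i ω ω) →
                  (∀ i → Independent (D i) (_∼₁_ i) (_∼₂_ i)) →
                  Independent (Πᴰ D) (λ f g → ∀ i → _∼₁_ i (f i) (g i)) (λ f g → ∀ i → _∼₂_ i (f i) (g i))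
  independent-Π {zero}  D {_∼₁_} {_∼₂_} r₁ r₂ ind {φ} {ψ} φ∼ ψ∼ =
    independent-total (Πᴰ D) {_∼₁_ = λ f g → ∀ i → _∼₁_ i (f i) (g i)} {_∼₂_ = λ f g → ∀ i → _∼₂_ i (f i) (g i)} (λ _ _ ()) {φ} {ψ} φ∼ ψ∼
  independent-Π {suc k} D {_∼₁_} {_∼₂_} r₁ r₂ ind {φ} {ψ} φ∼ ψ∼ = begin
    𝔼 (Πᴰ D) (λ f → φ f * ψ f)
      ≈⟨ 𝔼-Π-suc D _ ⟩
    𝔼 (D zero) (λ a → 𝔼 D′ (λ g → φ (∀-cons a g) * ψ (∀-cons a g)))
      ≈⟨ 𝔼-cong (D zero) (λ a → independent-Π (D ∘ suc) (r₁ ∘ suc) (r₂ ∘ suc) (ind ∘ suc) {λ g → φ (∀-cons a g)} {λ g → ψ (∀-cons a g)}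
           (λ g g′ g∼ → φ∼ (∀-cons a g) (∀-cons a g′) (∀-cons (r₁ zero) g∼))
           (λ g g′ g∼ → ψ∼ (∀-cons a g) (∀-cons a g′) (∀-cons (r₂ zero) g∼))) ⟩
    𝔼 (D zero) (λ a → 𝔼 D′ (λ g → φ (∀-cons a g)) * 𝔼 D′ (λ g → ψ (∀-cons a g)))
      ≈⟨ ind zero {λ a → 𝔼 D′ (λ g → φ (∀-cons a g))} {λ a → 𝔼 D′ (λ g → ψ (∀-cons a g))}
           (λ a a′ a∼ → 𝔼-cong D′ (λ g → φ∼ (∀-cons a g) (∀-cons a′ g) (∀-cons a∼ (λ i → r₁ (suc i)))))
           (λ a a′ a∼ → 𝔼-cong D′ (λ g → ψ∼ (∀-cons a g) (∀-cons a′ g) (∀-cons a∼ (λ i → r₂ (suc i))))) ⟩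
    𝔼 (D zero) (λ a → 𝔼 D′ (λ g → φ (∀-cons a g))) * 𝔼 (D zero) (λ a → 𝔼 D′ (λ g → ψ (∀-cons a g)))
      ≈⟨ *-cong (𝔼-Π-suc D φ) (𝔼-Π-suc D ψ) ⟨
    𝔼 (Πᴰ D) φ * 𝔼 (Πᴰ D) ψ ∎
    where D′ = Πᴰ (D ∘ suc)

  -- Fubini for one coordinate. The value at `j` is passed to `ψ` separately, and `ψ` ignores
  -- coordinate `j` of its second argument, so that value can be averaged apart from the rest.
  resample : ∀ {k} {Ω : Fin k → Set} (D : ∀ i → Distribution (Ω i)) j (ψ : Ω j → (∀ i → Ω i) → Carrier) →
             (∀ a → Respects (λ f g → ∀ i → i ≢ j → f i ≡ g i) (ψ a)) →
             𝔼 (Πᴰ D) (λ f → ψ (f j) f) ≈ 𝔼 (Πᴰ D) (λ f → 𝔼 (D j) (λ a → ψ a f))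
  resample {suc k} {Ω} D zero ψ ψ∼ = begin
    𝔼 (Πᴰ D) (λ f → ψ (f zero) f)
      ≈⟨ 𝔼-Π-suc D _ ⟩
    𝔼 (D zero) (λ a → 𝔼 D′ (λ g → ψ a (∀-cons {P = Ω} a g)))
      -- A dummy draw `b` is added to occupy coordinate zero, which `ψ` ignores, once `a` is
      -- detached from it.
      ≈⟨ 𝔼-const (D zero) _ ⟨
    𝔼 (D zero) (λ b → 𝔼 (D zero) (λ a → 𝔼 D′ (λ g → ψ a (∀-cons {P = Ω} a g))))
      ≈⟨ 𝔼-cong (D zero) (λ b → 𝔼-cong (D zero) (λ a → 𝔼-cong D′ (λ g → ψ∼ a (∀-cons {P = Ω} a g) (∀-cons {P = Ω} b g) (off a b g)))) ⟩
    𝔼 (D zero) (λ b → 𝔼 (D zero) (λ a → 𝔼 D′ (λ g → ψ a (∀-cons {P = Ω} b g))))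
      ≈⟨ 𝔼-cong (D zero) (λ b → 𝔼-swap (D zero) D′ (λ a g → ψ a (∀-cons {P = Ω} b g))) ⟩
    𝔼 (D zero) (λ b → 𝔼 D′ (λ g → 𝔼 (D zero) (λ a → ψ a (∀-cons {P = Ω} b g))))
      ≈⟨ 𝔼-Π-suc D _ ⟨
    𝔼 (Πᴰ D) (λ f → 𝔼 (D zero) (λ a → ψ a f)) ∎
    where
    D′ = Πᴰ (D ∘ suc)
    off : ∀ a b g i → i ≢ zero → ∀-cons {P = Ω} a g i ≡ ∀-cons {P = Ω} b g i
    off a b g zero    i≢ = contradiction refl i≢
    off a b g (suc i) i≢ = refl
  resample {suc k} {Ω} D (suc j) ψ ψ∼ = begin
    𝔼 (Πᴰ D) (λ f → ψ (f (suc j)) f)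
      ≈⟨ 𝔼-Π-suc D _ ⟩
    𝔼 (D zero) (λ a → 𝔼 D′ (λ g → ψ (g j) (∀-cons {P = Ω} a g)))
      ≈⟨ 𝔼-cong (D zero) (λ a → resample (D ∘ suc) j (λ b g → ψ b (∀-cons {P = Ω} a g)) (λ b g g′ g∼ → ψ∼ b (∀-cons {P = Ω} a g) (∀-cons {P = Ω} a g′) (off a {g} {g′} g∼))) ⟩
    𝔼 (D zero) (λ a → 𝔼 D′ (λ g → 𝔼 (D (suc j)) (λ b → ψ b (∀-cons {P = Ω} a g))))
      ≈⟨ 𝔼-Π-suc D _ ⟨
    𝔼 (Πᴰ D) (λ f → 𝔼 (D (suc j)) (λ a → ψ a f)) ∎
    where
    D′ = Πᴰ (D ∘ suc)
    off : ∀ a {g g′ : ∀ i → Ω (suc i)} → (∀ i → i ≢ j → g i ≡ g′ i) → ∀ i → i ≢ suc j → ∀-cons {P = Ω} a g i ≡ ∀-cons {P = Ω} a g′ i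
    off a g∼ zero    i≢ = refl
    off a g∼ (suc i) i≢ = g∼ i (i≢ ∘ cong suc)

-- Subsets and bijections between them

C-factorial : ∀ {m k} → k ℕ.≤ m → (m choose k) ℕ.* (k ! ℕ.* (m ℕ.∸ k) !) ≡ m !
C-factorial {m} {k} k≤m = trans (cong (ℕ._* (k ! ℕ.* (m ℕ.∸ k) !)) (nCk≡n!/k![n-k]! k≤m))
  (m/n*n≡m {{k ℕₚ.!* (m ℕ.∸ k) !≢0}} (k![n∸k]!∣n! k≤m))

nC0≡1 : ∀ m → m choose 0 ≡ 1
nC0≡1 m = trans (nCk≡nC[n∸k] {k = 0} {n = m} z≤n) (nCn≡1 m)

∈─⇒∉ : ∀ {n} {p q : Subset n} {x} → x ∈ p ─ q → x ∉ q
∈─⇒∉ {p = s ∷ p} {inside ∷ q}  (there x∈) (there x∈q) = ∈─⇒∉ x∈ x∈q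
∈─⇒∉ {p = s ∷ p} {outside ∷ q} (there x∈) (there x∈q) = ∈─⇒∉ x∈ x∈q

∣─∣ : ∀ {n} {p q : Subset n} → q ⊆ p → ∣ q ∣ ℕ.+ ∣ p ─ q ∣ ≡ ∣ p ∣
∣─∣ {p = []}          {[]}          q⊆p = refl
∣─∣ {p = inside ∷ p}  {inside ∷ q}  q⊆p = cong suc (∣─∣ (drop-∷-⊆ q⊆p))
∣─∣ {p = outside ∷ p} {inside ∷ q}  q⊆p with () ← q⊆p here
∣─∣ {p = inside ∷ p}  {outside ∷ q} q⊆p = trans (ℕₚ.+-suc _ _) (cong suc (∣─∣ (drop-∷-⊆ q⊆p)))
∣─∣ {p = outside ∷ p} {outside ∷ q} q⊆p = ∣─∣ (drop-∷-⊆ q⊆p)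

⁅⁆⊆ : ∀ {n} {p : Subset n} {x} → x ∈ p → ⁅ x ⁆ ⊆ p
⁅⁆⊆ {x = x} x∈p y∈ = subst (_∈ _) (sym (x∈⁅y⁆⇒x≡y x y∈)) x∈p

∈-remove⁻ : ∀ {n} {p : Subset n} {x y} → y ∈ p ∖ x → y ∈ p × y ≢ x
∈-remove⁻ {p = p} {x} y∈ = p─q⊆p p ⁅ x ⁆ y∈ , λ { refl → ∈─⇒∉ {p = p} y∈ (x∈⁅x⁆ x) }

suc∣remove∣ : ∀ {n} {p : Subset n} {x} → x ∈ p → suc ∣ p ∖ x ∣ ≡ ∣ p ∣
suc∣remove∣ {p = p} {x} x∈p = trans (cong (ℕ._+ ∣ p ∖ x ∣) (sym (∣⁅x⁆∣≡1 x))) (∣─∣ (⁅⁆⊆ x∈p))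

∣∣≡0⇒∉ : ∀ {n} {p : Subset n} → ∣ p ∣ ≡ 0 → ∀ x → x ∉ p
∣∣≡0⇒∉ {p = outside ∷ p} eq (suc x) (there x∈) = ∣∣≡0⇒∉ eq x x∈

-- Stated for subsets rather than subtypes, so that one total map can be tested on many pairs of
-- sets. With both sets equal to `S` it unfolds to `PermutesOn f S`.
Bij : ∀ {a b} → (Fin a → Fin b) → Subset a → Subset b → Set
Bij f A B = (∀ v → v ∈ A → f v ∈ B)
          × (∀ u v → u ∈ A → v ∈ A → f u ≡ f v → u ≡ v)
          × (∀ w → w ∈ B → ∃ λ v → v ∈ A × f v ≡ w)

bij? : ∀ {a b} (f : Fin a → Fin b) A B → Dec (Bij f A B)
bij? f A B =
  all? (λ v → (v ∈? A) →-dec (f v ∈? B))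
  ×-dec all? (λ u → all? λ v → (u ∈? A) →-dec ((v ∈? A) →-dec ((f u ≟ᶠ f v) →-dec (u ≟ᶠ v))))
  ×-dec all? (λ w → (w ∈? B) →-dec any? λ v → (v ∈? A) ×-dec (f v ≟ᶠ w))

bij-∘ : ∀ {a b c} {f : Fin a → Fin b} {g : Fin b → Fin c} {A B C} → Bij f A B → Bij g B C → Bij (g ∘ f) A C
bij-∘ {f = f} {g} (f∈ , f-inj , f-sur) (g∈ , g-inj , g-sur) =
  (λ v v∈ → g∈ _ (f∈ v v∈)) ,
  (λ u v u∈ v∈ eq → f-inj u v u∈ v∈ (g-inj _ _ (f∈ u u∈) (f∈ v v∈) eq)) ,
  λ w w∈ → let (v , v∈ , gv≡w) = g-sur w w∈; (u , u∈ , fu≡v) = f-sur v v∈ in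
    u , u∈ , trans (cong g fu≡v) gv≡w

-- Cancels a bijection on the right. With `bij-∘` it allows the last map of the cycle to be tested
-- after precomposition with the earlier ones.
bij-∘⁻ : ∀ {a b c} {f : Fin a → Fin b} {g : Fin b → Fin c} {A B C} → Bij f A B → Bij (g ∘ f) A C → Bij g B C
bij-∘⁻ {f = f} {g} {C = C} (f∈ , f-inj , f-sur) (gf∈ , gf-inj , gf-sur) =
  (λ v v∈ → let (u , u∈ , eq) = f-sur v v∈ in subst (λ t → g t ∈ C) eq (gf∈ u u∈)) ,
  (λ v v′ v∈ v∈′ eq → let (u , u∈ , fu≡v) = f-sur v v∈; (u′ , u∈′ , fu′≡v′) = f-sur v′ v∈′ in
    trans (sym fu≡v) (trans (cong f (gf-inj u u′ u∈ u∈′ (trans (cong g fu≡v) (trans eq (cong g (sym fu′≡v′)))))) fu′≡v′)) ,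
  λ w w∈ → let (u , u∈ , eq) = gf-sur w w∈ in f u , f∈ u u∈ , eq

bij-resp : ∀ {a b} {f g : Fin a → Fin b} {A B} → (∀ v → v ∈ A → f v ≡ g v) → Bij f A B → Bij g A B
bij-resp f≡g (f∈ , f-inj , f-sur) =
  (λ v v∈ → subst (_∈ _) (f≡g v v∈) (f∈ v v∈)) ,
  (λ u v u∈ v∈ eq → f-inj u v u∈ v∈ (trans (f≡g u u∈) (trans eq (sym (f≡g v v∈))))) ,
  λ w w∈ → let (v , v∈ , eq) = f-sur w w∈ in v , v∈ , trans (sym (f≡g v v∈)) eq

bij-id : ∀ {a} {A : Subset a} → Bij (λ v → v) A A
bij-id = (λ _ v∈ → v∈) , (λ _ _ _ _ eq → eq) , (λ w w∈ → w , w∈ , refl)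

module _ {a b} {f : Fin (suc a) → Fin b} {A : Subset a} {B : Subset b} where

  bij-outside⁻ : Bij f (outside ∷ A) B → Bij (f ∘ suc) A B
  bij-outside⁻ (f∈ , f-inj , f-sur) =
    (λ v v∈ → f∈ (suc v) (there v∈)) ,
    (λ u v u∈ v∈ eq → suc-injective (f-inj _ _ (there u∈) (there v∈) eq)) ,
    λ w w∈ → case-there (f-sur w w∈)
    where
    case-there : ∀ {w} → (∃ λ v → v ∈ outside ∷ A × f v ≡ w) → ∃ λ v → v ∈ A × f (suc v) ≡ w
    case-there (suc v , there v∈ , eq) = v , v∈ , eq

  bij-outside⁺ : Bij (f ∘ suc) A B → Bij f (outside ∷ A) B
  bij-outside⁺ (f∈ , f-inj , f-sur) =
    (λ { (suc v) (there v∈) → f∈ v v∈ }) ,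
    (λ { (suc u) (suc v) (there u∈) (there v∈) eq → cong suc (f-inj u v u∈ v∈ eq) }) ,
    λ w w∈ → let (v , v∈ , eq) = f-sur w w∈ in suc v , there v∈ , eq

  bij-inside⁻ : Bij f (inside ∷ A) B → f zero ∈ B × Bij (f ∘ suc) A (B ∖ f zero)
  bij-inside⁻ (f∈ , f-inj , f-sur) =
    f∈ zero here ,
    (λ v v∈ → x∈p∧x≢y⇒x∈p-y (f∈ (suc v) (there v∈)) λ eq → contradiction (f-inj _ _ (there v∈) here eq) λ ()) ,
    (λ u v u∈ v∈ eq → suc-injective (f-inj _ _ (there u∈) (there v∈) eq)) ,
    λ w w∈ → sur (∈-remove⁻ w∈)
    where
    sur : ∀ {w} → w ∈ B × w ≢ f zero → ∃ λ v → v ∈ A × f (suc v) ≡ w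
    sur (w∈ , w≢) with f-sur _ w∈
    ... | zero  , here     , eq = contradiction (sym eq) w≢
    ... | suc v , there v∈ , eq = v , v∈ , eq

  bij-inside⁺ : f zero ∈ B → Bij (f ∘ suc) A (B ∖ f zero) → Bij f (inside ∷ A) B
  bij-inside⁺ f0∈ (f∈ , f-inj , f-sur) =
    (λ { zero here → f0∈ ; (suc v) (there v∈) → proj₁ (∈-remove⁻ (f∈ v v∈)) }) ,
    inj ,
    sur
    where
    inj : ∀ u v → u ∈ inside ∷ A → v ∈ inside ∷ A → f u ≡ f v → u ≡ v
    inj zero    zero    _ _ _ = refl
    inj zero    (suc v) _ (there v∈) eq = contradiction (sym eq) (proj₂ (∈-remove⁻ (f∈ v v∈)))
    inj (suc u) zero    (there u∈) _ eq = contradiction eq (proj₂ (∈-remove⁻ (f∈ u u∈)))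
    inj (suc u) (suc v) (there u∈) (there v∈) eq = cong suc (f-inj u v u∈ v∈ eq)
    sur : ∀ w → w ∈ B → ∃ λ v → v ∈ inside ∷ A × f v ≡ w
    sur w w∈ with w ≟ᶠ f zero
    ... | yes refl = zero , here , refl
    ... | no  w≢   = let (v , v∈ , eq) = f-sur w (x∈p∧x≢y⇒x∈p-y w∈ w≢) in suc v , there v∈ , eq

bij-∣∣ : ∀ {a b} {f : Fin a → Fin b} {A B} → Bij f A B → ∣ A ∣ ≡ ∣ B ∣
bij-∣∣ {b = b} {f} {[]} {B} (_ , _ , sur) =
  sym (trans (cong ∣_∣ (Empty-unique {p = B} λ (w , w∈) → contradiction (proj₁ (sur w w∈)) λ ())) (∣⊥∣≡0 b))
bij-∣∣ {A = outside ∷ A} f-bij = bij-∣∣ (bij-outside⁻ f-bij)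
bij-∣∣ {A = inside ∷ A}  f-bij = let (f0∈ , f-bij′) = bij-inside⁻ f-bij in
  trans (cong suc (bij-∣∣ f-bij′)) (suc∣remove∣ f0∈)

-- Subset sums and random bijections

module Counting {c ℓ} (R : CommutativeRing c ℓ) where

  open CommutativeRing R hiding (zero; _-_) renaming (refl to ≈-refl; sym to ≈-sym; trans to ≈-trans; reflexive to ≈-reflexive)
  open FiniteSums R
  open Sums R
  open MonoidSum *-commutativeMonoid using () renaming
    (sum-cong-≋ to product-cong; ∑-distrib-+ to product-*)
  open RingSolver commutativeSemiring using (solve; _:=_; _:*_)
  open SetoidReasoning setoid

  elementary-∑ : ∀ {m} (x : Fin m → Carrier) j → elementary x j ≈ ∑ (subsets m) (λ S → ⟦ ∣ S ∣ ℕₚ.≟ j ⟧ * monomial x S)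
  elementary-∑ {m} x j = ∑-filter (λ S → ∣ S ∣ ℕₚ.≟ j) (subsets m) (monomial x)

  monomial-─ : ∀ {m} (x : Fin m → Carrier) {p q} → q ⊆ p → monomial x q * monomial x (p ─ q) ≈ monomial x p
  monomial-─ x {p} {q} q⊆p = ≈-trans (≈-sym (product-* (λ v → if does (v ∈? q) then x v else 1#) _)) (product-cong split)
    where
    split : ∀ v → (if does (v ∈? q) then x v else 1#) * (if does (v ∈? p ─ q) then x v else 1#) ≈ (if does (v ∈? p) then x v else 1#)
    split v with v ∈? q | v ∈? p ─ q | v ∈? p
    ... | yes v∈q | yes v∈─ | _       = contradiction v∈q (∈─⇒∉ v∈─)
    ... | yes v∈q | no  _   | yes _   = *-identityʳ _
    ... | yes v∈q | no  _   | no  v∉p = contradiction (q⊆p v∈q) v∉p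
    ... | no  _   | yes v∈─ | yes _   = *-identityˡ _
    ... | no  _   | yes v∈─ | no  v∉p = contradiction (p─q⊆p p q v∈─) v∉p
    ... | no  v∉q | no  v∉─ | yes v∈p = contradiction (x∈p∧x∉q⇒x∈p─q v∈p v∉q) v∉─
    ... | no  _   | no  _   | no  _   = *-identityˡ _

  monomial-empty : ∀ {m} (x : Fin m → Carrier) {p} → (∀ v → v ∉ p) → monomial x p ≈ 1#
  monomial-empty x {p} ∉p = product-1 outside-p
    where
    outside-p : ∀ v → (if does (v ∈? p) then x v else 1#) ≈ 1#
    outside-p v with v ∈? p
    ... | yes v∈ = contradiction v∈ (∉p v)
    ... | no  _  = ≈-refl

  monomial-⁅⁆ : ∀ {m} (x : Fin m → Carrier) u → monomial x ⁅ u ⁆ ≈ x u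
  monomial-⁅⁆ x zero    = ≈-trans (*-congˡ (monomial-empty (x ∘ suc) (λ v → ∉⊥))) (*-identityʳ _)
  monomial-⁅⁆ x (suc u) = ≈-trans (*-identityˡ _) (monomial-⁅⁆ (x ∘ suc) u)

  monomial-remove : ∀ {m} (x : Fin m → Carrier) {p u} → u ∈ p → x u * monomial x (p ∖ u) ≈ monomial x p
  monomial-remove x {p} {u} u∈p = ≈-trans (*-congʳ (≈-sym (monomial-⁅⁆ x u))) (monomial-─ x {p} (⁅⁆⊆ u∈p))

  sum-∈ : ∀ {m} (p : Subset m) → sum (λ v → ⟦ v ∈? p ⟧) ≈ nat ∣ p ∣
  sum-∈ []            = ≈-refl
  sum-∈ (inside ∷ p)  = +-congˡ (sum-∈ p)
  sum-∈ (outside ∷ p) = ≈-trans (+-identityˡ _) (sum-∈ p)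

  ∑-subsets : ∀ m φ → ∑ (subsets (suc m)) φ ≈ ∑ (subsets m) (φ ∘ (inside ∷_)) + ∑ (subsets m) (φ ∘ (outside ∷_))
  ∑-subsets m φ = ≈-trans (∑-++ (map (inside ∷_) (subsets m)) _ φ) (+-cong (∑-map (inside ∷_) (subsets m) φ) (∑-map (outside ∷_) (subsets m) φ))

  ∑-subsets-≟ : ∀ {m} (T : Subset m) → ∑ (subsets m) (λ S → ⟦ S ≟ˢ T ⟧) ≈ 1#
  ∑-subsets-≟ [] = +-identityʳ _
  ∑-subsets-≟ {suc m} (inside ∷ T) = begin
    ∑ (subsets (suc m)) (λ S → ⟦ S ≟ˢ (inside ∷ T) ⟧)
      ≈⟨ ∑-subsets m _ ⟩
    ∑ (subsets m) (λ S → ⟦ (inside ∷ S) ≟ˢ (inside ∷ T) ⟧) + ∑ (subsets m) (λ S → ⟦ (outside ∷ S) ≟ˢ (inside ∷ T) ⟧)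
      ≈⟨ +-cong (∑-cong (subsets m) (λ S → ⟦⟧-⇔ ((inside ∷ S) ≟ˢ (inside ∷ T)) (S ≟ˢ T) (λ { refl → refl }) (cong (inside ∷_))))
                (∑-0 (subsets m) (λ S → ⟦⟧-no ((outside ∷ S) ≟ˢ (inside ∷ T)) λ ())) ⟩
    ∑ (subsets m) (λ S → ⟦ S ≟ˢ T ⟧) + 0#
      ≈⟨ ≈-trans (+-identityʳ _) (∑-subsets-≟ T) ⟩
    1# ∎
  ∑-subsets-≟ {suc m} (outside ∷ T) = begin
    ∑ (subsets (suc m)) (λ S → ⟦ S ≟ˢ (outside ∷ T) ⟧)
      ≈⟨ ∑-subsets m _ ⟩
    ∑ (subsets m) (λ S → ⟦ (inside ∷ S) ≟ˢ (outside ∷ T) ⟧) + ∑ (subsets m) (λ S → ⟦ (outside ∷ S) ≟ˢ (outside ∷ T) ⟧)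
      ≈⟨ +-cong (∑-0 (subsets m) (λ S → ⟦⟧-no ((inside ∷ S) ≟ˢ (outside ∷ T)) λ ()))
                (∑-cong (subsets m) (λ S → ⟦⟧-⇔ ((outside ∷ S) ≟ˢ (outside ∷ T)) (S ≟ˢ T) (λ { refl → refl }) (cong (outside ∷_)))) ⟩
    0# + ∑ (subsets m) (λ S → ⟦ S ≟ˢ T ⟧)
      ≈⟨ ≈-trans (+-identityˡ _) (∑-subsets-≟ T) ⟩
    1# ∎

  -- `P` singles out `T`, so one term survives. Families are compared pointwise, hence the
  -- hypothesis that `φ` takes the same value on all families satisfying `P`.
  ∑-families-≡ : ∀ {k} {n : Fin k → ℕ} {P : (∀ i → Subset (n i)) → Set} (P? : ∀ S → Dec (P S)) (T : ∀ i → Subset (n i)) →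
                 (∀ S → P S → ∀ i → S i ≡ T i) → (∀ S → (∀ i → S i ≡ T i) → P S) →
                 ∀ (φ : (∀ i → Subset (n i)) → Carrier) → (∀ S → P S → φ S ≈ φ T) →
                 ∑ (choices (λ i → subsets (n i))) (λ S → ⟦ P? S ⟧ * φ S) ≈ φ T
  ∑-families-≡ {n = n} P? T P⇒≡ ≡⇒P φ φ-resp = begin
    ∑ families (λ S → ⟦ P? S ⟧ * φ S)
      ≈⟨ ∑-cong families (λ S → ≈-trans (⟦⟧*-cong (P? S) (φ-resp S))
           (*-congʳ (≈-trans (⟦⟧-⇔ (P? S) (all? λ i → S i ≟ˢ T i) (P⇒≡ S) (≡⇒P S)) (⟦⟧-all (λ i → S i ≟ˢ T i))))) ⟩
    ∑ families (λ S → product (λ i → ⟦ S i ≟ˢ T i ⟧) * φ T)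
      ≈⟨ ∑-*ʳ families (φ T) (λ S → product (λ i → ⟦ S i ≟ˢ T i ⟧)) ⟩
    ∑ families (λ S → product (λ i → ⟦ S i ≟ˢ T i ⟧)) * φ T
      ≈⟨ *-congʳ (≈-trans (∑-product (λ i → subsets (n i)) (λ i S → ⟦ S ≟ˢ T i ⟧)) (product-1 (λ i → ∑-subsets-≟ (T i)))) ⟩
    1# * φ T
      ≈⟨ *-identityˡ _ ⟩
    φ T ∎
    where families = choices (λ i → subsets (n i))

  ∑-⊆ : ∀ {m} (T : Subset m) j → ∑ (subsets m) (λ S → ⟦ S ⊆? T ⟧ * ⟦ ∣ S ∣ ℕₚ.≟ j ⟧) ≈ nat (∣ T ∣ choose j)
  ∑-⊆ [] zero    = ≈-trans (+-identityʳ _) (≈-trans (*-identityˡ _) (≈-sym nat-1))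
  ∑-⊆ [] (suc j) = ≈-trans (+-identityʳ _) (≈-trans (*-identityˡ _) (≈-reflexive (cong nat (sym (k>n⇒nCk≡0 {0} {suc j} (s≤s z≤n))))))
  ∑-⊆ {suc m} (t ∷ T) j = begin
    ∑ (subsets (suc m)) (λ S → ⟦ S ⊆? (t ∷ T) ⟧ * ⟦ ∣ S ∣ ℕₚ.≟ j ⟧)
      ≈⟨ ∑-subsets m _ ⟩
    ∑ (subsets m) (λ S → ⟦ (inside ∷ S) ⊆? (t ∷ T) ⟧ * ⟦ suc ∣ S ∣ ℕₚ.≟ j ⟧) + ∑ (subsets m) (λ S → ⟦ (outside ∷ S) ⊆? (t ∷ T) ⟧ * ⟦ ∣ S ∣ ℕₚ.≟ j ⟧)
      ≈⟨ +-cong (with-head t j)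
           (≈-trans (∑-cong (subsets m) (λ S → *-congʳ (⟦⟧-⇔ ((outside ∷ S) ⊆? (t ∷ T)) (S ⊆? T) drop-∷-⊆ out⊆))) (∑-⊆ T j)) ⟩
    headCount t j + nat (∣ T ∣ choose j)
      ≈⟨ pascal t j ⟩
    nat (∣ t ∷ T ∣ choose j) ∎
    where
    headCount : Bool → ℕ → Carrier
    headCount outside j       = 0#
    headCount inside  zero    = 0#
    headCount inside  (suc j) = nat (∣ T ∣ choose j)

    with-head : ∀ t j → ∑ (subsets m) (λ S → ⟦ (inside ∷ S) ⊆? (t ∷ T) ⟧ * ⟦ suc ∣ S ∣ ℕₚ.≟ j ⟧) ≈ headCount t j
    with-head outside j = ∑-0 (subsets m) (λ S → ≈-trans (*-congʳ (⟦⟧-no ((inside ∷ S) ⊆? (outside ∷ T)) (λ S⊆ → contradiction (S⊆ here) λ ()))) (zeroˡ _))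
    with-head inside zero = ∑-0 (subsets m) (λ S → zeroʳ _)
    with-head inside (suc j) = ≈-trans
      (∑-cong (subsets m) (λ S → *-cong (⟦⟧-⇔ ((inside ∷ S) ⊆? (inside ∷ T)) (S ⊆? T) drop-∷-⊆ in⊆in)
        (⟦⟧-⇔ (suc ∣ S ∣ ℕₚ.≟ suc j) (∣ S ∣ ℕₚ.≟ j) ℕₚ.suc-injective (cong suc))))
      (∑-⊆ T j)

    pascal : ∀ t j → headCount t j + nat (∣ T ∣ choose j) ≈ nat (∣ t ∷ T ∣ choose j)
    pascal outside j       = +-identityˡ _
    pascal inside  zero    = ≈-trans (+-identityˡ _) (≈-reflexive (cong nat (trans (nC0≡1 ∣ T ∣) (sym (nC0≡1 (suc ∣ T ∣))))))
    pascal inside  (suc j) = ≈-trans (≈-sym (nat-+ (∣ T ∣ choose j) (∣ T ∣ choose suc j))) (≈-reflexive (cong nat (nCk+nC[k+1]≡[n+1]C[k+1] ∣ T ∣ j)))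

  finᴰ : ∀ {b} (p : Fin b → Carrier) → sum p ≈ 1# → Distribution (Fin b)
  finᴰ {b} p mass = record { support = allFin b ; weight = p ; normalized = ≈-trans (∑-allFin p) mass }

  iid : ∀ a {b} → Distribution (Fin b) → Distribution (Fin a → Fin b)
  iid a D = Πᴰ {a} (λ _ → D)

  module _ {b} (p : Fin b → Carrier) (mass : sum p ≈ 1#) where

    -- The first element of `A` may go to any `u` in `B`, and the rest must then biject onto
    -- `B ∖ u`. The weight of `u` restores the monomial of `B` whichever `u` was chosen, so each
    -- element contributes only its number of choices.
    Pr-bij : ∀ {a} (A : Subset a) (B : Subset b) →
             𝔼 (iid a (finᴰ p mass)) (λ f → ⟦ bij? f A B ⟧) ≈ ⟦ ∣ A ∣ ℕₚ.≟ ∣ B ∣ ⟧ * (nat (∣ A ∣ !) * monomial p B)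
    Pr-bij [] B with ∣ B ∣ ℕₚ.≟ 0
    ... | yes ∣B∣≡0 = begin
      𝔼 (iid 0 D) (λ f → ⟦ bij? f [] B ⟧)
        ≈⟨ 𝔼-cong (iid 0 D) (λ f → ⟦⟧-yes (bij? f [] B) ((λ ()) , (λ ()) , λ w w∈ → contradiction w∈ (∣∣≡0⇒∉ ∣B∣≡0 w))) ⟩
      𝔼 (iid 0 D) (λ _ → 1#)
        ≈⟨ 𝔼-const (iid 0 D) 1# ⟩
      1#
        ≈⟨ ≈-trans (*-cong nat-1 (monomial-empty p (∣∣≡0⇒∉ ∣B∣≡0))) (*-identityˡ _) ⟨
      nat 1 * monomial p B
        ≈⟨ ≈-trans (*-congʳ (⟦⟧-yes (0 ℕₚ.≟ ∣ B ∣) (sym ∣B∣≡0))) (*-identityˡ _) ⟨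
      ⟦ 0 ℕₚ.≟ ∣ B ∣ ⟧ * (nat 1 * monomial p B) ∎
      where D = finᴰ p mass
    ... | no ∣B∣≢0 = begin
      𝔼 (iid 0 D) (λ f → ⟦ bij? f [] B ⟧)
        ≈⟨ 𝔼-cong (iid 0 D) (λ f → ⟦⟧-no (bij? f [] B) (∣B∣≢0 ∘ sym ∘ bij-∣∣ {f = f} {[]})) ⟩
      𝔼 (iid 0 D) (λ _ → 0#)
        ≈⟨ 𝔼-const (iid 0 D) 0# ⟩
      0#
        ≈⟨ ≈-trans (*-congʳ (⟦⟧-no (0 ℕₚ.≟ ∣ B ∣) (∣B∣≢0 ∘ sym))) (zeroˡ _) ⟨
      ⟦ 0 ℕₚ.≟ ∣ B ∣ ⟧ * (nat 1 * monomial p B) ∎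
      where D = finᴰ p mass
    Pr-bij {suc a} (outside ∷ A) B = begin
      𝔼 (iid (suc a) D) (λ f → ⟦ bij? f (outside ∷ A) B ⟧)
        ≈⟨ 𝔼-Π-suc (λ _ → D) _ ⟩
      𝔼 D (λ u → 𝔼 (iid a D) (λ g → ⟦ bij? (∀-cons u g) (outside ∷ A) B ⟧))
        ≈⟨ 𝔼-cong D (λ u → 𝔼-cong (iid a D) (λ g → ⟦⟧-⇔ (bij? (∀-cons u g) (outside ∷ A) B) (bij? g A B) bij-outside⁻ bij-outside⁺)) ⟩
      𝔼 D (λ u → 𝔼 (iid a D) (λ g → ⟦ bij? g A B ⟧))
        ≈⟨ 𝔼-const D _ ⟩
      𝔼 (iid a D) (λ g → ⟦ bij? g A B ⟧)
        ≈⟨ Pr-bij A B ⟩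
      ⟦ ∣ A ∣ ℕₚ.≟ ∣ B ∣ ⟧ * (nat (∣ A ∣ !) * monomial p B) ∎
      where D = finᴰ p mass
    Pr-bij {suc a} (inside ∷ A) B = begin
      𝔼 (iid (suc a) D) (λ f → ⟦ bij? f (inside ∷ A) B ⟧)
        ≈⟨ 𝔼-Π-suc (λ _ → D) _ ⟩
      𝔼 D (λ u → 𝔼 (iid a D) (λ g → ⟦ bij? (∀-cons u g) (inside ∷ A) B ⟧))
        ≈⟨ 𝔼-cong D (λ u → ≈-trans (𝔼-cong (iid a D) (λ g → ≈-trans
             (⟦⟧-⇔ (bij? (∀-cons u g) (inside ∷ A) B) (u ∈? B ×-dec bij? g A (B ∖ u)) bij-inside⁻ (λ (u∈ , g-bij) → bij-inside⁺ u∈ g-bij))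
             (⟦⟧-× (u ∈? B) (bij? g A (B ∖ u)))))
             (≈-trans (𝔼-*ˡ (iid a D) ⟦ u ∈? B ⟧ (λ g → ⟦ bij? g A (B ∖ u) ⟧)) (*-congˡ (Pr-bij A (B ∖ u))))) ⟩
      𝔼 D (λ u → ⟦ u ∈? B ⟧ * (⟦ ∣ A ∣ ℕₚ.≟ ∣ B ∖ u ∣ ⟧ * (nat (∣ A ∣ !) * monomial p (B ∖ u))))
        ≈⟨ ∑-cong (allFin b) (λ u → ≈-trans
             (solve 3 (λ x y z → x :* (y :* z) := y :* (x :* z)) ≈-refl (p u) ⟦ u ∈? B ⟧ _)
             (⟦⟧*-cong (u ∈? B) (λ u∈ → move u u∈))) ⟩
      ∑ (allFin b) (λ u → ⟦ u ∈? B ⟧ * (⟦ suc ∣ A ∣ ℕₚ.≟ ∣ B ∣ ⟧ * (nat (∣ A ∣ !) * monomial p B)))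
        ≈⟨ ∑-*ʳ (allFin b) _ (λ u → ⟦ u ∈? B ⟧) ⟩
      ∑ (allFin b) (λ u → ⟦ u ∈? B ⟧) * (⟦ suc ∣ A ∣ ℕₚ.≟ ∣ B ∣ ⟧ * (nat (∣ A ∣ !) * monomial p B))
        ≈⟨ *-congʳ (≈-trans (∑-allFin (λ u → ⟦ u ∈? B ⟧)) (sum-∈ B)) ⟩
      nat ∣ B ∣ * (⟦ suc ∣ A ∣ ℕₚ.≟ ∣ B ∣ ⟧ * (nat (∣ A ∣ !) * monomial p B))
        ≈⟨ solve 4 (λ x y z w → x :* (y :* (z :* w)) := y :* ((x :* z) :* w)) ≈-refl (nat ∣ B ∣) _ _ _ ⟩
      ⟦ suc ∣ A ∣ ℕₚ.≟ ∣ B ∣ ⟧ * ((nat ∣ B ∣ * nat (∣ A ∣ !)) * monomial p B)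
        ≈⟨ ⟦⟧*-cong (suc ∣ A ∣ ℕₚ.≟ ∣ B ∣) (λ eq → *-congʳ (≈-trans (*-congʳ (≈-reflexive (cong nat (sym eq)))) (≈-sym (nat-* (suc ∣ A ∣) (∣ A ∣ !))))) ⟩
      ⟦ suc ∣ A ∣ ℕₚ.≟ ∣ B ∣ ⟧ * (nat (suc ∣ A ∣ !) * monomial p B) ∎
      where
      D = finᴰ p mass
      move : ∀ u → u ∈ B → p u * (⟦ ∣ A ∣ ℕₚ.≟ ∣ B ∖ u ∣ ⟧ * (nat (∣ A ∣ !) * monomial p (B ∖ u)))
                           ≈ ⟦ suc ∣ A ∣ ℕₚ.≟ ∣ B ∣ ⟧ * (nat (∣ A ∣ !) * monomial p B)
      move u u∈ = begin
        p u * (⟦ ∣ A ∣ ℕₚ.≟ ∣ B ∖ u ∣ ⟧ * (nat (∣ A ∣ !) * monomial p (B ∖ u)))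
          ≈⟨ solve 4 (λ x y z w → x :* (y :* (z :* w)) := y :* (z :* (x :* w))) ≈-refl (p u) _ _ _ ⟩
        ⟦ ∣ A ∣ ℕₚ.≟ ∣ B ∖ u ∣ ⟧ * (nat (∣ A ∣ !) * (p u * monomial p (B ∖ u)))
          ≈⟨ *-cong (⟦⟧-⇔ (∣ A ∣ ℕₚ.≟ ∣ B ∖ u ∣) (suc ∣ A ∣ ℕₚ.≟ ∣ B ∣)
                       (λ eq → trans (cong suc eq) (suc∣remove∣ u∈))
                       (λ eq → ℕₚ.suc-injective (trans eq (sym (suc∣remove∣ u∈)))))
                    (*-congˡ (monomial-remove p u∈)) ⟩
        ⟦ suc ∣ A ∣ ℕₚ.≟ ∣ B ∣ ⟧ * (nat (∣ A ∣ !) * monomial p B) ∎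

  AgreeOn : ∀ {a b} → Subset a → (Fin a → Fin b) → (Fin a → Fin b) → Set
  AgreeOn A f g = ∀ v → v ∈ A → f v ≡ g v

  -- As τ is injective on A, resampling f at τ zero leaves f ∘ τ unchanged on the rest of A.
  𝔼-pullback : ∀ {a b d} (D : Distribution (Fin d)) (A : Subset a) (τ : Fin a → Fin b) →
               (∀ u v → u ∈ A → v ∈ A → τ u ≡ τ v → u ≡ v) →
               ∀ φ → Respects (AgreeOn A) φ → 𝔼 (iid b D) (λ f → φ (f ∘ τ)) ≈ 𝔼 (iid a D) φ
  𝔼-pullback {zero} {b} {d} D [] τ τ-inj φ φ∼ = begin
    𝔼 (iid b D) (λ f → φ (f ∘ τ))  ≈⟨ 𝔼-cong (iid b D) (λ f → φ∼ (f ∘ τ) none (λ ())) ⟩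
    𝔼 (iid b D) (λ f → φ none)     ≈⟨ 𝔼-const (iid b D) (φ none) ⟩
    φ none                         ≈⟨ 𝔼-const (iid 0 D) (φ none) ⟨
    𝔼 (iid 0 D) (λ _ → φ none)     ≈⟨ 𝔼-cong (iid 0 D) (λ f → φ∼ none f (λ ())) ⟩
    𝔼 (iid 0 D) φ                  ∎
    where
    none : Fin 0 → Fin d
    none ()
  𝔼-pullback {suc a} {b} D (s ∷ A) τ τ-inj φ φ∼ = begin
    𝔼 (iid b D) (λ f → φ (f ∘ τ))
      ≈⟨ split s φ∼ τ-inj ⟩
    𝔼 (iid b D) (λ f → 𝔼 D (λ u → φ (∀-cons u (f ∘ τ ∘ suc))))
      ≈⟨ 𝔼-pullback D A (τ ∘ suc) (λ u v u∈ v∈ eq → suc-injective (τ-inj _ _ (there u∈) (there v∈) eq))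
           (λ h → 𝔼 D (λ u → φ (∀-cons u h))) (λ h h′ h∼ → 𝔼-cong D (λ u → φ∼ _ _ (extend u h∼))) ⟩
    𝔼 (iid a D) (λ h → 𝔼 D (λ u → φ (∀-cons u h)))
      ≈⟨ 𝔼-swap (iid a D) D (λ h u → φ (∀-cons u h)) ⟩
    𝔼 D (λ u → 𝔼 (iid a D) (λ h → φ (∀-cons u h)))
      ≈⟨ 𝔼-Π-suc (λ _ → D) φ ⟨
    𝔼 (iid (suc a) D) φ ∎
    where
    extend : ∀ {s} u {h h′} → AgreeOn A h h′ → AgreeOn (s ∷ A) (∀-cons u h) (∀-cons u h′)
    extend u h∼ zero    here       = refl
    extend u h∼ (suc v) (there v∈) = h∼ v v∈

    split : ∀ s → Respects (AgreeOn (s ∷ A)) φ → (∀ u v → u ∈ s ∷ A → v ∈ s ∷ A → τ u ≡ τ v → u ≡ v) →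
            𝔼 (iid b D) (λ f → φ (f ∘ τ)) ≈ 𝔼 (iid b D) (λ f → 𝔼 D (λ u → φ (∀-cons u (f ∘ τ ∘ suc))))
    -- `φ` does not read index zero here, so a random value may be put there and averaged out.
    split outside φ∼ τ-inj = 𝔼-cong (iid b D) (λ f → ≈-trans (≈-sym (𝔼-const D _))
      (𝔼-cong D (λ u → φ∼ (f ∘ τ) (∀-cons u (f ∘ τ ∘ suc)) λ { (suc v) (there v∈) → refl })))
    split inside φ∼ τ-inj = ≈-trans
      (𝔼-cong (iid b D) (λ f → φ∼ (f ∘ τ) (∀-cons (f (τ zero)) (f ∘ τ ∘ suc)) (λ { zero _ → refl ; (suc v) _ → refl })))
      (resample (λ _ → D) (τ zero) (λ u f → φ (∀-cons u (f ∘ τ ∘ suc)))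
        (λ u f g f∼ → φ∼ _ _ (extend u (λ v v∈ → f∼ (τ (suc v)) (λ eq → contradiction (τ-inj _ _ (there v∈) here eq) λ ())))))

  -- At each point one of the two relations is total, according to whether the point lies in `A`, so
  -- one of the two factors is constant there.
  independent-iid : ∀ {a b} (D : Distribution (Fin b)) (A : Subset a) →
                    Independent (iid a D) (λ f g → ∀ v → v ∈ A → f v ≡ g v) (λ f g → ∀ v → v ∉ A → f v ≡ g v)
  independent-iid D A = independent-Π (λ _ → D) (λ _ _ → refl) (λ _ _ → refl) ind
    where
    ind : ∀ v → Independent D (λ x y → v ∈ A → x ≡ y) (λ x y → v ∉ A → x ≡ y)
    ind v {φ} {ψ} with v ∈? A
    ... | yes v∈ = independent-total D {_∼₁_ = λ x y → v ∈ A → x ≡ y} {_∼₂_ = λ x y → v ∉ A → x ≡ y} (λ _ _ v∉ → contradiction v∈ v∉) {φ} {ψ}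
    ... | no  v∉ = independent-sym D {_∼₁_ = λ x y → v ∉ A → x ≡ y} {_∼₂_ = λ x y → v ∈ A → x ≡ y} (λ {φ} {ψ} → independent-total D {_∼₁_ = λ x y → v ∉ A → x ≡ y} {_∼₂_ = λ x y → v ∈ A → x ≡ y} (λ _ _ v∈ → contradiction v∈ v∉) {φ} {ψ}) {φ} {ψ}

-- Cycles of a self-map

count : ∀ {A : Set} {P : A → Set} → Decidable P → List A → ℕ
count P? xs = length (filter P? xs)

module _ {A : Set} where

  count-⊎ : ∀ {P Q E : A → Set} (P? : Decidable P) (Q? : Decidable Q) (E? : Decidable E) →
            (∀ a → P a → Q a ⊎ E a) → (∀ a → Q a → P a) → (∀ a → E a → P a) → (∀ a → Q a → ¬ E a) →
            ∀ xs → count P? xs ≡ count Q? xs ℕ.+ count E? xs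
  count-⊎ P? Q? E? P⇒ Q⇒ E⇒ Q∩E [] = refl
  count-⊎ P? Q? E? P⇒ Q⇒ E⇒ Q∩E (x ∷ xs) with ih ← count-⊎ P? Q? E? P⇒ Q⇒ E⇒ Q∩E xs | P? x | Q? x | E? x
  ... | _     | yes q | yes e = contradiction e (Q∩E x q)
  ... | yes _ | yes _ | no _  = cong suc ih
  ... | yes _ | no _  | yes _ = trans (cong suc ih) (sym (ℕₚ.+-suc _ _))
  ... | yes p | no ¬q | no ¬e = contradiction (P⇒ x p) [ ¬q , ¬e ]′
  ... | no ¬p | yes q | no _  = contradiction (Q⇒ x q) ¬p
  ... | no ¬p | no _  | yes e = contradiction (E⇒ x e) ¬p
  ... | no _  | no _  | no _  = ih

  count-⇔ : ∀ {P Q : A → Set} (P? : Decidable P) (Q? : Decidable Q) →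
            (∀ a → P a → Q a) → (∀ a → Q a → P a) → ∀ xs → count P? xs ≡ count Q? xs
  count-⇔ P? Q? P⇒Q Q⇒P [] = refl
  count-⇔ P? Q? P⇒Q Q⇒P (x ∷ xs) with ih ← count-⇔ P? Q? P⇒Q Q⇒P xs | P? x | Q? x
  ... | yes _ | yes _ = cong suc ih
  ... | yes p | no ¬q = contradiction (P⇒Q x p) ¬q
  ... | no ¬p | yes q = contradiction (Q⇒P x q) ¬p
  ... | no _  | no _  = ih

  count-none : ∀ {P : A → Set} (P? : Decidable P) → (∀ a → ¬ P a) → ∀ xs → count P? xs ≡ 0
  count-none P? ¬P [] = refl
  count-none P? ¬P (x ∷ xs) with P? x
  ... | yes p = contradiction p (¬P x)
  ... | no _  = count-none P? ¬P xs

  count-map : ∀ {B : Set} {P : A → Set} (P? : Decidable P) (g : B → A) ys → count P? (map g ys) ≡ count (P? ∘ g) ys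
  count-map P? g [] = refl
  count-map P? g (y ∷ ys) with P? (g y)
  ... | yes _ = cong suc (count-map P? g ys)
  ... | no _  = count-map P? g ys

  count-++ : ∀ {P : A → Set} (P? : Decidable P) xs ys → count P? (xs ++ ys) ≡ count P? xs ℕ.+ count P? ys
  count-++ P? xs ys = trans (cong length (filter-++ P? xs ys)) (length-++ (filter P? xs))

count-subsets-≡ : ∀ {m} (T : Subset m) → count (_≟ˢ T) (subsets m) ≡ 1
count-subsets-≡ [] = refl
count-subsets-≡ {suc m} (t ∷ T) = trans (count-++ (_≟ˢ (t ∷ T)) (map (inside ∷_) (subsets m)) _)
  (trans (cong₂ ℕ._+_ (count-map (_≟ˢ (t ∷ T)) (inside ∷_) (subsets m)) (count-map (_≟ˢ (t ∷ T)) (outside ∷_) (subsets m))) (split t))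
  where
  split : ∀ t → count (λ S → (inside ∷ S) ≟ˢ (t ∷ T)) (subsets m) ℕ.+ count (λ S → (outside ∷ S) ≟ˢ (t ∷ T)) (subsets m) ≡ 1
  split inside  = cong₂ ℕ._+_
    (trans (count-⇔ (λ S → (inside ∷ S) ≟ˢ (inside ∷ T)) (_≟ˢ T) (λ { _ refl → refl }) (λ { _ refl → refl }) (subsets m)) (count-subsets-≡ T))
    (count-none (λ S → (outside ∷ S) ≟ˢ (inside ∷ T)) (λ _ ()) (subsets m))
  split outside = cong₂ ℕ._+_
    (count-none (λ S → (inside ∷ S) ≟ˢ (outside ∷ T)) (λ _ ()) (subsets m))
    (trans (count-⇔ (λ S → (outside ∷ S) ≟ˢ (outside ∷ T)) (_≟ˢ T) (λ { _ refl → refl }) (λ { _ refl → refl }) (subsets m)) (count-subsets-≡ T))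

module _ {A : Set} where

  open Endo A using (_^_)

  ^-suc : ∀ (g : A → A) m v → (g ^ m) (g v) ≡ (g ^ suc m) v
  ^-suc g zero    v = refl
  ^-suc g (suc m) v = cong g (^-suc g m v)

  ^-+ : ∀ (g : A → A) a b v → (g ^ (a ℕ.+ b)) v ≡ (g ^ a) ((g ^ b) v)
  ^-+ g zero    b v = refl
  ^-+ g (suc a) b v = cong g (^-+ g a b v)

  ^-period : ∀ (g : A → A) l v → (g ^ l) v ≡ v → ∀ q → (g ^ (q ℕ.* l)) v ≡ v
  ^-period g l v eq zero    = refl
  ^-period g l v eq (suc q) = trans (^-+ g l (q ℕ.* l) v) (trans (cong (g ^ l) (^-period g l v eq q)) eq)

  ^-mod : ∀ (g : A → A) l .{{_ : NonZero l}} v → (g ^ l) v ≡ v → ∀ t → (g ^ (t % l)) v ≡ (g ^ t) v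
  ^-mod g l v eq t = sym (trans (cong (λ t → (g ^ t) v) (m≡m%n+[m/n]*n t l))
    (trans (^-+ g (t % l) (t div l ℕ.* l) v) (cong (g ^ (t % l)) (^-period g l v eq (t div l)))))

module _ {n : ℕ} where

  open Endo (Fin n) using (_^_)

  -- The same as IsCycle, with the union of singletons spelled out.
  Orbit : (Fin n → Fin n) → ℕ → Subset n → Fin n → Set
  Orbit g l C v = (g ^ l) v ≡ v × (∀ x → x ∈ C → ∃ λ j → j < l × (g ^ j) v ≡ x) × (∀ j → j < l → (g ^ j) v ∈ C)

  private
    ∈-⋃⁻ : ∀ (h : ℕ → Fin n) js {x} → x ∈ ⋃ (map (λ j → ⁅ h j ⁆) js) → ∃ λ j → j ∈ᴸ js × h j ≡ x
    ∈-⋃⁻ h []       x∈ = contradiction x∈ ∉⊥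
    ∈-⋃⁻ h (j ∷ js) x∈ with x∈p∪q⁻ ⁅ h j ⁆ _ x∈
    ... | inj₁ x∈j  = j , here refl , sym (x∈⁅y⁆⇒x≡y (h j) x∈j)
    ... | inj₂ x∈js = let (i , i∈ , eq) = ∈-⋃⁻ h js x∈js in i , there i∈ , eq

    ∈-⋃⁺ : ∀ (h : ℕ → Fin n) {js j} → j ∈ᴸ js → h j ∈ ⋃ (map (λ j → ⁅ h j ⁆) js)
    ∈-⋃⁺ h {j ∷ js} (here refl) = p⊆p∪q _ (x∈⁅x⁆ (h j))
    ∈-⋃⁺ h {j ∷ js} (there j∈)  = q⊆p∪q ⁅ h j ⁆ _ (∈-⋃⁺ h j∈)

  isCycle⇒orbit : ∀ {g l C} → IsCycle g l C → ∃ (Orbit g l C)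
  isCycle⇒orbit {g} {l} (_ , v , eq , refl) = v , eq ,
    (λ x x∈ → let (j , j∈ , eq) = ∈-⋃⁻ (λ j → (g ^ j) v) (upTo l) x∈ in j , ∈-upTo⁻ j∈ , eq) ,
    (λ j j<l → ∈-⋃⁺ (λ j → (g ^ j) v) (∈-upTo⁺ j<l))

  orbit⇒isCycle : ∀ {g l C v} → ∣ C ∣ ≡ l → Orbit g l C v → IsCycle g l C
  orbit⇒isCycle {g} {l} {C} {v} ∣C∣ (eq , C⇒ , ⇒C) = ∣C∣ , v , eq , ⊆-antisym C⊆ ⊆C
    where
    C⊆ : C ⊆ ⋃ (map (λ j → ⁅ (g ^ j) v ⁆) (upTo l))
    C⊆ {x} x∈ = let (j , j<l , eq) = C⇒ x x∈ in subst (_∈ _) eq (∈-⋃⁺ (λ j → (g ^ j) v) (∈-upTo⁺ j<l))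
    ⊆C : ⋃ (map (λ j → ⁅ (g ^ j) v ⁆) (upTo l)) ⊆ C
    ⊆C x∈ = let (j , j∈ , eq) = ∈-⋃⁻ (λ j → (g ^ j) v) (upTo l) x∈ in subst (_∈ C) eq (⇒C j (∈-upTo⁻ j∈))

  rebase : ∀ {g l C v} .{{_ : NonZero l}} → Orbit g l C v → ∀ {a} → a ∈ C → Orbit g l C a
  rebase {g} {l} {C} {v} (eq , C⇒ , ⇒C) {a} a∈ with i , i<l , refl ← C⇒ a a∈ =
    periodic , reach , stay
    where
    shifted : ∀ t → (g ^ t) ((g ^ i) v) ≡ (g ^ (t ℕ.+ i)) v
    shifted t = sym (^-+ g t i v)
    periodic : (g ^ l) ((g ^ i) v) ≡ (g ^ i) v
    periodic = trans (shifted l) (trans (cong (λ t → (g ^ t) v) (ℕₚ.+-comm l i)) (trans (^-+ g i l v) (cong (g ^ i) eq)))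
    reach : ∀ x → x ∈ C → ∃ λ j → j < l × (g ^ j) ((g ^ i) v) ≡ x
    reach x x∈ with j , j<l , refl ← C⇒ x x∈ =
      -- From the i-th iterate, `l - i` steps complete the turn back to `v` and `j` more reach `x`.
      (j ℕ.+ (l ℕ.∸ i)) % l , m%n<n _ l ,
      trans (^-mod g l _ periodic (j ℕ.+ (l ℕ.∸ i))) (trans (shifted (j ℕ.+ (l ℕ.∸ i)))
        (trans (cong (λ t → (g ^ t) v) (trans (ℕₚ.+-assoc j (l ℕ.∸ i) i) (cong (j ℕ.+_) (ℕₚ.m∸n+n≡m (ℕₚ.<⇒≤ i<l)))))
          (trans (^-+ g j l v) (cong (g ^ j) eq))))
    stay : ∀ j → j < l → (g ^ j) ((g ^ i) v) ∈ C
    stay j j<l = subst (_∈ C) (trans (^-mod g l v eq (j ℕ.+ i)) (^-+ g j i v)) (⇒C _ (m%n<n (j ℕ.+ i) l))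

  module _ {g : Fin n → Fin n} {l : ℕ} .{{_ : NonZero l}} {C : Subset n} (cyc : IsCycle g l C) where

    private
      orbitAt : ∀ {a} → a ∈ C → Orbit g l C a
      orbitAt = rebase (proj₂ (isCycle⇒orbit cyc))

    cycle-^∈ : ∀ t {a} → a ∈ C → (g ^ t) a ∈ C
    cycle-^∈ t {a} a∈ = let (eq , _ , ⇒C) = orbitAt a∈ in subst (_∈ C) (^-mod g l a eq t) (⇒C (t % l) (m%n<n t l))

    cycle-transitive : ∀ {a b} → a ∈ C → b ∈ C → ∃ λ t → (g ^ t) a ≡ b
    cycle-transitive a∈ b∈ = let (_ , C⇒ , _) = orbitAt a∈; (j , _ , eq) = C⇒ _ b∈ in j , eq

    cycle-period : ∀ {a} → a ∈ C → (g ^ l) a ≡ a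
    cycle-period a∈ = proj₁ (orbitAt a∈)

    cycle-nonempty : ∃ (_∈ C)
    cycle-nonempty = let (v , _ , _ , ⇒C) = isCycle⇒orbit cyc in v , ⇒C 0 (ℕ.>-nonZero⁻¹ l)

    cycle-bij : Bij g C C
    cycle-bij = (λ v v∈ → cycle-^∈ 1 v∈) , inj , sur
      where
      -- On the cycle, `g ^ (l - 1)` inverts `g`.
      back : ∀ v → v ∈ C → (g ^ (ℕ.pred l)) (g v) ≡ v
      back v v∈ = trans (^-suc g (ℕ.pred l) v) (trans (cong (λ t → (g ^ t) v) (ℕₚ.suc-pred l)) (cycle-period v∈))
      inj : ∀ u v → u ∈ C → v ∈ C → g u ≡ g v → u ≡ v
      inj u v u∈ v∈ eq = trans (sym (back u u∈)) (trans (cong (g ^ ℕ.pred l) eq) (back v v∈))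
      sur : ∀ w → w ∈ C → ∃ λ v → v ∈ C × g v ≡ w
      sur w w∈ = (g ^ ℕ.pred l) w , cycle-^∈ (ℕ.pred l) w∈ , trans (cong (λ t → (g ^ t) w) (ℕₚ.suc-pred l)) (cycle-period w∈)

  -- A cycle is the forward orbit of any of its points, so a common point determines both.
  cycles-meet : ∀ {g l l′ C C′} .{{_ : NonZero l}} .{{_ : NonZero l′}} → IsCycle g l C → IsCycle g l′ C′ →
                ∀ {u} → u ∈ C → u ∈ C′ → C ≡ C′
  cycles-meet {g} {l} {l′} {C} {C′} cyc cyc′ u∈ u∈′ = ⊆-antisym
    (λ x∈ → let (t , eq) = cycle-transitive cyc u∈ x∈ in subst (_∈ C′) eq (cycle-^∈ cyc′ t u∈′))
    (λ x∈ → let (t , eq) = cycle-transitive cyc′ u∈′ x∈ in subst (_∈ C) eq (cycle-^∈ cyc t u∈))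

  isCycle-resp : ∀ {g g′ : Fin n → Fin n} {l C} → (∀ v → v ∈ C → g v ≡ g′ v) → IsCycle g l C → IsCycle g′ l C
  isCycle-resp {g} {g′} {l} {C} g≡g′ cyc with v , eq , C⇒ , ⇒C ← isCycle⇒orbit cyc =
    orbit⇒isCycle (proj₁ cyc) (trans (sym (same l ℕₚ.≤-refl)) eq ,
      (λ x x∈ → let (j , j<l , eq) = C⇒ x x∈ in j , j<l , trans (sym (same j (ℕₚ.<⇒≤ j<l))) eq) ,
      (λ j j<l → subst (_∈ C) (same j (ℕₚ.<⇒≤ j<l)) (⇒C j j<l)))
    where
    same : ∀ j → j ≤ l → (g ^ j) v ≡ (g′ ^ j) v
    same zero    _   = refl
    same (suc j) j<l = trans (g≡g′ _ (⇒C j j<l)) (cong g′ (same j (ℕₚ.<⇒≤ j<l)))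

  -- Chain m g a U b: starting from a, g runs once through the m-element set U and then arrives at b.
  Chain : ℕ → (Fin n → Fin n) → Fin n → Subset n → Fin n → Set
  Chain zero    g a U b = g a ≡ b
  Chain (suc m) g a U b = g a ∈ U × Chain m g (g a) (U ∖ g a) b

  chain? : ∀ m g a U b → Dec (Chain m g a U b)
  chain? zero    g a U b = g a ≟ᶠ b
  chain? (suc m) g a U b = (g a ∈? U) ×-dec chain? m g (g a) (U ∖ g a) b

  chain-resp : ∀ m {g g′ a U b} → g a ≡ g′ a → (∀ v → v ∈ U → g v ≡ g′ v) → Chain m g a U b → Chain m g′ a U b
  chain-resp zero    ga≡ gU≡ eq = trans (sym ga≡) eq
  chain-resp (suc m) {g} {g′} {a} {U} {b} ga≡ gU≡ (ga∈ , ch) =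
    subst (λ u → u ∈ U × Chain m g′ u (U ∖ u) b) ga≡
      (ga∈ , chain-resp m (gU≡ _ ga∈) (λ v v∈ → gU≡ v (proj₁ (∈-remove⁻ v∈))) ch)

  chain⇒orbit : ∀ m {g a U b} → ∣ U ∣ ≡ m → Chain m g a U b →
                (g ^ suc m) a ≡ b × (∀ x → x ∈ U → ∃ λ j → j < m × (g ^ suc j) a ≡ x) × (∀ j → j < m → (g ^ suc j) a ∈ U)
  chain⇒orbit zero    ∣U∣ eq = eq , (λ x x∈ → contradiction x∈ (∣∣≡0⇒∉ ∣U∣ x)) , (λ _ ())
  chain⇒orbit (suc m) {g} {a} {U} {b} ∣U∣ (ga∈ , ch)
    with eq , U⇒ , ⇒U ← chain⇒orbit m (ℕₚ.suc-injective (trans (suc∣remove∣ ga∈) ∣U∣)) ch =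
    trans (sym (^-suc g (suc m) a)) eq , reach , stay
    where
    reach : ∀ x → x ∈ U → ∃ λ j → j < suc m × (g ^ suc j) a ≡ x
    reach x x∈ with x ≟ᶠ g a
    ... | yes refl = 0 , s≤s z≤n , refl
    ... | no x≢    = let (j , j<m , eq) = U⇒ x (x∈p∧x≢y⇒x∈p-y x∈ x≢) in
      suc j , s≤s j<m , trans (sym (^-suc g (suc j) a)) eq
    stay : ∀ j → j < suc m → (g ^ suc j) a ∈ U
    stay zero    _         = ga∈
    stay (suc j) (s≤s j<m) = proj₁ (∈-remove⁻ (subst (_∈ (U ∖ g a)) (^-suc g (suc j) a) (⇒U j j<m)))

  trail : (Fin n → Fin n) → ℕ → Fin n → List (Fin n)
  trail g zero    a = []
  trail g (suc m) a = a ∷ trail g m (g a)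

  ∈-trail : ∀ g {m j} a → j < m → (g ^ j) a ∈ᴸ trail g m a
  ∈-trail g {suc m} {zero}  a _         = here refl
  ∈-trail g {suc m} {suc j} a (s≤s j<m) = there (subst (_∈ᴸ trail g m (g a)) (^-suc g j a) (∈-trail g (g a) j<m))

  length-trail : ∀ g m a → length (trail g m a) ≡ m
  length-trail g zero    a = refl
  length-trail g (suc m) a = cong suc (length-trail g m (g a))

  ∣∣≤length : ∀ (xs : List (Fin n)) {U : Subset n} → (∀ x → x ∈ U → x ∈ᴸ xs) → ∣ U ∣ ≤ length xs
  ∣∣≤length []       {U} U⊆ = ℕₚ.≤-reflexive (trans (cong ∣_∣ (Empty-unique {p = U} λ (x , x∈) → contradiction (U⊆ x x∈) λ ())) (∣⊥∣≡0 n))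
  ∣∣≤length (y ∷ xs) {U} U⊆ with y ∈? U
  ... | yes y∈ = subst (_≤ suc (length xs)) (suc∣remove∣ y∈) (s≤s (∣∣≤length xs λ x x∈ → drop x (∈-remove⁻ x∈)))
    where
    drop : ∀ x → x ∈ U × x ≢ y → x ∈ᴸ xs
    drop x (x∈ , x≢y) with U⊆ x x∈
    ... | here x≡y  = contradiction x≡y x≢y
    ... | there x∈′ = x∈′
  ... | no y∉ = ℕₚ.m≤n⇒m≤1+n (∣∣≤length xs drop)
    where
    drop : ∀ x → x ∈ U → x ∈ᴸ xs
    drop x x∈ with U⊆ x x∈
    ... | here refl = contradiction x∈ y∉
    ... | there x∈′ = x∈′

  -- If the next point missed `U`, the remaining trail, shorter than `∣ U ∣`, would still cover `U`,
  -- against `∣∣≤length`. Applied after each removal, this excludes repetitions as well.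
  cover⇒chain : ∀ m {g a U b} → (∀ x → x ∈ U → x ∈ᴸ trail g m (g a)) → ∣ U ∣ ≡ m → (g ^ suc m) a ≡ b → Chain m g a U b
  cover⇒chain zero    U⊆ ∣U∣ eq = eq
  cover⇒chain (suc m) {g} {a} {U} U⊆ ∣U∣ eq with g a ∈? U
  ... | no ga∉ = contradiction (ℕₚ.≤-trans (ℕₚ.≤-reflexive (sym ∣U∣))
                   (ℕₚ.≤-trans (∣∣≤length (trail g m (g (g a))) drop) (ℕₚ.≤-reflexive (length-trail g m _)))) (ℕₚ.<-irrefl refl)
    where
    drop : ∀ x → x ∈ U → x ∈ᴸ trail g m (g (g a))
    drop x x∈ with U⊆ x x∈
    ... | here refl = contradiction x∈ ga∉
    ... | there x∈′ = x∈′
  ... | yes ga∈ = ga∈ , cover⇒chain m (λ x x∈ → drop x (∈-remove⁻ x∈)) (ℕₚ.suc-injective (trans (suc∣remove∣ ga∈) ∣U∣)) (trans (^-suc g (suc m) a) eq)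
    where
    drop : ∀ x → x ∈ U × x ≢ g a → x ∈ᴸ trail g m (g (g a))
    drop x (x∈ , x≢) with U⊆ x x∈
    ... | here x≡   = contradiction x≡ x≢
    ... | there x∈′ = x∈′

  isCycle⇒chain : ∀ {g m C a} → a ∈ C → IsCycle g (suc m) C → Chain m g a (C ∖ a) a
  isCycle⇒chain {g} {m} {C} {a} a∈ cyc with eq , C⇒ , _ ← rebase (proj₂ (isCycle⇒orbit cyc)) a∈ =
    cover⇒chain m (λ x x∈ → cover x (∈-remove⁻ x∈)) (ℕₚ.suc-injective (trans (suc∣remove∣ a∈) (proj₁ cyc))) eq
    where
    cover : ∀ x → x ∈ C × x ≢ a → x ∈ᴸ trail g m (g a)
    cover x (x∈ , x≢a) with C⇒ x x∈
    ... | zero  , _       , refl = contradiction refl x≢a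
    ... | suc j , s≤s j<m , refl = subst (_∈ᴸ trail g m (g a)) (^-suc g j a) (∈-trail g (g a) j<m)

  chain⇒isCycle : ∀ {g m C a} → a ∈ C → ∣ C ∣ ≡ suc m → Chain m g a (C ∖ a) a → IsCycle g (suc m) C
  chain⇒isCycle {g} {m} {C} {a} a∈ ∣C∣ ch
    with eq , U⇒ , ⇒U ← chain⇒orbit m (ℕₚ.suc-injective (trans (suc∣remove∣ a∈) ∣C∣)) ch =
    orbit⇒isCycle ∣C∣ (eq , reach , stay)
    where
    reach : ∀ x → x ∈ C → ∃ λ j → j < suc m × (g ^ j) a ≡ x
    reach x x∈ with x ≟ᶠ a
    ... | yes refl = 0 , s≤s z≤n , refl
    ... | no x≢a   = let (j , j<m , eq) = U⇒ x (x∈p∧x≢y⇒x∈p-y x∈ x≢a) in suc j , s≤s j<m , eq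
    stay : ∀ j → j < suc m → (g ^ j) a ∈ C
    stay zero    _         = a∈
    stay (suc j) (s≤s j<m) = proj₁ (∈-remove⁻ (⇒U j j<m))

  module _ {g : Fin n → Fin n} {l : ℕ} .{{_ : NonZero l}} {C S : Subset n} (cyc : IsCycle g l C) (C⊆S : C ⊆ S) where

    bij-remove-cycle : Bij g S S → Bij g (S ─ C) (S ─ C)
    bij-remove-cycle (g∈ , g-inj , g-sur) =
      -- If `g v` were in `C`, it would have a preimage in `C`, and injectivity on `S` would put `v`
      -- there.
      (λ v v∈ → x∈p∧x∉q⇒x∈p─q (g∈ v (p─q⊆p S C v∈)) λ gv∈C →
        let (u , u∈C , gu≡gv) = proj₂ (proj₂ (cycle-bij cyc)) _ gv∈C in
        ∈─⇒∉ v∈ (subst (_∈ C) (g-inj u v (C⊆S u∈C) (p─q⊆p S C v∈) gu≡gv) u∈C)) ,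
      (λ u v u∈ v∈ → g-inj u v (p─q⊆p S C u∈) (p─q⊆p S C v∈)) ,
      λ w w∈ → let (v , v∈ , gv≡w) = g-sur w (p─q⊆p S C w∈) in
        v , x∈p∧x∉q⇒x∈p─q v∈ (λ v∈C → ∈─⇒∉ w∈ (subst (_∈ C) gv≡w (cycle-^∈ cyc 1 v∈C))) , gv≡w

    bij-add-cycle : Bij g (S ─ C) (S ─ C) → Bij g S S
    bij-add-cycle (g∈ , g-inj , g-sur) = closed , inj , sur
      where
      closed : ∀ v → v ∈ S → g v ∈ S
      closed v v∈ with v ∈? C
      ... | yes v∈C = C⊆S (cycle-^∈ cyc 1 v∈C)
      ... | no  v∉C = p─q⊆p S C (g∈ v (x∈p∧x∉q⇒x∈p─q v∈ v∉C))
      inj : ∀ u v → u ∈ S → v ∈ S → g u ≡ g v → u ≡ v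
      inj u v u∈ v∈ eq with u ∈? C | v ∈? C
      ... | yes u∈C | yes v∈C = proj₁ (proj₂ (cycle-bij cyc)) u v u∈C v∈C eq
      ... | yes u∈C | no  v∉C = contradiction (subst (_∈ C) eq (cycle-^∈ cyc 1 u∈C)) (∈─⇒∉ (g∈ v (x∈p∧x∉q⇒x∈p─q v∈ v∉C)))
      ... | no  u∉C | yes v∈C = contradiction (subst (_∈ C) (sym eq) (cycle-^∈ cyc 1 v∈C)) (∈─⇒∉ (g∈ u (x∈p∧x∉q⇒x∈p─q u∈ u∉C)))
      ... | no  u∉C | no  v∉C = g-inj u v (x∈p∧x∉q⇒x∈p─q u∈ u∉C) (x∈p∧x∉q⇒x∈p─q v∈ v∉C) eq
      sur : ∀ w → w ∈ S → ∃ λ v → v ∈ S × g v ≡ w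
      sur w w∈ with w ∈? C
      ... | yes w∈C = let (v , v∈C , eq) = proj₂ (proj₂ (cycle-bij cyc)) w w∈C in v , C⊆S v∈C , eq
      ... | no  w∉C = let (v , v∈ , eq) = g-sur w (x∈p∧x∉q⇒x∈p─q w∈ w∉C) in v , p─q⊆p S C v∈ , eq

    -- Cycles that meet coincide, so a cycle inside `S` lies in `S ─ C` or is `C` itself. The last
    -- summand is the Kronecker delta of `j` and `l`, written as a multiplicity so that it cancels
    -- against `mult-∷`.
    cycleCount-remove : ∀ j .{{_ : NonZero j}} → cycleCount g S j ≡ cycleCount g (S ─ C) j ℕ.+ count (j ℕₚ.≟_) (l ∷ [])
    cycleCount-remove j = trans
      (count-⊎ (λ D → (D ⊆? S) ×-dec isCycle? g j D) (λ D → (D ⊆? (S ─ C)) ×-dec isCycle? g j D)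
        (λ D → (D ≟ˢ C) ×-dec (j ℕₚ.≟ l)) split
        (λ D (D⊆ , D-cyc) → (λ x∈ → p─q⊆p S C (D⊆ x∈)) , D-cyc)
        (λ { D (refl , refl) → C⊆S , cyc })
        (λ { D (D⊆ , D-cyc) (refl , _) → let (v , v∈) = cycle-nonempty cyc in ∈─⇒∉ (D⊆ v∈) v∈ })
        (subsets n))
      (cong (cycleCount g (S ─ C) j ℕ.+_) (self (j ℕₚ.≟ l)))
      where
      split : ∀ D → D ⊆ S × IsCycle g j D → (D ⊆ S ─ C × IsCycle g j D) ⊎ (D ≡ C × j ≡ l)
      split D (D⊆S , D-cyc) with D ⊆? (S ─ C)
      ... | yes D⊆ = inj₁ (D⊆ , D-cyc)
      ... | no  D⊈ with D ≟ˢ C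
      ...   | yes refl = inj₂ (refl , trans (sym (proj₁ D-cyc)) (proj₁ cyc))
      ...   | no  D≢C  = contradiction (λ {x} x∈ → x∈p∧x∉q⇒x∈p─q (D⊆S x∈) (λ x∈C → D≢C (cycles-meet D-cyc cyc x∈ x∈C))) D⊈
      self : Dec (j ≡ l) → count (λ D → (D ≟ˢ C) ×-dec (j ℕₚ.≟ l)) (subsets n) ≡ count (j ℕₚ.≟_) (l ∷ [])
      self (yes refl) = trans
        (count-⇔ (λ D → (D ≟ˢ C) ×-dec (l ℕₚ.≟ l)) (_≟ˢ C) (λ _ → proj₁) (λ _ D≡C → D≡C , refl) (subsets n))
        (trans (count-subsets-≡ C) (sym (cong length (filter-accept (l ℕₚ.≟_) {l} {[]} refl))))
      self (no j≢l) = trans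
        (count-none (λ D → (D ≟ˢ C) ×-dec (j ℕₚ.≟ l)) (λ D (_ , j≡l) → j≢l j≡l) (subsets n))
        (sym (cong length (filter-reject (j ℕₚ.≟_) {l} {[]} j≢l)))

-- Permutations of a given cycle type

-- `multiplicity` for bare lists: the induction removes one part at a time, which would change the
-- index of `Partition`.
mult : List ℕ → ℕ → ℕ
mult ps l = count (l ℕₚ.≟_) ps

mult-∷ : ∀ l ps j → mult (l ∷ ps) j ≡ mult ps j ℕ.+ mult (l ∷ []) j
mult-∷ l ps j = trans (count-++ (j ℕₚ.≟_) (l ∷ []) ps) (ℕₚ.+-comm (mult (l ∷ []) j) (mult ps j))

mult-accept : ∀ l ps → mult (l ∷ ps) l ≡ suc (mult ps l)
mult-accept l ps = cong length (filter-accept (l ℕₚ.≟_) {l} {ps} refl)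

mult-reject : ∀ {l j} ps → j ≢ l → mult (l ∷ ps) j ≡ mult ps j
mult-reject {l} {j} ps j≢l = cong length (filter-reject (j ℕₚ.≟_) {l} {ps} j≢l)

zFactor : List ℕ → ℕ → ℕ
zFactor ps l = l ℕ.^ mult ps l ℕ.* mult ps l !

-- The centralizer order of a permutation with cycle lengths ps, all of which are at most B.
zOrder : ℕ → List ℕ → ℕ
zOrder B ps = productℕ {B} λ i → zFactor ps (suc (toℕ i))

productℕ-scale : ∀ {B} (f g : Fin B → ℕ) a i → f i ≡ a ℕ.* g i → (∀ j → j ≢ i → f j ≡ g j) → productℕ f ≡ a ℕ.* productℕ g
productℕ-scale {suc B} f g a zero eq others = trans
  (cong₂ ℕ._*_ eq (MonoidSum.sum-cong-≗ ℕₚ.*-1-commutativeMonoid (λ j → others (suc j) λ ())))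
  (ℕₚ.*-assoc a (g zero) _)
productℕ-scale {suc B} f g a (suc i) eq others = trans
  (cong₂ ℕ._*_ (others zero λ ()) (productℕ-scale (f ∘ suc) (g ∘ suc) a i eq (λ j j≢i → others (suc j) λ { refl → j≢i refl })))
  (solve 3 (λ x y z → x :* (y :* z) := y :* (x :* z)) refl (g zero) a (productℕ (g ∘ suc)))
  where open +-*-Solver

-- Only the factor at `l` changes: its exponent grows by one, giving `l`, and its factorial gains
-- the new multiplicity.
zOrder-∷ : ∀ {B l} ps → 1 ≤ l → l ≤ B → zOrder B (l ∷ ps) ≡ l ℕ.* mult (l ∷ ps) l ℕ.* zOrder B ps
zOrder-∷ {B} {suc l} ps _ l<B = productℕ-scale _ _ (suc l ℕ.* mult (suc l ∷ ps) (suc l)) (fromℕ< l<B)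
  (trans (cong (zFactor (suc l ∷ ps)) sl≡) (trans at-l
    (cong (λ t → suc l ℕ.* mult (suc l ∷ ps) (suc l) ℕ.* zFactor ps t) (sym sl≡))))
  (λ j j≢ → cong (λ t → suc (toℕ j) ℕ.^ t ℕ.* t !) (mult-reject ps (λ eq → j≢ (toℕ-injective (trans (ℕₚ.suc-injective eq) (sym (toℕ-fromℕ< l<B)))))))
  where
  open +-*-Solver
  sl≡ : suc (toℕ (fromℕ< l<B)) ≡ suc l
  sl≡ = cong suc (toℕ-fromℕ< l<B)
  at-l : zFactor (suc l ∷ ps) (suc l) ≡ suc l ℕ.* mult (suc l ∷ ps) (suc l) ℕ.* zFactor ps (suc l)
  at-l rewrite mult-accept (suc l) ps = solve 4 (λ x y z w → x :* y :* (w :* z) := x :* w :* (y :* z)) refl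
    (suc l) (suc l ℕ.^ mult ps (suc l)) (mult ps (suc l) !) (suc (mult ps (suc l)))

module _ {n : ℕ} where

  -- The bound `B` stays fixed while parts are removed. For `B` equal to `N` and the parts of a
  -- partition of `N` this unfolds to `HasCycleType`.
  Typed : ℕ → (Fin n → Fin n) → Subset n → List ℕ → Set
  Typed B g S ps = ∀ {j} → j < suc B → 1 ≤ j → cycleCount g S j ≡ mult ps j

  typed? : ∀ B g S ps → Dec (Typed B g S ps)
  typed? B g S ps = ℕₚ.allUpTo? (λ j → (1 ℕₚ.≤? j) →-dec (cycleCount g S j ℕₚ.≟ mult ps j)) (suc B)

  cycleCount-resp : ∀ {g g′ : Fin n → Fin n} {S} → (∀ v → v ∈ S → g v ≡ g′ v) → ∀ j → cycleCount g S j ≡ cycleCount g′ S j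
  cycleCount-resp {g} {g′} {S} g≡g′ j = count-⇔ (λ D → (D ⊆? S) ×-dec isCycle? g j D) (λ D → (D ⊆? S) ×-dec isCycle? g′ j D)
    (λ D (D⊆ , cyc) → D⊆ , isCycle-resp (λ v v∈ → g≡g′ v (D⊆ v∈)) cyc)
    (λ D (D⊆ , cyc) → D⊆ , isCycle-resp (λ v v∈ → sym (g≡g′ v (D⊆ v∈))) cyc)
    (subsets n)

  typed-resp : ∀ {B} {g g′ : Fin n → Fin n} {S ps} → (∀ v → v ∈ S → g v ≡ g′ v) → Typed B g S ps → Typed B g′ S ps
  typed-resp g≡g′ ty j< 1≤j = trans (sym (cycleCount-resp g≡g′ _)) (ty j< 1≤j)

  module _ {B : ℕ} {g : Fin n → Fin n} {l : ℕ} .{{_ : NonZero l}} {C S : Subset n} {ps : List ℕ} (cyc : IsCycle g l C) (C⊆S : C ⊆ S) where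

    typed-remove : Typed B g S (l ∷ ps) → Typed B g (S ─ C) ps
    typed-remove ty {j} j< 1≤j = ℕₚ.+-cancelʳ-≡ (mult (l ∷ []) j) _ _
      (trans (sym (cycleCount-remove cyc C⊆S j {{ℕ.>-nonZero 1≤j}})) (trans (ty j< 1≤j) (mult-∷ l ps j)))

    typed-add : Typed B g (S ─ C) ps → Typed B g S (l ∷ ps)
    typed-add ty {j} j< 1≤j = trans (cycleCount-remove cyc C⊆S j {{ℕ.>-nonZero 1≤j}})
      (trans (cong (ℕ._+ mult (l ∷ []) j) (ty j< 1≤j)) (sym (mult-∷ l ps j)))

  typed-[] : ∀ {B} {g : Fin n → Fin n} {S} → ∣ S ∣ ≡ 0 → Typed B g S []
  typed-[] {g = g} {S} ∣S∣ {j} _ 1≤j = count-none (λ D → (D ⊆? S) ×-dec isCycle? g j D)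
    (λ D (D⊆ , cyc) → contradiction 1≤j (ℕₚ.<⇒≱ (s≤s (ℕₚ.≤-trans (ℕₚ.≤-reflexive (sym (proj₁ cyc)))
      (ℕₚ.≤-trans (p⊆q⇒∣p∣≤∣q∣ D⊆) (ℕₚ.≤-reflexive ∣S∣)))))) (subsets n)

module CycleTypes {c ℓ} (R : CommutativeRing c ℓ) where

  open CommutativeRing R hiding (zero; _-_) renaming (refl to ≈-refl; sym to ≈-sym; trans to ≈-trans; reflexive to ≈-reflexive)
  open FiniteSums R
  open Sums R
  open Counting R
  open RingSolver commutativeSemiring using (solve; _:=_; _:*_)
  open SetoidReasoning setoid

  nat-count : ∀ {A : Set} {P : A → Set} (P? : ∀ a → Dec (P a)) xs → nat (count P? xs) ≈ ∑ xs (λ a → ⟦ P? a ⟧)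
  nat-count P? [] = ≈-refl
  nat-count P? (x ∷ xs) with P? x
  ... | yes _ = +-congˡ (nat-count P? xs)
  ... | no _  = ≈-trans (nat-count P? xs) (≈-sym (+-identityˡ _))

  module _ {n} (p : Fin n → Carrier) (mass : sum p ≈ 1#) where

    private
      D : Distribution (Fin n)
      D = finᴰ p mass

    Pr-≡ : ∀ b → 𝔼 D (λ u → ⟦ u ≟ᶠ b ⟧) ≈ p b
    Pr-≡ b = ≈-trans (∑-allFin (λ u → p u * ⟦ u ≟ᶠ b ⟧)) (point p b)
      where
      point : ∀ {m} (q : Fin m → Carrier) b → sum (λ u → q u * ⟦ u ≟ᶠ b ⟧) ≈ q b
      point {suc m} q zero = ≈-trans (+-cong (*-identityʳ _) (tail-0 (λ u → q (suc u)))) (+-identityʳ _)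
        where
        tail-0 : ∀ {k} (r : Fin k → Carrier) → sum (λ u → r u * 0#) ≈ 0#
        tail-0 {zero}  r = ≈-refl
        tail-0 {suc k} r = ≈-trans (+-cong (zeroʳ _) (tail-0 (r ∘ suc))) (+-identityˡ _)
      point {suc m} q (suc b) = ≈-trans (+-cong (zeroʳ _)
        (≈-trans (SemiringSum.sum-cong-≋ semiring (λ u → *-congˡ (⟦⟧-⇔ (suc u ≟ᶠ suc b) (u ≟ᶠ b) (λ { refl → refl }) (cong suc)))) (point (q ∘ suc) b)))
        (+-identityˡ _)

    -- The chain reads `g` at `a` and then at the points of `U` in the order of their visits, never
    -- twice at the same point, so each value can be resampled. The visits contribute the `m !`
    -- orders and the monomial of `U`, the final arrival contributes `p b`.
    Pr-chain : ∀ m a (U : Subset n) b → a ∉ U → ∣ U ∣ ≡ m →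
               𝔼 (iid n D) (λ g → ⟦ chain? m g a U b ⟧) ≈ nat (m !) * monomial p U * p b
    Pr-chain zero a U b a∉ ∣U∣ = begin
      𝔼 (iid n D) (λ g → ⟦ g a ≟ᶠ b ⟧)
        ≈⟨ resample (λ _ → D) a (λ u g → ⟦ u ≟ᶠ b ⟧) (λ _ _ _ _ → ≈-refl) ⟩
      𝔼 (iid n D) (λ g → 𝔼 D (λ u → ⟦ u ≟ᶠ b ⟧))
        ≈⟨ ≈-trans (𝔼-const (iid n D) _) (Pr-≡ b) ⟩
      p b
        ≈⟨ ≈-trans (*-congʳ (≈-trans (*-cong nat-1 (monomial-empty p (∣∣≡0⇒∉ ∣U∣))) (*-identityˡ _))) (*-identityˡ _) ⟨
      nat 1 * monomial p U * p b ∎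
    Pr-chain (suc m) a U b a∉ ∣U∣ = begin
      𝔼 (iid n D) (λ g → ⟦ chain? (suc m) g a U b ⟧)
        ≈⟨ resample (λ _ → D) a (λ u g → ⟦ (u ∈? U) ×-dec chain? m g u (U ∖ u) b ⟧)
             (λ u g g′ g∼ → ⟦⟧-⇔ ((u ∈? U) ×-dec chain? m g u (U ∖ u) b) ((u ∈? U) ×-dec chain? m g′ u (U ∖ u) b)
               (λ (u∈ , ch) → u∈ , chain-resp m (g∼ u (∈-≢ u∈)) (λ v v∈ → g∼ v (∈-≢ (proj₁ (∈-remove⁻ v∈)))) ch)
               (λ (u∈ , ch) → u∈ , chain-resp m (sym (g∼ u (∈-≢ u∈))) (λ v v∈ → sym (g∼ v (∈-≢ (proj₁ (∈-remove⁻ v∈))))) ch)) ⟩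
      𝔼 (iid n D) (λ g → 𝔼 D (λ u → ⟦ (u ∈? U) ×-dec chain? m g u (U ∖ u) b ⟧))
        ≈⟨ 𝔼-swap (iid n D) D (λ g u → ⟦ (u ∈? U) ×-dec chain? m g u (U ∖ u) b ⟧) ⟩
      𝔼 D (λ u → 𝔼 (iid n D) (λ g → ⟦ (u ∈? U) ×-dec chain? m g u (U ∖ u) b ⟧))
        ≈⟨ 𝔼-cong D (λ u → ≈-trans (𝔼-cong (iid n D) (λ g → ⟦⟧-× (u ∈? U) (chain? m g u (U ∖ u) b))) (𝔼-*ˡ (iid n D) ⟦ u ∈? U ⟧ (λ g → ⟦ chain? m g u (U ∖ u) b ⟧))) ⟩
      𝔼 D (λ u → ⟦ u ∈? U ⟧ * 𝔼 (iid n D) (λ g → ⟦ chain? m g u (U ∖ u) b ⟧))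
        ≈⟨ ∑-cong (allFin n) (λ u → ≈-trans
             (solve 3 (λ x y z → x :* (y :* z) := y :* (x :* z)) ≈-refl (p u) ⟦ u ∈? U ⟧ _)
             (⟦⟧*-cong (u ∈? U) (move u))) ⟩
      ∑ (allFin n) (λ u → ⟦ u ∈? U ⟧ * (nat (m !) * monomial p U * p b))
        ≈⟨ ≈-trans (∑-*ʳ (allFin n) _ (λ u → ⟦ u ∈? U ⟧)) (*-congʳ (≈-trans (∑-allFin (λ u → ⟦ u ∈? U ⟧)) (sum-∈ U))) ⟩
      nat ∣ U ∣ * (nat (m !) * monomial p U * p b)
        ≈⟨ solve 4 (λ x y z w → x :* (y :* z :* w) := (x :* y) :* z :* w) ≈-refl (nat ∣ U ∣) _ _ _ ⟩
      (nat ∣ U ∣ * nat (m !)) * monomial p U * p b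
        ≈⟨ *-congʳ (*-congʳ (≈-trans (*-congʳ (≈-reflexive (cong nat ∣U∣))) (≈-sym (nat-* (suc m) (m !))))) ⟩
      nat (suc m !) * monomial p U * p b ∎
      where
      ∈-≢ : ∀ {u} → u ∈ U → u ≢ a
      ∈-≢ u∈ refl = a∉ u∈
      move : ∀ u → u ∈ U → p u * 𝔼 (iid n D) (λ g → ⟦ chain? m g u (U ∖ u) b ⟧) ≈ nat (m !) * monomial p U * p b
      move u u∈ = begin
        p u * 𝔼 (iid n D) (λ g → ⟦ chain? m g u (U ∖ u) b ⟧)
          ≈⟨ *-congˡ (Pr-chain m u (U ∖ u) b (λ u∈′ → proj₂ (∈-remove⁻ {p = U} u∈′) refl) (ℕₚ.suc-injective (trans (suc∣remove∣ u∈) ∣U∣))) ⟩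
        p u * (nat (m !) * monomial p (U ∖ u) * p b)
          ≈⟨ solve 4 (λ x y z w → x :* (y :* z :* w) := y :* (x :* z) :* w) ≈-refl (p u) _ _ _ ⟩
        nat (m !) * (p u * monomial p (U ∖ u)) * p b
          ≈⟨ *-congʳ (*-congˡ (monomial-remove p u∈)) ⟩
        nat (m !) * monomial p U * p b ∎

    -- A base point `a` of `C` turns the cycle into a chain from `a` through `C ∖ a` back to `a`,
    -- which accounts for the `m !` cyclic orders.
    Pr-cycle : ∀ m (C : Subset n) → 𝔼 (iid n D) (λ g → ⟦ isCycle? g (suc m) C ⟧) ≈ ⟦ ∣ C ∣ ℕₚ.≟ suc m ⟧ * (nat (m !) * monomial p C)
    Pr-cycle m C with ∣ C ∣ ℕₚ.≟ suc m | nonempty? C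
    ... | no ∣C∣≢ | _ = begin
      𝔼 (iid n D) (λ g → ⟦ isCycle? g (suc m) C ⟧)   ≈⟨ 𝔼-cong (iid n D) (λ g → ⟦⟧-no (isCycle? g (suc m) C) (∣C∣≢ ∘ proj₁)) ⟩
      𝔼 (iid n D) (λ g → 0#)                         ≈⟨ 𝔼-const (iid n D) 0# ⟩
      0#                                             ≈⟨ ≈-trans (*-congʳ (⟦⟧-no (∣ C ∣ ℕₚ.≟ suc m) ∣C∣≢)) (zeroˡ _) ⟨
      ⟦ ∣ C ∣ ℕₚ.≟ suc m ⟧ * (nat (m !) * monomial p C) ∎
    ... | yes ∣C∣≡ | no empty = contradiction (trans (sym ∣C∣≡) (trans (cong ∣_∣ (Empty-unique {p = C} empty)) (∣⊥∣≡0 n))) λ ()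
    ... | yes ∣C∣≡ | yes (a , a∈) = begin
      𝔼 (iid n D) (λ g → ⟦ isCycle? g (suc m) C ⟧)
        ≈⟨ 𝔼-cong (iid n D) (λ g → ⟦⟧-⇔ (isCycle? g (suc m) C) (chain? m g a (C ∖ a) a) (isCycle⇒chain a∈) (chain⇒isCycle a∈ ∣C∣≡)) ⟩
      𝔼 (iid n D) (λ g → ⟦ chain? m g a (C ∖ a) a ⟧)
        ≈⟨ Pr-chain m a (C ∖ a) a (λ a∈′ → proj₂ (∈-remove⁻ {p = C} a∈′) refl) (ℕₚ.suc-injective (trans (suc∣remove∣ a∈) ∣C∣≡)) ⟩
      nat (m !) * monomial p (C ∖ a) * p a
        ≈⟨ solve 3 (λ x y z → x :* y :* z := x :* (z :* y)) ≈-refl (nat (m !)) _ (p a) ⟩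
      nat (m !) * (p a * monomial p (C ∖ a))
        ≈⟨ *-congˡ (monomial-remove p a∈) ⟩
      nat (m !) * monomial p C
        ≈⟨ ≈-trans (*-congʳ (⟦⟧-yes (∣ C ∣ ℕₚ.≟ suc m) ∣C∣≡)) (*-identityˡ _) ⟨
      ⟦ ∣ C ∣ ℕₚ.≟ suc m ⟧ * (nat (m !) * monomial p C) ∎

    permutesTyped? : ∀ B S ps (g : Fin n → Fin n) → Dec (Bij g S S × Typed B g S ps)
    permutesTyped? B S ps g = bij? g S S ×-dec typed? B g S ps

    permutesTyped-resp : ∀ {B S ps} {g g′ : Fin n → Fin n} → (∀ v → v ∈ S → g v ≡ g′ v) →
                         Bij g S S × Typed B g S ps → Bij g′ S S × Typed B g′ S ps
    permutesTyped-resp {B} {S} {ps} g≡g′ (bij , ty) = bij-resp g≡g′ bij , typed-resp {B = B} {S = S} {ps} g≡g′ ty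

    -- Double counting of pairs (permutation of type l ∷ ps, one of its l-cycles).
    Pr-type : ∀ {B} S ps → All (1 ≤_) ps → sumℕ ps ≡ ∣ S ∣ → ∣ S ∣ ≤ B →
              nat (zOrder B ps) * 𝔼 (iid n D) (λ g → ⟦ permutesTyped? B S ps g ⟧) ≈ nat (∣ S ∣ !) * monomial p S
    Pr-type {B} S [] _ ∣S∣ _ = begin
      nat (zOrder B []) * 𝔼 (iid n D) (λ g → ⟦ permutesTyped? B S [] g ⟧)
        ≈⟨ *-cong (≈-trans (≈-reflexive (cong nat zOrder-[])) nat-1) (𝔼-cong (iid n D) (λ g → ⟦⟧-yes (permutesTyped? B S [] g)
             (((λ v v∈ → contradiction v∈ (S-empty v)) , (λ u v u∈ → contradiction u∈ (S-empty u)) , (λ w w∈ → contradiction w∈ (S-empty w))) ,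
              typed-[] {B = B} {g} {S} (sym ∣S∣)))) ⟩
      1# * 𝔼 (iid n D) (λ g → 1#)
        ≈⟨ *-congˡ (𝔼-const (iid n D) 1#) ⟩
      1# * 1#
        ≈⟨ *-cong (≈-trans (≈-reflexive (cong (λ t → nat (t !)) (sym ∣S∣))) nat-1) (monomial-empty p S-empty) ⟨
      nat (∣ S ∣ !) * monomial p S ∎
      where
      S-empty : ∀ v → v ∉ S
      S-empty = ∣∣≡0⇒∉ (sym ∣S∣)
      zOrder-[] : zOrder B [] ≡ 1
      zOrder-[] = go {B} (λ i → zFactor [] (suc (toℕ i))) (λ _ → refl)
        where
        go : ∀ {B} (f : Fin B → ℕ) → (∀ i → f i ≡ 1) → productℕ f ≡ 1
        go {zero}  f f≡1 = refl
        go {suc B} f f≡1 rewrite f≡1 zero | go (f ∘ suc) (f≡1 ∘ suc) = refl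
    Pr-type {B} S (l@(suc m) ∷ ps) (1≤l ∷ pos) ∣S∣ ∣S∣≤B = begin
      nat (zOrder B (l ∷ ps)) * E
        ≈⟨ *-congʳ (≈-trans (≈-reflexive (cong nat (zOrder-∷ ps 1≤l l≤B)))
             (≈-trans (nat-* (l ℕ.* mult (l ∷ ps) l) (zOrder B ps)) (*-congʳ (nat-* l (mult (l ∷ ps) l))))) ⟩
      (nat l * nat (mult (l ∷ ps) l)) * z * E
        ≈⟨ solve 4 (λ x y z w → (x :* y) :* z :* w := (x :* z) :* (w :* y)) ≈-refl (nat l) _ _ _ ⟩
      (nat l * z) * (E * nat (mult (l ∷ ps) l))
        ≈⟨ *-congˡ mark ⟩
      (nat l * z) * ∑ (subsets n) (λ C → ⟦ C ⊆? S ⟧ * (⟦ ∣ C ∣ ℕₚ.≟ l ⟧ * (nat (m !) * monomial p C) * E′ C))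
        ≈⟨ ∑-*ˡ (subsets n) _ _ ⟨
      ∑ (subsets n) (λ C → (nat l * z) * (⟦ C ⊆? S ⟧ * (⟦ ∣ C ∣ ℕₚ.≟ l ⟧ * (nat (m !) * monomial p C) * E′ C)))
        -- By induction on the remaining parts every `l`-subset `C` of `S` contributes the same
        -- amount: `l` and `m !` make `l !`, and the monomials of `C` and `S ─ C` make that of `S`.
        ≈⟨ ∑-cong (subsets n) term ⟩
      ∑ (subsets n) (λ C → (⟦ C ⊆? S ⟧ * ⟦ ∣ C ∣ ℕₚ.≟ l ⟧) * (nat (l ! ℕ.* (∣ S ∣ ℕ.∸ l) !) * monomial p S))
        ≈⟨ ≈-trans (∑-*ʳ (subsets n) _ (λ C → ⟦ C ⊆? S ⟧ * ⟦ ∣ C ∣ ℕₚ.≟ l ⟧)) (*-congʳ (∑-⊆ S l)) ⟩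
      nat (∣ S ∣ choose l) * (nat (l ! ℕ.* (∣ S ∣ ℕ.∸ l) !) * monomial p S)
        ≈⟨ ≈-trans (≈-sym (*-assoc _ _ _)) (*-congʳ (≈-trans (≈-sym (nat-* (∣ S ∣ choose l) _)) (≈-reflexive (cong nat (C-factorial l≤∣S∣))))) ⟩
      nat (∣ S ∣ !) * monomial p S ∎
      where
      T? = permutesTyped? B S (l ∷ ps)
      T′? = λ C → permutesTyped? B (S ─ C) ps

      z : Carrier
      z = nat (zOrder B ps)
      E : Carrier
      E = 𝔼 (iid n D) (λ g → ⟦ T? g ⟧)
      E′ : Subset n → Carrier
      E′ C = 𝔼 (iid n D) (λ g → ⟦ T′? C g ⟧)

      l≤∣S∣ : l ≤ ∣ S ∣
      l≤∣S∣ = ℕₚ.≤-trans (ℕₚ.m≤m+n l (sumℕ ps)) (ℕₚ.≤-reflexive ∣S∣)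
      l≤B : l ≤ B
      l≤B = ℕₚ.≤-trans l≤∣S∣ ∣S∣≤B

      marked : ∀ g C → ⟦ T? g ⟧ * ⟦ (C ⊆? S) ×-dec isCycle? g l C ⟧ ≈ ⟦ C ⊆? S ⟧ * (⟦ isCycle? g l C ⟧ * ⟦ T′? C g ⟧)
      marked g C = begin
        ⟦ T? g ⟧ * ⟦ (C ⊆? S) ×-dec isCycle? g l C ⟧
          ≈⟨ ⟦⟧-× (T? g) ((C ⊆? S) ×-dec isCycle? g l C) ⟨
        ⟦ T? g ×-dec ((C ⊆? S) ×-dec isCycle? g l C) ⟧
          ≈⟨ ⟦⟧-⇔ (T? g ×-dec ((C ⊆? S) ×-dec isCycle? g l C)) ((C ⊆? S) ×-dec (isCycle? g l C ×-dec T′? C g))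
               (λ ((bij , ty) , C⊆S , cyc) → C⊆S , cyc , bij-remove-cycle cyc C⊆S bij , typed-remove {B = B} {ps = ps} cyc C⊆S ty)
               (λ (C⊆S , cyc , bij , ty) → (bij-add-cycle cyc C⊆S bij , typed-add {B = B} {ps = ps} cyc C⊆S ty) , C⊆S , cyc) ⟩
        ⟦ (C ⊆? S) ×-dec (isCycle? g l C ×-dec T′? C g) ⟧
          ≈⟨ ≈-trans (⟦⟧-× (C ⊆? S) (isCycle? g l C ×-dec T′? C g)) (*-congˡ (⟦⟧-× (isCycle? g l C) (T′? C g))) ⟩
        ⟦ C ⊆? S ⟧ * (⟦ isCycle? g l C ⟧ * ⟦ T′? C g ⟧) ∎

      -- The cycle event reads `g` on `C`, the type of the rest reads it on `S ─ C`.
      independent : ∀ C → 𝔼 (iid n D) (λ g → ⟦ isCycle? g l C ⟧ * ⟦ T′? C g ⟧)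
                          ≈ 𝔼 (iid n D) (λ g → ⟦ isCycle? g l C ⟧) * E′ C
      independent C = independent-iid D C {λ g → ⟦ isCycle? g l C ⟧} {λ g → ⟦ T′? C g ⟧}
        (λ g g′ g∼ → ⟦⟧-⇔ (isCycle? g l C) (isCycle? g′ l C) (isCycle-resp g∼) (isCycle-resp (λ v v∈ → sym (g∼ v v∈))))
        (λ g g′ g∼ → ⟦⟧-⇔ (T′? C g) (T′? C g′)
          (permutesTyped-resp {B} {S ─ C} {ps} (λ v v∈ → g∼ v (∈─⇒∉ v∈)))
          (permutesTyped-resp {B} {S ─ C} {ps} (λ v v∈ → sym (g∼ v (∈─⇒∉ v∈)))))

      mark : E * nat (mult (l ∷ ps) l)
             ≈ ∑ (subsets n) (λ C → ⟦ C ⊆? S ⟧ * (⟦ ∣ C ∣ ℕₚ.≟ l ⟧ * (nat (m !) * monomial p C) * E′ C))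
      mark = begin
        E * nat (mult (l ∷ ps) l)
          ≈⟨ 𝔼-*ʳ (iid n D) _ (λ g → ⟦ T? g ⟧) ⟨
        𝔼 (iid n D) (λ g → ⟦ T? g ⟧ * nat (mult (l ∷ ps) l))
          ≈⟨ 𝔼-cong (iid n D) (λ g → ≈-trans
               (⟦⟧*-cong (T? g) (λ (_ , ty) → ≈-trans (≈-reflexive (cong nat (sym (ty (s≤s l≤B) 1≤l)))) (nat-count (λ C → (C ⊆? S) ×-dec isCycle? g l C) (subsets n))))
               (≈-trans (≈-sym (∑-*ˡ (subsets n) _ _)) (∑-cong (subsets n) (marked g)))) ⟩
        𝔼 (iid n D) (λ g → ∑ (subsets n) (λ C → ⟦ C ⊆? S ⟧ * (⟦ isCycle? g l C ⟧ * ⟦ T′? C g ⟧)))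
          ≈⟨ 𝔼-∑ (iid n D) (subsets n) (λ C g → ⟦ C ⊆? S ⟧ * (⟦ isCycle? g l C ⟧ * ⟦ T′? C g ⟧)) ⟩
        ∑ (subsets n) (λ C → 𝔼 (iid n D) (λ g → ⟦ C ⊆? S ⟧ * (⟦ isCycle? g l C ⟧ * ⟦ T′? C g ⟧)))
          ≈⟨ ∑-cong (subsets n) (λ C → ≈-trans (𝔼-*ˡ (iid n D) ⟦ C ⊆? S ⟧ (λ g → ⟦ isCycle? g l C ⟧ * ⟦ T′? C g ⟧))
               (*-congˡ (≈-trans (independent C) (*-congʳ (Pr-cycle m C))))) ⟩
        ∑ (subsets n) (λ C → ⟦ C ⊆? S ⟧ * (⟦ ∣ C ∣ ℕₚ.≟ l ⟧ * (nat (m !) * monomial p C) * E′ C)) ∎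

      term : ∀ C → (nat l * z) * (⟦ C ⊆? S ⟧ * (⟦ ∣ C ∣ ℕₚ.≟ l ⟧ * (nat (m !) * monomial p C) * E′ C))
                   ≈ (⟦ C ⊆? S ⟧ * ⟦ ∣ C ∣ ℕₚ.≟ l ⟧) * (nat (l ! ℕ.* (∣ S ∣ ℕ.∸ l) !) * monomial p S)
      term C = begin
        (nat l * z) * (⟦ C ⊆? S ⟧ * (⟦ ∣ C ∣ ℕₚ.≟ l ⟧ * (nat (m !) * monomial p C) * E′ C))
          ≈⟨ solve 7 (λ x z u v f w e → (x :* z) :* (u :* (v :* (f :* w) :* e)) := u :* (v :* ((x :* f) :* (w :* (z :* e))))) ≈-refl
               (nat l) (z) ⟦ C ⊆? S ⟧ ⟦ ∣ C ∣ ℕₚ.≟ l ⟧ (nat (m !)) (monomial p C) (E′ C) ⟩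
        ⟦ C ⊆? S ⟧ * (⟦ ∣ C ∣ ℕₚ.≟ l ⟧ * ((nat l * nat (m !)) * (monomial p C * (z * E′ C))))
          ≈⟨ ⟦⟧*-cong (C ⊆? S) (λ C⊆S → ⟦⟧*-cong (∣ C ∣ ℕₚ.≟ l) (λ ∣C∣≡l → value C⊆S ∣C∣≡l)) ⟩
        ⟦ C ⊆? S ⟧ * (⟦ ∣ C ∣ ℕₚ.≟ l ⟧ * (nat (l ! ℕ.* (∣ S ∣ ℕ.∸ l) !) * monomial p S))
          ≈⟨ *-assoc _ _ _ ⟨
        (⟦ C ⊆? S ⟧ * ⟦ ∣ C ∣ ℕₚ.≟ l ⟧) * (nat (l ! ℕ.* (∣ S ∣ ℕ.∸ l) !) * monomial p S) ∎
        where
        value : C ⊆ S → ∣ C ∣ ≡ l → (nat l * nat (m !)) * (monomial p C * (z * E′ C)) ≈ nat (l ! ℕ.* (∣ S ∣ ℕ.∸ l) !) * monomial p S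
        value C⊆S ∣C∣≡l = begin
          (nat l * nat (m !)) * (monomial p C * (z * E′ C))
            ≈⟨ *-cong (≈-sym (nat-* l (m !))) (*-congˡ (Pr-type (S ─ C) ps pos rest≡ (ℕₚ.≤-trans (∣p─q∣≤∣p∣ S C) ∣S∣≤B))) ⟩
          nat (l !) * (monomial p C * (nat (∣ S ─ C ∣ !) * monomial p (S ─ C)))
            ≈⟨ solve 4 (λ x y z w → x :* (y :* (z :* w)) := (x :* z) :* (y :* w)) ≈-refl (nat (l !)) _ _ _ ⟩
          (nat (l !) * nat (∣ S ─ C ∣ !)) * (monomial p C * monomial p (S ─ C))
            ≈⟨ *-cong (≈-trans (≈-sym (nat-* (l !) (∣ S ─ C ∣ !))) (≈-reflexive (cong (λ t → nat (l ! ℕ.* t !)) ∣S─C∣≡))) (monomial-─ p {S} C⊆S) ⟩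
          nat (l ! ℕ.* (∣ S ∣ ℕ.∸ l) !) * monomial p S ∎
          where
          l+ : l ℕ.+ ∣ S ─ C ∣ ≡ ∣ S ∣
          l+ = trans (cong (ℕ._+ ∣ S ─ C ∣) (sym ∣C∣≡l)) (∣─∣ C⊆S)
          rest≡ : sumℕ ps ≡ ∣ S ─ C ∣
          rest≡ = ℕₚ.+-cancelˡ-≡ l _ _ (trans ∣S∣ (sym l+))
          ∣S─C∣≡ : ∣ S ─ C ∣ ≡ ∣ S ∣ ℕ.∸ l
          ∣S─C∣≡ = trans (sym (ℕₚ.m+n∸m≡n l ∣ S ─ C ∣)) (cong (ℕ._∸ l) l+)

-- Recurrence in finite dynamical systems

module _ {m : ℕ} {P : Fin m → Set} (P? : Decidable P) where

  subsetOf : Subset m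
  subsetOf = Vec.tabulate (does ∘ P?)

  ∈-subsetOf⁺ : ∀ {v} → P v → v ∈ subsetOf
  ∈-subsetOf⁺ {v} p = lookup⇒[]= v subsetOf (trans (lookup∘tabulate (does ∘ P?) v) (dec-true (P? v) p))

  ∈-subsetOf⁻ : ∀ {v} → v ∈ subsetOf → P v
  ∈-subsetOf⁻ {v} v∈ with P? v | trans (sym (lookup∘tabulate (does ∘ P?) v)) ([]=⇒lookup v∈)
  ... | yes p | _ = p
  ... | no _  | ()

n≤n! : ∀ m → m ≤ m !
n≤n! zero    = z≤n
n≤n! (suc m) = ℕₚ.m≤m*n (suc m) (m !) {{m ℕₚ.!≢0}}

module _ {V : Set} {L : ℕ} (code : V → Fin L) (code-inj : ∀ {u v} → code u ≡ code v → u ≡ v) where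

  open Endo V using (_^_)

  -- Two of the iterates 0 to `L` of `v` coincide, which gives a preperiod and a period of at most
  -- `L`. So `suc L !` is at least the preperiod and a multiple of the period, for every `v` at
  -- once.
  ^-factorial-idem : ∀ (s : V → V) v → (s ^ (suc L ! ℕ.+ suc L !)) v ≡ (s ^ (suc L !)) v
  ^-factorial-idem s v with i , j , i<j , eq ← pigeonhole (ℕₚ.n<1+n L) (λ i → code ((s ^ toℕ i) v)) = trans
    (cong (λ t → (s ^ t) v) split₂) (trans (^-+ s (ω ℕ.∸ a) (ω ℕ.+ a) v) (trans
      (cong (s ^ (ω ℕ.∸ a)) (trans (^-+ s ω a v) periodic))
      (trans (sym (^-+ s (ω ℕ.∸ a) a v)) (cong (λ t → (s ^ t) v) (ℕₚ.m∸n+n≡m a≤ω)))))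
    where
    ω = suc L !
    a = toℕ i
    d = toℕ j ℕ.∸ a
    a≤ω : a ≤ ω
    a≤ω = ℕₚ.≤-trans (ℕₚ.<⇒≤ (toℕ<n i)) (n≤n! (suc L))
    d≢0 : NonZero d
    d≢0 = ℕ.>-nonZero (ℕₚ.m<n⇒0<n∸m i<j)
    d∣d! : ∀ d → .{{NonZero d}} → d ∣ d !
    d∣d! (suc d) = m∣m*n (d !)
    d∣ω : d ∣ ω
    d∣ω = ∣-trans (d∣d! d {{d≢0}}) (m≤n⇒m!∣n! (ℕₚ.≤-trans (ℕₚ.m∸n≤m (toℕ j) a) (ℕₚ.<⇒≤ (toℕ<n j))))
    -- Run `a` steps into the cycle, turn there `ω` steps to no effect, then run the remaining
    -- `ω - a`.
    split₂ : ω ℕ.+ ω ≡ (ω ℕ.∸ a) ℕ.+ (ω ℕ.+ a)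
    split₂ = sym (trans (cong ((ω ℕ.∸ a) ℕ.+_) (ℕₚ.+-comm ω a)) (trans (sym (ℕₚ.+-assoc (ω ℕ.∸ a) a ω)) (cong (ℕ._+ ω) (ℕₚ.m∸n+n≡m a≤ω))))
    step-d : (s ^ d) ((s ^ a) v) ≡ (s ^ a) v
    step-d = trans (sym (^-+ s d a v)) (trans (cong (λ t → (s ^ t) v) (ℕₚ.m∸n+n≡m (ℕₚ.<⇒≤ i<j))) (sym (code-inj eq)))
    periodic : (s ^ ω) ((s ^ a) v) ≡ (s ^ a) v
    periodic with divides q eq ← d∣ω = trans (cong (λ t → (s ^ t) ((s ^ a) v)) eq) (^-period s d _ step-d q)

-- For an idempotent power s ^ ω, the fixed points of s ^ ω are the recurrent
-- points of s.  Avoiding consists of those whose cycle does not meet S.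
module Recurrence {V : Set} (_≟ⱽ_ : ∀ (u v : V) → Dec (u ≡ v)) (s : V → V) (ω : ℕ) .{{_ : NonZero ω}}
                  (idem : ∀ v → Endo._^_ V s (ω ℕ.+ ω) v ≡ Endo._^_ V s ω v)
                  {S : V → Set} (S? : Decidable S) where

  open Endo V using (_^_)

  -- The first condition makes `ω` a multiple of the period of `v`, so `ω` iterates run through the
  -- whole cycle, and the bound makes the predicate decidable.
  Avoiding : V → Set
  Avoiding v = (s ^ ω) v ≡ v × (∀ {m} → m < ω → ¬ S ((s ^ m) v))

  avoiding? : Decidable Avoiding
  avoiding? v = ((s ^ ω) v ≟ⱽ v) ×-dec ℕₚ.allUpTo? (λ m → ¬? (S? ((s ^ m) v))) ω

  0<ω : 0 < ω
  0<ω = ℕ.>-nonZero⁻¹ ω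

  avoiding-∉ : ∀ {v} → Avoiding v → ¬ S v
  avoiding-∉ (_ , av) = av 0<ω

  avoiding-step : ∀ {v} → Avoiding v → Avoiding (s v)
  avoiding-step {v} (per , av) = trans (^-suc s ω v) (cong s per) , λ {m} m<ω → avoid m m<ω
    where
    avoid : ∀ m → m < ω → ¬ S ((s ^ m) (s v))
    avoid m m<ω Sm with suc m ℕₚ.<? ω
    ... | yes sm<ω = av sm<ω (subst S (^-suc s m v) Sm)
    -- The one wrap-around: `suc m` equals `ω` and the orbit is back at `v`.
    ... | no  sm≮ω = av 0<ω (subst S (trans (^-suc s m v) (trans (cong (λ t → (s ^ t) v) (ℕₚ.≤-antisym m<ω (ℕₚ.≮⇒≥ sm≮ω))) per)) Sm)

  avoiding-^ : ∀ m {v} → Avoiding v → Avoiding ((s ^ m) v)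
  avoiding-^ zero    av = av
  avoiding-^ (suc m) av = avoiding-step (avoiding-^ m av)

  -- On recurrent points `s ^ (ω - 1)` inverts `s`, whence injectivity there.
  back : ∀ {v} → (s ^ ω) v ≡ v → (s ^ ℕ.pred ω) (s v) ≡ v
  back {v} per = trans (^-suc s (ℕ.pred ω) v) (trans (cong (λ t → (s ^ t) v) (ℕₚ.suc-pred ω)) per)

  avoiding-inj : ∀ {u v} → Avoiding u → Avoiding v → s u ≡ s v → u ≡ v
  avoiding-inj (pu , _) (pv , _) eq = trans (sym (back pu)) (trans (cong (s ^ ℕ.pred ω) eq) (back pv))

  avoiding-sur : ∀ {w} → Avoiding w → ∃ λ v → Avoiding v × s v ≡ w
  avoiding-sur {w} av = (s ^ ℕ.pred ω) w , avoiding-^ (ℕ.pred ω) av , trans (cong (λ t → (s ^ t) w) (ℕₚ.suc-pred ω)) (proj₁ av)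

  -- After `ω` steps the orbit is recurrent by idempotence, and the next `ω` iterates either meet
  -- `S` or show that the cycle avoids it. This is the origin of the bound `ω + ω` in `Acyc`.
  reaches : ∀ v → ∃ λ m → m < ω ℕ.+ ω × (S ((s ^ m) v) ⊎ Avoiding ((s ^ m) v))
  reaches v with ℕₚ.anyUpTo? (λ m → S? ((s ^ m) ((s ^ ω) v))) ω
  ... | yes (m , m<ω , Sm) = m ℕ.+ ω , ℕₚ.+-monoˡ-< ω m<ω , inj₁ (subst S (sym (^-+ s m ω v)) Sm)
  ... | no ¬hit = ω , ℕₚ.m<m+n ω 0<ω , inj₂ (trans (sym (^-+ s ω ω v)) (idem v) , λ m<ω Sm → ¬hit (_ , m<ω , Sm))

  module _ {T : V → Set} (T-step : ∀ {v} → T v → T (s v))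
           (T-inj : ∀ {u v} → T u → T v → s u ≡ s v → u ≡ v) (T∩S : ∀ {v} → T v → ¬ S v) where

    T-^ : ∀ m {v} → T v → T ((s ^ m) v)
    T-^ zero    t = t
    T-^ (suc m) t = T-step (T-^ m t)

    T-^-inj : ∀ m {u v} → T u → T v → (s ^ m) u ≡ (s ^ m) v → u ≡ v
    T-^-inj zero    tu tv eq = eq
    T-^-inj (suc m) tu tv eq = T-^-inj m tu tv (T-inj (T-^ m tu) (T-^ m tv) eq)

    -- Injectivity of `s ^ ω` on `T` cancels one `ω` from the idempotence equation, so points of `T`
    -- are recurrent; their orbits stay in `T`, off `S`.
    permuted⇒avoiding : ∀ {v} → T v → Avoiding v
    permuted⇒avoiding {v} t = T-^-inj ω (T-^ ω t) t (trans (sym (^-+ s ω ω v)) (idem v)) , λ {m} _ → T∩S (T-^ m t)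

    -- The orbit of an avoiding point never meets `S`, so it enters `T`. It then stays in `T`, and
    -- being a cycle it brings `v` itself into `T`.
    avoiding⇒permuted : (∀ v → ∃ λ m → S ((s ^ m) v) ⊎ T ((s ^ m) v)) → ∀ {v} → Avoiding v → T v
    avoiding⇒permuted reach {v} av with reach v
    ... | m , inj₁ Sm = contradiction Sm (avoiding-∉ (avoiding-^ m av))
    ... | m , inj₂ Tm = subst T around (T-^ (m ℕ.* ℕ.pred ω) Tm)
      where
      -- From the m-th iterate, `m * (ω - 1)` further steps make `m * ω` in all, a multiple of the
      -- period.
      around : (s ^ (m ℕ.* ℕ.pred ω)) ((s ^ m) v) ≡ v
      around = trans (sym (^-+ s (m ℕ.* ℕ.pred ω) m v)) (trans (cong (λ t → (s ^ t) v)
        (trans (ℕₚ.+-comm (m ℕ.* ℕ.pred ω) m) (trans (sym (ℕₚ.*-suc m (ℕ.pred ω))) (cong (m ℕ.*_) (ℕₚ.suc-pred ω)))))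
        (^-period s ω v (proj₁ av) m))

-- Arithmetic of the cyclic index set

module _ {k : ℕ} .{{_ : NonZero k}} where

  toℕ-mod : ∀ a → toℕ (a mod k) ≡ a % k
  toℕ-mod a = toℕ-fromℕ< (m%n<n a k)

  mod-cong : ∀ {a b} → a % k ≡ b % k → a mod k ≡ b mod k
  mod-cong {a} {b} eq = toℕ-injective (trans (toℕ-mod a) (trans eq (sym (toℕ-mod b))))

  mod-toℕ : ∀ (i : Fin k) → toℕ i mod k ≡ i
  mod-toℕ i = toℕ-injective (trans (toℕ-mod (toℕ i)) (m<n⇒m%n≡m (toℕ<n i)))

  %-+ˡ : ∀ a b → (a % k ℕ.+ b) % k ≡ (a ℕ.+ b) % k
  %-+ˡ a b = trans (%-distribˡ-+ (a % k) b k) (trans (cong (λ t → (t ℕ.+ b % k) % k) (m%n%n≡m%n a k)) (sym (%-distribˡ-+ a b k)))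

  next-mod : ∀ a → next (a mod k) ≡ suc a mod k
  next-mod a = mod-cong (trans (cong (λ t → suc t % k) (toℕ-mod a))
    (trans (cong (_% k) (ℕₚ.+-comm 1 (a % k))) (trans (%-+ˡ a 1) (cong (_% k) (ℕₚ.+-comm a 1)))))

  around : ∀ (i : Fin k) → (toℕ i ℕ.+ k) mod k ≡ i
  around i = trans (mod-cong ([m+n]%n≡m%n (toℕ i) k)) (mod-toℕ i)

  next-prev : ∀ (i : Fin k) → next (prev i) ≡ i
  next-prev i = trans (next-mod (toℕ i ℕ.+ ℕ.pred k)) (trans
    (cong (_mod k) (trans (sym (ℕₚ.+-suc (toℕ i) (ℕ.pred k))) (cong (toℕ i ℕ.+_) (ℕₚ.suc-pred k)))) (around i))

  prev-next : ∀ (i : Fin k) → prev (next i) ≡ i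
  prev-next i = trans (mod-cong (trans (cong (λ t → (t ℕ.+ ℕ.pred k) % k) (toℕ-mod (suc (toℕ i)))) (%-+ˡ (suc (toℕ i)) (ℕ.pred k))))
    (trans (cong (_mod k) (trans (sym (ℕₚ.+-suc (toℕ i) (ℕ.pred k))) (cong (toℕ i ℕ.+_) (ℕₚ.suc-pred k)))) (around i))

  next-injective : ∀ {i j : Fin k} → next i ≡ next j → i ≡ j
  next-injective {i} {j} eq = trans (sym (prev-next i)) (trans (cong prev eq) (prev-next j))

  shift-first : ∀ m → shift m (first {k}) ≡ m mod k
  shift-first zero    = refl
  shift-first (suc m) = trans (cong next (shift-first m)) (next-mod m)

  shift-first-injective : ∀ {a b} → a < k → b < k → shift a (first {k}) ≡ shift b first → a ≡ b
  shift-first-injective {a} {b} a<k b<k eq = trans (sym (m<n⇒m%n≡m a<k)) (trans (sym (toℕ-mod a))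
    (trans (cong toℕ (trans (sym (shift-first a)) (trans eq (shift-first b)))) (trans (toℕ-mod b) (m<n⇒m%n≡m b<k))))

  -- Every index is a shift of `first`. The main use is for sizes: equality between neighbours
  -- forces one common size.
  next-invariant : ∀ {A : Set} (h : Fin k → A) → (∀ i → h i ≡ h (next i)) → ∀ i → h first ≡ h i
  next-invariant h inv i = trans (along (toℕ i)) (cong h (trans (shift-first (toℕ i)) (mod-toℕ i)))
    where
    along : ∀ m → h first ≡ h (shift m first)
    along zero    = refl
    along (suc m) = trans (along m) (inv _)

bounded : ∀ {k} (n : Fin k → ℕ) → ∃ λ b → ∀ i → n i ≤ b
bounded {zero}  n = 0 , λ ()
bounded {suc k} n = let (b , n≤b) = bounded (n ∘ suc) in
  n zero ℕ.⊔ b , λ { zero → ℕₚ.m≤m⊔n (n zero) b ; (suc i) → ℕₚ.≤-trans (n≤b i) (ℕₚ.m≤n⊔m (n zero) b) }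

-- Recurrent families of a cyclic tuple of maps

module Decomposition (k : ℕ) .{{_ : NonZero k}} (n : Fin k → ℕ) where

  open Tuples k n using (Vertex; Tuple; run; composite)
  open Endo Vertex using (_^_)

  Family : Set
  Family = ∀ i → Subset (n i)

  In : Family → Vertex → Set
  In S (i , v) = v ∈ S i

  in? : ∀ S → Decidable (In S)
  in? S (i , v) = v ∈? S i

  -- The whole tuple as one self-map of the disjoint union, so that the results on a single
  -- dynamical system apply. On the first set its k-th iterate is `composite f`.
  step : Tuple → Vertex → Vertex
  step f (i , v) = next i , f i v

  ,-injective₂ : ∀ {i} {u v : Fin (n i)} → _≡_ {A = Vertex} (i , u) (i , v) → u ≡ v
  ,-injective₂ refl = refl

  codeSize : ℕ
  codeSize = k ℕ.* proj₁ (bounded n)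

  code : Vertex → Fin codeSize
  code (i , v) = combine i (inject≤ v (proj₂ (bounded n) i))

  code-injective : ∀ {u v} → code u ≡ code v → u ≡ v
  code-injective {i , u} {j , v} eq with combine-injective i _ j _ eq
  ... | refl , eq′ = cong (i ,_) (inject≤-injective _ _ u v eq′)

  -- A multiple of every cycle length and a bound for every preperiod, so that step f ^ ω is idempotent.
  ω : ℕ
  ω = suc codeSize !

  instance
    ω≢0 : NonZero ω
    ω≢0 = suc codeSize ℕₚ.!≢0

  Perm : Tuple → Family → Set
  Perm f T = ∀ i → Bij (f i) (T i) (T (next i))

  perm? : ∀ f T → Dec (Perm f T)
  perm? f T = all? λ i → bij? (f i) (T i) (T (next i))

  -- Off `R` the maps then form a forest whose paths lead into `R`. The finite bound, the one
  -- supplied by `reaches`, makes the event decidable.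
  Acyc : Tuple → Family → Set
  Acyc f R = ∀ i v → ∃ λ (m : Fin (ω ℕ.+ ω)) → In R ((step f ^ toℕ m) (i , v))

  acyc? : ∀ f R → Dec (Acyc f R)
  acyc? f R = all? λ i → all? λ v → any? λ m → in? R ((step f ^ toℕ m) (i , v))

  Extends : Tuple → Family → Family → Set
  Extends f S R = (∀ i → S i ⊆ R i) × Perm f (λ i → R i ─ S i) × Acyc f R

  extends? : ∀ f S R → Dec (Extends f S R)
  extends? f S R = all? (λ i → S i ⊆? R i) ×-dec (perm? f (λ i → R i ─ S i) ×-dec acyc? f R)

  -- Leaves the map at `j` free, to be resampled given the others.
  PermExcept : Fin k → Tuple → Family → Set
  PermExcept j f T = ∀ i → i ≢ j → Bij (f i) (T i) (T (next i))

  permExcept? : ∀ j f T → Dec (PermExcept j f T)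
  permExcept? j f T = all? λ i → ¬? (i ≟ᶠ j) →-dec bij? (f i) (T i) (T (next i))

  permExcept-⇔ : ∀ {j f T} → PermExcept j f T → Bij (f j) (T j) (T (next j)) → Perm f T
  permExcept-⇔ {j} pe b i with i ≟ᶠ j
  ... | yes refl = b
  ... | no i≢    = pe i i≢

  AllSize : ℕ → Family → Set
  AllSize j T = ∀ i → ∣ T i ∣ ≡ j

  allSize? : ∀ j T → Dec (AllSize j T)
  allSize? j T = all? λ i → ∣ T i ∣ ℕₚ.≟ j

  perm-cong : ∀ {f S T} → (∀ i → S i ≡ T i) → Perm f S → Perm f T
  perm-cong {f} S≡T p i = subst₂ (Bij (f i)) (S≡T i) (S≡T (next i)) (p i)

  acyc-cong : ∀ {f S T} → (∀ i → S i ≡ T i) → Acyc f S → Acyc f T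
  acyc-cong S≡T ac i v = let (m , m∈) = ac i v in m , subst (_ ∈_) (S≡T _) m∈

  module _ (f : Tuple) (S : Family) where

    private
      open module Rec = Recurrence (Productₚ.≡-dec _≟ᶠ_ _≟ᶠ_) (step f) ω
             (^-factorial-idem code code-injective (step f)) (in? S)

    core : Family
    core i = subsetOf (λ v → avoiding? (i , v))

    closure : Family
    closure i = S i ∪ core i

    core∩S : ∀ {i v} → v ∈ core i → v ∉ S i
    core∩S {i} v∈ = avoiding-∉ (∈-subsetOf⁻ (λ v → avoiding? (i , v)) v∈)

    closure─S : ∀ i → closure i ─ S i ≡ core i
    closure─S i = ⊆-antisym ⊆core core⊆
      where
      ⊆core : closure i ─ S i ⊆ core i
      ⊆core v∈ with x∈p∪q⁻ (S i) (core i) (p─q⊆p (closure i) (S i) v∈)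
      ... | inj₁ v∈S = contradiction v∈S (∈─⇒∉ v∈)
      ... | inj₂ v∈core = v∈core
      core⊆ : core i ⊆ closure i ─ S i
      core⊆ v∈ = x∈p∧x∉q⇒x∈p─q (q⊆p∪q (S i) (core i) v∈) (core∩S v∈)

    core-perm : Perm f core
    core-perm i = (λ v v∈ → ∈⁺ (avoiding-step (∈⁻ v∈))) ,
      (λ u v u∈ v∈ eq → ,-injective₂ (avoiding-inj (∈⁻ u∈) (∈⁻ v∈) (cong (next i ,_) eq))) ,
      λ w w∈ → preimage (avoiding-sur (∈⁻ w∈))
      where
      ∈⁺ : ∀ {i v} → Avoiding (i , v) → v ∈ core i
      ∈⁺ {i} = ∈-subsetOf⁺ (λ v → avoiding? (i , v))
      ∈⁻ : ∀ {i v} → v ∈ core i → Avoiding (i , v)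
      ∈⁻ {i} = ∈-subsetOf⁻ (λ v → avoiding? (i , v))
      preimage : ∀ {w} → (∃ λ v → Avoiding v × step f v ≡ (next i , w)) → ∃ λ v → v ∈ core i × f i v ≡ w
      preimage ((j , v) , av , eq) with next-injective {i = j} {i} (cong proj₁ eq)
      ... | refl = v , ∈⁺ av , ,-injective₂ eq

    closure-extends : Extends f S closure
    closure-extends = (λ i v∈ → p⊆p∪q (core i) v∈) , perm-cong {f} (λ i → sym (closure─S i)) core-perm , acyclic
      where
      acyclic : Acyc f closure
      acyclic i v with reaches (i , v)
      ... | m , m< , hit = fromℕ< m< , subst (λ t → In closure ((step f ^ t) (i , v))) (sym (toℕ-fromℕ< m<)) (member hit)
        where
        member : ∀ {u} → In S u ⊎ Avoiding u → In closure u
        member {j , u} (inj₁ u∈S) = p⊆p∪q (core j) u∈S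
        member {j , u} (inj₂ av)  = q⊆p∪q (S j) (core j) (∈-subsetOf⁺ (λ v → avoiding? (j , v)) av)

    -- `step f` maps `R ─ S` injectively into itself, so these points are recurrent with cycles off
    -- `S`. Conversely `Acyc` sends each cycle avoiding `S` into `R ─ S`, and then the whole cycle
    -- lies there.
    extends-unique : ∀ R → Extends f S R → ∀ i → R i ≡ closure i
    extends-unique R (S⊆R , perm , acyc) i = ⊆-antisym R⊆ ⊆R
      where
      T : Vertex → Set
      T = In (λ i → R i ─ S i)
      T-step : ∀ {v} → T v → T (step f v)
      T-step {j , v} v∈ = proj₁ (perm j) v v∈
      T-inj : ∀ {u v} → T u → T v → step f u ≡ step f v → u ≡ v
      T-inj {i , u} {j , v} u∈ v∈ eq with next-injective {i = i} {j} (cong proj₁ eq)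
      ... | refl = cong (i ,_) (proj₁ (proj₂ (perm i)) u v u∈ v∈ (,-injective₂ eq))
      T∩S : ∀ {v} → T v → ¬ In S v
      T∩S {j , v} v∈ = ∈─⇒∉ v∈
      split : ∀ {v} → In R v → In S v ⊎ T v
      split {j , v} v∈ with v ∈? S j
      ... | yes v∈S = inj₁ v∈S
      ... | no v∉S  = inj₂ (x∈p∧x∉q⇒x∈p─q v∈ v∉S)
      reach : ∀ v → ∃ λ m → In S ((step f ^ m) v) ⊎ T ((step f ^ m) v)
      reach (j , v) = let (m , m∈) = acyc j v in toℕ m , split m∈
      R⊆ : R i ⊆ closure i
      R⊆ {v} v∈ with split {i , v} v∈
      ... | inj₁ v∈S = p⊆p∪q (core i) v∈S
      ... | inj₂ v∈T = q⊆p∪q (S i) (core i) (∈-subsetOf⁺ (λ v → avoiding? (i , v)) (permuted⇒avoiding T-step T-inj T∩S v∈T))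
      ⊆R : closure i ⊆ R i
      ⊆R {v} v∈ with x∈p∪q⁻ (S i) (core i) v∈
      ... | inj₁ v∈S = S⊆R i v∈S
      ... | inj₂ v∈core = p─q⊆p (R i) (S i) (avoiding⇒permuted T-step T-inj T∩S reach (∈-subsetOf⁻ (λ v → avoiding? (i , v)) v∈core))

    extends-cong : ∀ R → (∀ i → R i ≡ closure i) → Extends f S R
    extends-cong R R≡ = let (S⊆ , perm , acyc) = closure-extends in
      (λ i v∈ → subst (_ ∈_) (sym (R≡ i)) (S⊆ i v∈)) ,
      perm-cong {f} (λ i → cong (_─ S i) (sym (R≡ i))) perm ,
      acyc-cong (λ i → sym (R≡ i)) acyc

  -- The path is followed only to its first entry into `R`. Until then it reads values off `R`,
  -- where the maps agree, so the entry time cannot grow and the bound of `Acyc` is kept.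
  reach-resp : ∀ {f g R} → (∀ i v → v ∉ R i → f i v ≡ g i v) → ∀ m {u} →
               In R ((step f ^ m) u) → ∃ λ m′ → m′ ≤ m × In R ((step g ^ m′) u)
  reach-resp {f} {g} {R} f≡g m {j , u} m∈ with u ∈? R j
  reach-resp {f} {g} {R} f≡g m       {j , u} m∈ | yes u∈ = 0 , z≤n , u∈
  reach-resp {f} {g} {R} f≡g zero    {j , u} m∈ | no u∉  = contradiction m∈ u∉
  reach-resp {f} {g} {R} f≡g (suc m) {j , u} m∈ | no u∉  =
    let (m′ , m′≤ , m′∈) = reach-resp f≡g m {step f (j , u)} (subst (In R) (sym (^-suc (step f) m (j , u))) m∈) in
    suc m′ , s≤s m′≤ , subst (In R) (trans (cong (λ w → (step g ^ m′) (next j , w)) (f≡g j u u∉)) (^-suc (step g) m′ (j , u))) m′∈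

  -- Thus `Acyc` is an event of the values off `R`, while `Perm` for a family inside `R` reads only
  -- values on `R`: the source of their independence.
  acyc-resp : ∀ {f g R} → (∀ i v → v ∉ R i → f i v ≡ g i v) → Acyc f R → Acyc g R
  acyc-resp {f} {g} {R} f≡g ac i v with m , m∈ ← ac i v with m′ , m′≤ , m′∈ ← reach-resp {f} {g} {R} f≡g (toℕ m) {i , v} m∈ =
    fromℕ< (bound m m′≤) , subst (λ t → In R ((step g ^ t) (i , v))) (sym (toℕ-fromℕ< (bound m m′≤))) m′∈
    where
    bound : ∀ {b m′} (m : Fin b) → m′ ≤ toℕ m → m′ < b
    bound m m′≤ = ℕₚ.<-≤-trans (s≤s m′≤) (toℕ<n m)

  perm-resp : ∀ {f g T} → (∀ i v → v ∈ T i → f i v ≡ g i v) → Perm f T → Perm g T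
  perm-resp f≡g p i = bij-resp (f≡g i) (p i)

  -- An equation of vertices absorbs the transports along index equations that the types of `run`
  -- and `composite` would otherwise demand.
  run-step : ∀ f m {i} (v : Fin (n i)) → _≡_ {A = Vertex} (shift m i , run f m v) ((step f ^ m) (i , v))
  run-step f zero    v = refl
  run-step f (suc m) v = cong (step f) (run-step f m v)

  ,-subst : ∀ {i j} (eq : i ≡ j) (v : Fin (n i)) → _≡_ {A = Vertex} (j , subst (Fin ∘ n) eq v) (i , v)
  ,-subst refl v = refl

  composite-step : ∀ f v → _≡_ {A = Vertex} (first , composite f v) ((step f ^ k) (first , v))
  composite-step f v = trans (,-subst shift-k-first (run f k v)) (run-step f k v)

  composite-^-step : ∀ f m v → _≡_ {A = Vertex} (first , Endo._^_ (Fin (n first)) (composite f) m v) ((step f ^ (m ℕ.* k)) (first , v))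
  composite-^-step f zero    v = refl
  composite-^-step f (suc m) v = trans (composite-step f _) (trans (cong (step f ^ k) (composite-^-step f m v)) (sym (^-+ (step f) k (m ℕ.* k) (first , v))))

  run-bij : ∀ {f T} → Perm f T → ∀ m i → Bij (run f m {i}) (T i) (T (shift m i))
  run-bij         p zero    i = bij-id
  run-bij {f} {T} p (suc m) i = bij-∘ (run-bij p m i) (p (shift m i))

  bij-subst : ∀ {a} {A : Subset a} {i j} (T : Family) (eq : i ≡ j) (h : Fin a → Fin (n i)) → Bij h A (T i) → Bij (subst (Fin ∘ n) eq ∘ h) A (T j)
  bij-subst T refl h b = b

  composite-bij : ∀ {f T} → Perm f T → Bij (composite f) (T first) (T first)
  composite-bij {f} {T} p = bij-subst T shift-k-first (run f k) (run-bij p k first)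

  ^-bij : ∀ {m} {g : Fin m → Fin m} {A} → Bij g A A → ∀ j → Bij (Endo._^_ (Fin m) g j) A A
  ^-bij b zero    = bij-id
  ^-bij b (suc j) = bij-∘ (^-bij b j) b

  perm-∣∣ : ∀ {f T} → Perm f T → ∀ i → ∣ T first ∣ ≡ ∣ T i ∣
  perm-∣∣ {T = T} p = next-invariant (λ i → ∣ T i ∣) (λ i → bij-∣∣ (p i))

  -- Within `ω + ω` steps every vertex has entered `R`, which it cannot leave; this bounds the
  -- images from above. The composite permutes `R first`, which bounds them from below.
  perm-stabilizes : ∀ {f R} → Perm f R → Acyc f R → StabilizesTo (composite f) (R first)
  perm-stabilizes {f} {R} perm acyc = ω ℕ.+ ω , λ m ω2≤m → ⊆-antisym (image⊆ m ω2≤m) (⊆image m)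
    where
    In-^ : ∀ m {u} → In R u → In R ((step f ^ m) u)
    In-^ zero    u∈ = u∈
    In-^ (suc m) u∈ = proj₁ (perm _) _ (In-^ m u∈)
    image⊆ : ∀ m → ω ℕ.+ ω ≤ m → image (Endo._^_ _ (composite f) m) ⊆ R first
    image⊆ m ω2≤m u∈ with v , refl ← ∈-image⁻ (Endo._^_ _ (composite f) m) u∈ with j , j∈ ← acyc first v =
      subst (In R) (trans (sym (^-+ (step f) (m ℕ.* k ℕ.∸ toℕ j) (toℕ j) (first , v)))
        (trans (cong (λ t → (step f ^ t) (first , v)) (ℕₚ.m∸n+n≡m j≤)) (sym (composite-^-step f m v))))
        (In-^ (m ℕ.* k ℕ.∸ toℕ j) j∈)
      where
      j≤ : toℕ j ≤ m ℕ.* k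
      j≤ = ℕₚ.≤-trans (ℕₚ.<⇒≤ (toℕ<n j)) (ℕₚ.≤-trans ω2≤m (ℕₚ.m≤m*n m k))
    ⊆image : ∀ m → R first ⊆ image (Endo._^_ _ (composite f) m)
    ⊆image m v∈ = let (u , _ , eq) = proj₂ (proj₂ (^-bij (composite-bij perm) m)) _ v∈ in
      subst (_∈ image (Endo._^_ _ (composite f) m)) eq (∈-image⁺ (Endo._^_ _ (composite f) m) u)

-- Closing up the cycle at its last map

module Cyclic (k : ℕ) .{{_ : NonZero k}} (n : Fin k → ℕ) where

  open Tuples k n using (Vertex; Tuple; run; composite)
  open Decomposition k n
  open Endo Vertex using (_^_)

  k′ : ℕ
  k′ = ℕ.pred k

  -- The index of the map back into the first set. As a shift of `first` it is where `run f k′` ends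
  -- by computation; the price is the transport along `next-final`.
  final : Fin k
  final = shift k′ first

  next-final : next final ≡ first
  next-final = trans (cong (λ m → shift m first) (ℕₚ.suc-pred k)) shift-k-first

  -- Hence `run f k′` from `first` never reads `f final`, which can be resampled without disturbing
  -- it.
  before-final : ∀ {m} → m < k′ → shift m first ≢ final
  before-final {m} m<k′ eq = ℕₚ.<⇒≢ m<k′ (shift-first-injective (ℕₚ.<-trans m<k′ k′<k) k′<k eq)
    where
    k′<k : k′ < k
    k′<k = ℕₚ.≤-reflexive (ℕₚ.suc-pred k)

  closeUp : Tuple → (Fin (n final) → Fin (n (next final))) → Fin (n first) → Fin (n first)
  closeUp f g v = subst (Fin ∘ n) next-final (g (run f k′ v))

  composite≗closeUp : ∀ f v → composite f v ≡ closeUp f (f final) v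
  composite≗closeUp f v = ,-injective₂ (trans (composite-step f v) (sym (trans (,-subst next-final _)
    (trans (cong (step f) (run-step f k′ v)) (cong (λ m → (step f ^ m) (first , v)) (ℕₚ.suc-pred k))))))

  run-resp : ∀ {f g : Tuple} → (∀ i → i ≢ final → f i ≡ g i) → ∀ m → m ≤ k′ → ∀ v → run f m {first} v ≡ run g m v
  run-resp f≡g zero    _    v = refl
  run-resp {f} {g} f≡g (suc m) m<k′ v = trans (cong (f (shift m first)) (run-resp f≡g m (ℕₚ.<⇒≤ m<k′) v))
    (cong (λ h → h (run g m v)) (f≡g (shift m first) (before-final m<k′)))

  run-bij-before : ∀ {f T} → PermExcept final f T → ∀ m → m ≤ k′ → Bij (run f m {first}) (T first) (T (shift m first))
  run-bij-before pb zero    _    = bij-id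
  run-bij-before pb (suc m) m<k′ = bij-∘ (run-bij-before pb m (ℕₚ.<⇒≤ m<k′)) (pb (shift m first) (before-final m<k′))

  composite-resp : ∀ {f g T} → (∀ i v → v ∈ T i → f i v ≡ g i v) → Perm f T → ∀ v → v ∈ T first → composite f v ≡ composite g v
  composite-resp {f} {g} {T} f≡g perm v v∈ = cong (subst (Fin ∘ n) shift-k-first) (runs k)
    where
    runs : ∀ m → run f m v ≡ run g m v
    runs zero    = refl
    runs (suc m) = trans (f≡g _ _ (proj₁ (run-bij perm m first) v v∈)) (cong (g (shift m first)) (runs m))

  module _ {N : ℕ} (lam : Partition N) where

    parts : List ℕ
    parts = Partition.parts lam

    CompositeTyped : Tuple → Family → Set
    CompositeTyped f T = Typed N (composite f) (T first) parts

    compositeTyped? : ∀ f T → Dec (CompositeTyped f T)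
    compositeTyped? f T = typed? N (composite f) (T first) parts

    module _ {f T} (perm : Perm f T) (acyc : Acyc f T) where

      eventuallyCyclic⁺ : AllSize N T → CompositeTyped f T → EventuallyCyclic lam (composite f)
      eventuallyCyclic⁺ size typed = T first , perm-stabilizes perm acyc , size first , composite-bij perm , typed

      -- The stable image is unique and is `T first` by `perm-stabilizes`; the bijections carry its
      -- size to every index.
      eventuallyCyclic⁻ : EventuallyCyclic lam (composite f) → AllSize N T × CompositeTyped f T
      eventuallyCyclic⁻ (S , stab , size , _ , typed)
        with refl ← stabilizesTo-unique {g = composite f} stab (perm-stabilizes perm acyc) =
        (λ i → trans (sym (perm-∣∣ perm i)) size) , typed

-- Expectations over all tuples and the recurrence in the size

module Core {c ℓ} (R : CommutativeRing c ℓ) where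

  open CommutativeRing R hiding (zero; _-_) renaming (refl to ≈-refl; sym to ≈-sym; trans to ≈-trans; reflexive to ≈-reflexive)
  open FiniteSums R
  open Sums R
  open Counting R
  open CycleTypes R
  open MonoidSum *-commutativeMonoid using () renaming
    (sum-cong-≋ to product-cong; ∑-distrib-+ to product-*; sum-permute to product-permute)
  open RingSolver commutativeSemiring using (solve; _:=_; _:+_; _:*_)
  open SetoidReasoning setoid

  product-next : ∀ {k} .{{_ : NonZero k}} (h : Fin k → Carrier) → product (λ i → h (next i)) ≈ product h
  product-next h = ≈-sym (product-permute h (permutation next prev next-prev prev-next))

  product-replace : ∀ {k} (φ χ : Fin k → Carrier) j → φ j ≈ 1# → (∀ i → i ≢ j → φ i ≈ χ i) → product φ * χ j ≈ product χ
  product-replace φ χ zero    φj others = ≈-trans (*-congʳ (≈-trans (*-congʳ φj) (*-identityˡ _))) (≈-trans (*-comm _ _)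
    (*-congˡ (product-cong (λ i → others (suc i) λ ()))))
  product-replace φ χ (suc j) φj others = ≈-trans (*-assoc _ _ _)
    (*-cong (others zero λ ()) (product-replace (φ ∘ suc) (χ ∘ suc) j φj (λ i i≢ → others (suc i) λ { refl → i≢ refl })))

  module Balanced (k : ℕ) .{{_ : NonZero k}} (n : Fin k → ℕ) (p : ∀ i → Fin (n i) → Carrier) (mass : ∀ i → sum (p i) ≈ 1#) where

    open Tuples k n using (Tuple)
    open Decomposition k n

    D : ∀ i → Distribution (Fin (n i))
    D i = finᴰ (p i) (mass i)

    mapᴰ : ∀ i → Distribution (Fin (n i) → Fin (n (next i)))
    mapᴰ i = iid (n i) (D (next i))

    tupleᴰ : Distribution Tuple
    tupleᴰ = Πᴰ mapᴰ

    families : List Family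
    families = choices (λ i → subsets (n i))

    μ : Family → Carrier
    μ S = product (λ i → monomial (p i) (S i))

    -- The F of the overview. It is never evaluated: what counts is that the sums for consecutive
    -- sizes share it.
    Pr-acyc : Family → Carrier
    Pr-acyc T = 𝔼 tupleᴰ (λ f → ⟦ acyc? f T ⟧)

    e : ℕ → Fin k → Carrier
    e j i = elementary (p i) j

    sameSize? : ∀ (T : Family) i → Dec (∣ T i ∣ ≡ ∣ T (next i) ∣)
    sameSize? T i = ∣ T i ∣ ℕₚ.≟ ∣ T (next i) ∣

    -- The maps are independent, and the i-th one yields the monomial at the next index; shifting
    -- the product around the cycle collects `μ T`.
    Pr-perm : ∀ T → 𝔼 tupleᴰ (λ f → ⟦ perm? f T ⟧) ≈ product (λ i → ⟦ sameSize? T i ⟧ * nat (∣ T i ∣ !)) * μ T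
    Pr-perm T = begin
      𝔼 tupleᴰ (λ f → ⟦ perm? f T ⟧)
        ≈⟨ 𝔼-cong tupleᴰ (λ f → ⟦⟧-all (λ i → bij? (f i) (T i) (T (next i)))) ⟩
      𝔼 tupleᴰ (λ f → product (λ i → ⟦ bij? (f i) (T i) (T (next i)) ⟧))
        ≈⟨ 𝔼-product mapᴰ (λ i g → ⟦ bij? g (T i) (T (next i)) ⟧) ⟩
      product (λ i → 𝔼 (mapᴰ i) (λ g → ⟦ bij? g (T i) (T (next i)) ⟧))
        ≈⟨ product-cong (λ i → ≈-trans (Pr-bij (p (next i)) (mass (next i)) (T i) (T (next i))) (≈-sym (*-assoc _ _ _))) ⟩
      product (λ i → (⟦ sameSize? T i ⟧ * nat (∣ T i ∣ !)) * monomial (p (next i)) (T (next i)))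
        ≈⟨ product-* (λ i → ⟦ sameSize? T i ⟧ * nat (∣ T i ∣ !)) _ ⟩
      product (λ i → ⟦ sameSize? T i ⟧ * nat (∣ T i ∣ !)) * product (λ i → monomial (p (next i)) (T (next i)))
        ≈⟨ *-congˡ (product-next (λ i → monomial (p i) (T i))) ⟩
      product (λ i → ⟦ sameSize? T i ⟧ * nat (∣ T i ∣ !)) * μ T ∎

    independent-acyc : ∀ {S T : Family} → (∀ i → S i ⊆ T i) → ∀ φ → Respects (λ f g → ∀ i v → v ∈ S i → f i v ≡ g i v) φ →
                       𝔼 tupleᴰ (λ f → φ f * ⟦ acyc? f T ⟧) ≈ 𝔼 tupleᴰ φ * Pr-acyc T
    independent-acyc {S} {T} S⊆T φ φ∼ = independent-Π mapᴰ
      {λ i f g → ∀ v → v ∈ S i → f v ≡ g v} {λ i f g → ∀ v → v ∉ S i → f v ≡ g v}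
      (λ _ _ _ → refl) (λ _ _ _ → refl)
      (λ i {φ} {ψ} → independent-iid (D (next i)) (S i) {φ} {ψ})
      {φ} {λ f → ⟦ acyc? f T ⟧} φ∼
      (λ f g f∼ → ⟦⟧-⇔ (acyc? f T) (acyc? g T)
        (acyc-resp {f} {g} {T} (λ i v v∉ → f∼ i v (v∉ ∘ S⊆T i)))
        (acyc-resp {g} {f} {T} (λ i v v∉ → sym (f∼ i v (v∉ ∘ S⊆T i)))))

    ∑-extends : ∀ S → ∑ families (λ T → ⟦ all? (λ i → S i ⊆? T i) ⟧ * (𝔼 tupleᴰ (λ f → ⟦ perm? f (λ i → T i ─ S i) ⟧) * Pr-acyc T)) ≈ 1#
    ∑-extends S = ≈-sym (begin
      1#
        ≈⟨ 𝔼-const tupleᴰ 1# ⟨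
      𝔼 tupleᴰ (λ f → 1#)
        ≈⟨ 𝔼-cong tupleᴰ (λ f → ∑-families-≡ (extends? f S) (closure f S) (extends-unique f S) (extends-cong f S) (λ _ → 1#) (λ _ _ → ≈-refl)) ⟨
      𝔼 tupleᴰ (λ f → ∑ families (λ T → ⟦ extends? f S T ⟧ * 1#))
        ≈⟨ 𝔼-∑ tupleᴰ families (λ T f → ⟦ extends? f S T ⟧ * 1#) ⟩
      ∑ families (λ T → 𝔼 tupleᴰ (λ f → ⟦ extends? f S T ⟧ * 1#))
        ≈⟨ ∑-cong families (λ T → ≈-trans (𝔼-cong tupleᴰ (λ f → ≈-trans (*-identityʳ _)
             (≈-trans (⟦⟧-× (all? (λ i → S i ⊆? T i)) (perm? f (T─ T) ×-dec acyc? f T)) (*-congˡ (⟦⟧-× (perm? f (T─ T)) (acyc? f T))))))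
             (≈-trans (𝔼-*ˡ tupleᴰ ⟦ all? (λ i → S i ⊆? T i) ⟧ (λ f → ⟦ perm? f (T─ T) ⟧ * ⟦ acyc? f T ⟧))
               (*-congˡ (independent-acyc {T─ T} {T} (λ i → p─q⊆p (T i) (S i)) (λ f → ⟦ perm? f (T─ T) ⟧) (λ f g f∼ →
                 ⟦⟧-⇔ (perm? f (T─ T)) (perm? g (T─ T)) (perm-resp {f} {g} {T─ T} f∼) (perm-resp {g} {f} {T─ T} (λ i v v∈ → sym (f∼ i v v∈)))))))) ⟩
      ∑ families (λ T → ⟦ all? (λ i → S i ⊆? T i) ⟧ * (𝔼 tupleᴰ (λ f → ⟦ perm? f (T─ T) ⟧) * Pr-acyc T)) ∎)
      where
      T─ : Family → Family
      T─ T i = T i ─ S i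

    factorials : ℕ → Carrier
    factorials j = product {k} (λ _ → nat (j !))

    -- The factor of the free map is multiplied back in, which avoids a division and is the form in
    -- which `Pr-closed` supplies that factor.
    Pr-permExcept : ∀ j N T → AllSize N T →
                    𝔼 tupleᴰ (λ f → ⟦ permExcept? j f T ⟧) * (nat (N !) * monomial (p (next j)) (T (next j))) ≈ factorials N * μ T
    Pr-permExcept j N T sized = begin
      𝔼 tupleᴰ (λ f → ⟦ permExcept? j f T ⟧) * χ j
        ≈⟨ *-congʳ (≈-trans (𝔼-cong tupleᴰ (λ f → ⟦⟧-all (λ i → d i (f i)))) (𝔼-product mapᴰ (λ i g → ⟦ d i g ⟧))) ⟩
      product (λ i → 𝔼 (mapᴰ i) (λ g → ⟦ d i g ⟧)) * χ j
        ≈⟨ product-replace (λ i → 𝔼 (mapᴰ i) (λ g → ⟦ d i g ⟧)) χ j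
             (≈-trans (𝔼-cong (mapᴰ j) (λ g → ⟦⟧-yes (d j g) (λ j≢j → contradiction refl j≢j))) (𝔼-const (mapᴰ j) 1#))
             (λ i i≢j → ≈-trans (𝔼-cong (mapᴰ i) (λ g → ⟦⟧-⇔ (d i g) (bij? g (T i) (T (next i))) (λ b → b i≢j) (λ b _ → b)))
               (≈-trans (Pr-bij (p (next i)) (mass (next i)) (T i) (T (next i)))
                 (≈-trans (*-cong (⟦⟧-yes (sameSize? T i) (trans (sized i) (sym (sized (next i)))))
                   (*-congʳ (≈-reflexive (cong (λ t → nat (t !)) (sized i))))) (*-identityˡ _)))) ⟩
      product χ
        ≈⟨ product-* (λ i → nat (N !)) (λ i → monomial (p (next i)) (T (next i))) ⟩
      factorials N * product (λ i → monomial (p (next i)) (T (next i)))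
        ≈⟨ *-congˡ (product-next (λ i → monomial (p i) (T i))) ⟩
      factorials N * μ T ∎
      where
      d : ∀ i (g : Fin (n i) → Fin (n (next i))) → Dec (i ≢ j → Bij g (T i) (T (next i)))
      d i g = ¬? (i ≟ᶠ j) →-dec bij? g (T i) (T (next i))
      χ : Fin k → Carrier
      χ i = nat (N !) * monomial (p (next i)) (T (next i))

    -- The coefficient of `μ T * Pr-acyc T` in the expansion for size `j`. It vanishes unless all
    -- sizes in `T` agree, and `j` enters only as a threshold.
    balanced : ℕ → Family → Carrier
    balanced j T = product (λ i → ⟦ j ℕₚ.≤? ∣ T i ∣ ⟧ * (⟦ sameSize? T i ⟧ * nat (∣ T i ∣ !)))

    ∑-balanced : ∀ j → factorials j * product (e j) ≈ ∑ families (λ T → balanced j T * (μ T * Pr-acyc T))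
    ∑-balanced j = begin
      factorials j * product (e j)
        ≈⟨ *-congˡ (≈-trans (product-cong (λ i → elementary-∑ (p i) j)) (≈-sym (∑-product (λ i → subsets (n i)) (λ i S → ⟦ ∣ S ∣ ℕₚ.≟ j ⟧ * monomial (p i) S)))) ⟩
      factorials j * ∑ families (λ S → product (λ i → ⟦ ∣ S i ∣ ℕₚ.≟ j ⟧ * monomial (p i) (S i)))
        ≈⟨ *-congˡ (∑-cong families (λ S → ≈-trans (≈-sym (*-identityʳ _)) (*-cong
             (≈-trans (product-* (λ i → ⟦ ∣ S i ∣ ℕₚ.≟ j ⟧) _) (*-congʳ (≈-sym (⟦⟧-all (λ i → ∣ S i ∣ ℕₚ.≟ j)))))
             (≈-sym (∑-extends S))))) ⟩
      factorials j * ∑ families (λ S → (⟦ allSize? j S ⟧ * μ S) * ∑ families (λ T → ⟦ below? S T ⟧ * (Pr S T * Pr-acyc T)))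
        ≈⟨ ≈-trans (≈-sym (∑-*ˡ families _ _)) (∑-cong families (λ S → ≈-trans (≈-sym (*-assoc _ _ _)) (≈-sym (∑-*ˡ families _ _)))) ⟩
      ∑ families (λ S → ∑ families (λ T → (factorials j * (⟦ allSize? j S ⟧ * μ S)) * (⟦ below? S T ⟧ * (Pr S T * Pr-acyc T))))
        ≈⟨ ∑-swap families families _ ⟩
      ∑ families (λ T → ∑ families (λ S → (factorials j * (⟦ allSize? j S ⟧ * μ S)) * (⟦ below? S T ⟧ * (Pr S T * Pr-acyc T))))
        ≈⟨ ∑-cong families (λ T → ∑-cong families (λ S → term S T)) ⟩
      ∑ families (λ T → ∑ families (λ S → product (λ i → ⟦ S i ⊆? T i ⟧ * ⟦ ∣ S i ∣ ℕₚ.≟ j ⟧) * (rest T * (μ T * Pr-acyc T))))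
        ≈⟨ ∑-cong families (λ T → ≈-trans (∑-*ʳ families _ _) (≈-trans (*-congʳ (choose-all T)) (≈-trans (≈-sym (*-assoc _ _ _)) (*-congʳ (coefficient T))))) ⟩
      ∑ families (λ T → balanced j T * (μ T * Pr-acyc T)) ∎
      where
      below? : ∀ (S T : Family) → Dec (∀ i → S i ⊆ T i)
      below? S T = all? (λ i → S i ⊆? T i)
      Pr : Family → Family → Carrier
      Pr S T = 𝔼 tupleᴰ (λ f → ⟦ perm? f (λ i → T i ─ S i) ⟧)
      rest : Family → Carrier
      rest T = product (λ i → nat (j !) * (⟦ sameSize? T i ⟧ * nat ((∣ T i ∣ ℕ.∸ j) !)))

      choose-all : ∀ T → ∑ families (λ S → product (λ i → ⟦ S i ⊆? T i ⟧ * ⟦ ∣ S i ∣ ℕₚ.≟ j ⟧)) ≈ product (λ i → nat (∣ T i ∣ choose j))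
      choose-all T = ≈-trans (∑-product (λ i → subsets (n i)) (λ i S → ⟦ S ⊆? T i ⟧ * ⟦ ∣ S ∣ ℕₚ.≟ j ⟧)) (product-cong (λ i → ∑-⊆ (T i) j))

      coefficient : ∀ T → product (λ i → nat (∣ T i ∣ choose j)) * rest T ≈ balanced j T
      coefficient T = ≈-trans (≈-sym (product-* (λ i → nat (∣ T i ∣ choose j)) _)) (product-cong (λ i → pointwise ∣ T i ∣ ⟦ sameSize? T i ⟧))
        where
        pointwise : ∀ m b → nat (m choose j) * (nat (j !) * (b * nat ((m ℕ.∸ j) !))) ≈ ⟦ j ℕₚ.≤? m ⟧ * (b * nat (m !))
        pointwise m b with j ℕₚ.≤? m
        ... | yes j≤m = begin
          nat (m choose j) * (nat (j !) * (b * nat ((m ℕ.∸ j) !)))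
            ≈⟨ solve 4 (λ x y b z → x :* (y :* (b :* z)) := b :* (x :* (y :* z))) ≈-refl (nat (m choose j)) _ b _ ⟩
          b * (nat (m choose j) * (nat (j !) * nat ((m ℕ.∸ j) !)))
            ≈⟨ *-congˡ (≈-trans (*-congˡ (≈-sym (nat-* (j !) _))) (≈-trans (≈-sym (nat-* (m choose j) _)) (≈-reflexive (cong nat (C-factorial j≤m))))) ⟩
          b * nat (m !)
            ≈⟨ ≈-trans (*-congʳ (⟦⟧-yes (j ℕₚ.≤? m) j≤m)) (*-identityˡ _) ⟨
          ⟦ j ℕₚ.≤? m ⟧ * (b * nat (m !)) ∎
        -- Above `m` the binomial coefficient vanishes, in agreement with the bracket, whatever the
        -- truncated subtraction gives.
        ... | no j≰m = ≈-trans (*-congʳ (≈-reflexive (cong nat (k>n⇒nCk≡0 (ℕₚ.≰⇒> j≰m)))))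
          (≈-trans (zeroˡ _) (≈-sym (≈-trans (*-congʳ (⟦⟧-no (j ℕₚ.≤? m) j≰m)) (zeroˡ _))))

      term : ∀ S T → (factorials j * (⟦ allSize? j S ⟧ * μ S)) * (⟦ below? S T ⟧ * (Pr S T * Pr-acyc T))
                     ≈ product (λ i → ⟦ S i ⊆? T i ⟧ * ⟦ ∣ S i ∣ ℕₚ.≟ j ⟧) * (rest T * (μ T * Pr-acyc T))
      term S T = begin
        (factorials j * (⟦ allSize? j S ⟧ * μ S)) * (⟦ below? S T ⟧ * (Pr S T * Pr-acyc T))
          ≈⟨ solve 6 (λ c s m b r a → (c :* (s :* m)) :* (b :* (r :* a)) := b :* (s :* (c :* (m :* r) :* a))) ≈-refl
               (factorials j) ⟦ allSize? j S ⟧ (μ S) ⟦ below? S T ⟧ (Pr S T) (Pr-acyc T) ⟩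
        ⟦ below? S T ⟧ * (⟦ allSize? j S ⟧ * (factorials j * (μ S * Pr S T) * Pr-acyc T))
          ≈⟨ ⟦⟧*-cong (below? S T) (λ S⊆T → ⟦⟧*-cong (allSize? j S) (λ ∣S∣ → *-congʳ (value S⊆T ∣S∣))) ⟩
        ⟦ below? S T ⟧ * (⟦ allSize? j S ⟧ * (rest T * μ T * Pr-acyc T))
          ≈⟨ ≈-trans (≈-sym (*-assoc _ _ _)) (*-cong (≈-trans (*-cong (⟦⟧-all (λ i → S i ⊆? T i)) (⟦⟧-all (λ i → ∣ S i ∣ ℕₚ.≟ j)))
               (≈-sym (product-* (λ i → ⟦ S i ⊆? T i ⟧) _))) (*-assoc _ _ _)) ⟩
        product (λ i → ⟦ S i ⊆? T i ⟧ * ⟦ ∣ S i ∣ ℕₚ.≟ j ⟧) * (rest T * (μ T * Pr-acyc T)) ∎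
        where
        value : (∀ i → S i ⊆ T i) → (∀ i → ∣ S i ∣ ≡ j) → factorials j * (μ S * Pr S T) ≈ rest T * μ T
        value S⊆T ∣S∣ = begin
          factorials j * (μ S * Pr S T)
            ≈⟨ *-congˡ (*-congˡ (Pr-perm (λ i → T i ─ S i))) ⟩
          factorials j * (μ S * (perms * μ (λ i → T i ─ S i)))
            ≈⟨ solve 4 (λ c m q m′ → c :* (m :* (q :* m′)) := (c :* q) :* (m :* m′)) ≈-refl (factorials j) (μ S) perms _ ⟩
          (factorials j * perms) * (μ S * μ (λ i → T i ─ S i))
            ≈⟨ *-cong (≈-trans (≈-sym (product-* (λ _ → nat (j !)) permFactor)) (product-cong (λ i → *-congˡ {nat (j !)} (*-cong (sizes i) (≈-reflexive (cong (λ t → nat (t !)) (∣T─S∣ i)))))))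
                      (≈-trans (≈-sym (product-* (λ i → monomial (p i) (S i)) _)) (product-cong (λ i → monomial-─ (p i) {T i} (S⊆T i)))) ⟩
          rest T * μ T ∎
          where
          permFactor : Fin k → Carrier
          permFactor i = ⟦ ∣ T i ─ S i ∣ ℕₚ.≟ ∣ T (next i) ─ S (next i) ∣ ⟧ * nat (∣ T i ─ S i ∣ !)
          perms = product permFactor
          j+ : ∀ i → j ℕ.+ ∣ T i ─ S i ∣ ≡ ∣ T i ∣
          j+ i = trans (cong (ℕ._+ ∣ T i ─ S i ∣) (sym (∣S∣ i))) (∣─∣ (S⊆T i))
          ∣T─S∣ : ∀ i → ∣ T i ─ S i ∣ ≡ ∣ T i ∣ ℕ.∸ j
          ∣T─S∣ i = trans (sym (ℕₚ.m+n∸m≡n j _)) (cong (ℕ._∸ j) (j+ i))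
          sizes : ∀ i → ⟦ ∣ T i ─ S i ∣ ℕₚ.≟ ∣ T (next i) ─ S (next i) ∣ ⟧ ≈ ⟦ sameSize? T i ⟧
          sizes i = ⟦⟧-⇔ (∣ T i ─ S i ∣ ℕₚ.≟ ∣ T (next i) ─ S (next i) ∣) (sameSize? T i)
            (λ eq → trans (sym (j+ i)) (trans (cong (j ℕ.+_) eq) (j+ (next i))))
            (λ eq → ℕₚ.+-cancelˡ-≡ j _ _ (trans (j+ i) (trans eq (sym (j+ (next i))))))

    -- If neighbouring sizes differ somewhere, both sides are zero. Otherwise there is one common
    -- size, and raising the threshold by one drops exactly the families of size `j`.
    balanced-suc : ∀ j T → balanced j T ≈ ⟦ allSize? j T ⟧ * factorials j + balanced (suc j) T
    balanced-suc j T with all? (sameSize? T)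
    ... | no ¬eq = ≈-trans (balanced-0 j) (≈-sym (≈-trans (+-cong
            (≈-trans (*-congʳ (⟦⟧-no (allSize? j T) (λ eq → ¬eq (λ i → trans (eq i) (sym (eq (next i))))))) (zeroˡ _))
            (balanced-0 (suc j))) (+-identityˡ _)))
      where
      balanced-0 : ∀ j → balanced j T ≈ 0#
      balanced-0 j = let (i , ≢) = ¬∀⟶∃¬ k (λ i → ∣ T i ∣ ≡ ∣ T (next i) ∣) (sameSize? T) ¬eq in
        product-0 i (≈-trans (*-congˡ (≈-trans (*-congʳ (⟦⟧-no (sameSize? T i) ≢)) (zeroˡ _))) (zeroʳ _))
    ... | yes eq = compare (ℕₚ.<-cmp ∣ T first ∣ j)
      where
      all≡ : ∀ i → ∣ T first ∣ ≡ ∣ T i ∣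
      all≡ = next-invariant (λ i → ∣ T i ∣) eq
      small : ∀ j → ∣ T first ∣ < j → balanced j T ≈ 0#
      small j < = product-0 first (≈-trans (*-congʳ (⟦⟧-no (j ℕₚ.≤? ∣ T first ∣) (ℕₚ.<⇒≱ <))) (zeroˡ _))
      not-all : ∣ T first ∣ ≢ j → ⟦ allSize? j T ⟧ * factorials j ≈ 0#
      not-all ≢ = ≈-trans (*-congʳ (⟦⟧-no (allSize? j T) (λ all → ≢ (all first)))) (zeroˡ _)
      compare : _ → balanced j T ≈ ⟦ allSize? j T ⟧ * factorials j + balanced (suc j) T
      compare (tri< < ≢ _) = ≈-trans (small j <) (≈-sym (≈-trans (+-cong (not-all ≢) (small (suc j) (ℕₚ.m<n⇒m<1+n <))) (+-identityˡ _)))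
      compare (tri≈ _ ≡j _) = begin
        balanced j T
          ≈⟨ product-cong (λ i → ≈-trans (*-cong (⟦⟧-yes (j ℕₚ.≤? ∣ T i ∣) (ℕₚ.≤-reflexive (sym (size i))))
               (≈-trans (*-cong (⟦⟧-yes (sameSize? T i) (eq i)) (≈-reflexive (cong (λ t → nat (t !)) (size i)))) (*-identityˡ _))) (*-identityˡ _)) ⟩
        factorials j
          ≈⟨ ≈-trans (+-cong (≈-trans (*-congʳ (⟦⟧-yes (allSize? j T) size)) (*-identityˡ _)) (small (suc j) (s≤s (ℕₚ.≤-reflexive ≡j)))) (+-identityʳ _) ⟨
        ⟦ allSize? j T ⟧ * factorials j + balanced (suc j) T ∎
        where
        size : ∀ i → ∣ T i ∣ ≡ j
        size i = trans (sym (all≡ i)) ≡j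
      compare (tri> _ ≢ >) = ≈-trans (product-cong (λ i → *-congʳ (⟦⟧-⇔ (j ℕₚ.≤? ∣ T i ∣) (suc j ℕₚ.≤? ∣ T i ∣)
          (λ _ → subst (j <_) (all≡ i) >) (ℕₚ.≤-trans (ℕₚ.n≤1+n j)))))
        (≈-sym (≈-trans (+-congʳ (not-all ≢)) (+-identityˡ _)))

    Φ : ℕ → Carrier
    Φ j = ∑ families (λ T → ⟦ allSize? j T ⟧ * (μ T * Pr-acyc T))

    Φ-recurrence : ∀ j → factorials j * product (e j) ≈ factorials j * Φ j + factorials (suc j) * product (e (suc j))
    Φ-recurrence j = begin
      factorials j * product (e j)
        ≈⟨ ∑-balanced j ⟩
      ∑ families (λ T → balanced j T * (μ T * Pr-acyc T))
        ≈⟨ ∑-cong families (λ T → ≈-trans (*-congʳ (balanced-suc j T))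
             (solve 4 (λ b c b′ m → (b :* c :+ b′) :* m := c :* (b :* m) :+ b′ :* m) ≈-refl ⟦ allSize? j T ⟧ (factorials j) _ _)) ⟩
      ∑ families (λ T → factorials j * (⟦ allSize? j T ⟧ * (μ T * Pr-acyc T)) + balanced (suc j) T * (μ T * Pr-acyc T))
        ≈⟨ ∑-+ families _ _ ⟩
      ∑ families (λ T → factorials j * (⟦ allSize? j T ⟧ * (μ T * Pr-acyc T))) + ∑ families (λ T → balanced (suc j) T * (μ T * Pr-acyc T))
        ≈⟨ +-cong (∑-*ˡ families (factorials j) _) (≈-sym (∑-balanced (suc j))) ⟩
      factorials j * Φ j + factorials (suc j) * product (e (suc j)) ∎

  -- Tuples whose composite has a given cycle type

  module Counted (k : ℕ) .{{_ : NonZero k}} (n : Fin k → ℕ) (p : ∀ i → Fin (n i) → Carrier) (mass : ∀ i → sum (p i) ≈ 1#)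
                 {N : ℕ} (lam : Partition N) where

    open Tuples k n using (Tuple; run; composite)
    open Decomposition k n
    open Cyclic k n
    open Balanced k n p mass

    ps : List ℕ
    ps = parts lam

    z : Carrier
    z = nat (zOrder N ps)

    -- The index and its equation are variables so that `Pr-closed` can match on `refl` and fall
    -- back on self-maps of the first set; the case of interest is `next final`.
    Closed : ∀ {i} → i ≡ first → Family → (Fin (n first) → Fin (n i)) → Set
    Closed {i} eq T h = Bij h (T first) (T i) × Typed N (subst (Fin ∘ n) eq ∘ h) (T first) ps

    closed? : ∀ {i} (eq : i ≡ first) T h → Dec (Closed eq T h)
    closed? {i} eq T h = bij? h (T first) (T i) ×-dec typed? N (subst (Fin ∘ n) eq ∘ h) (T first) ps

    closed-resp : ∀ {i} (eq : i ≡ first) T {h h′} → (∀ v → v ∈ T first → h v ≡ h′ v) → Closed eq T h → Closed eq T h′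
    closed-resp eq T h≡ (b , ty) = bij-resp h≡ b , typed-resp {B = N} {S = T first} {ps} (λ v v∈ → cong (subst (Fin ∘ n) eq) (h≡ v v∈)) ty

    Pr-closed : ∀ {i} (eq : i ≡ first) T → AllSize N T →
                z * 𝔼 (iid (n first) (D i)) (λ h → ⟦ closed? eq T h ⟧) ≈ nat (N !) * monomial (p i) (T i)
    Pr-closed refl T sized = ≈-trans
      (Pr-type (p first) (mass first) (T first) ps (Partition.positive lam) (trans (Partition.total lam) (sym (sized first))) (ℕₚ.≤-reflexive (sized first)))
      (*-congʳ (≈-reflexive (cong (λ t → nat (t !)) (sized first))))

    -- Given the other maps, f final may be replaced by an independent random map g, and
    -- pulling g back along the injection run f k′ gives a random map out of the first set.
    Pr-permTyped : ∀ T → AllSize N T →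
                   z * 𝔼 tupleᴰ (λ f → ⟦ perm? f T ×-dec compositeTyped? lam f T ⟧) ≈ factorials N * μ T
    Pr-permTyped T sized = begin
      z * 𝔼 tupleᴰ (λ f → ⟦ perm? f T ×-dec compositeTyped? lam f T ⟧)
        ≈⟨ *-congˡ (𝔼-cong tupleᴰ (λ f → ⟦⟧-⇔ (perm? f T ×-dec compositeTyped? lam f T) (ψ? (f final) f)
             (λ (perm , ty) → (λ i _ → perm i) , perm final , typed-resp {B = N} {S = T first} {ps} (λ v _ → composite≗closeUp f v) ty)
             (λ (pe , b , ty) → permExcept-⇔ {final} {f} {T} pe b , typed-resp {B = N} {S = T first} {ps} (λ v _ → sym (composite≗closeUp f v)) ty))) ⟩
      z * 𝔼 tupleᴰ (λ f → ⟦ ψ? (f final) f ⟧)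
        ≈⟨ *-congˡ (resample mapᴰ final (λ g f → ⟦ ψ? g f ⟧) (λ g f f′ f∼ → ⟦⟧-⇔ (ψ? g f) (ψ? g f′) (ψ-resp g f f′ f∼) (ψ-resp g f′ f (λ i i≢ → sym (f∼ i i≢))))) ⟩
      z * 𝔼 tupleᴰ (λ f → 𝔼 (mapᴰ final) (λ g → ⟦ ψ? g f ⟧))
        ≈⟨ *-congˡ (𝔼-cong tupleᴰ conditional) ⟩
      z * 𝔼 tupleᴰ (λ f → ⟦ others? f ⟧ * closedMass)
        ≈⟨ *-congˡ (𝔼-*ʳ tupleᴰ closedMass (λ f → ⟦ others? f ⟧)) ⟩
      z * (𝔼 tupleᴰ (λ f → ⟦ others? f ⟧) * closedMass)
        ≈⟨ solve 3 (λ x y z → x :* (y :* z) := y :* (x :* z)) ≈-refl (z) _ closedMass ⟩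
      𝔼 tupleᴰ (λ f → ⟦ others? f ⟧) * (z * closedMass)
        ≈⟨ *-congˡ (Pr-closed next-final T sized) ⟩
      𝔼 tupleᴰ (λ f → ⟦ others? f ⟧) * (nat (N !) * monomial (p (next final)) (T (next final)))
        ≈⟨ Pr-permExcept final N T sized ⟩
      factorials N * μ T ∎
      where
      others? : ∀ f → Dec (PermExcept final f T)
      others? f = permExcept? final f T

      ψ? : ∀ (g : Fin (n final) → Fin (n (next final))) f →
           Dec (PermExcept final f T × Bij g (T final) (T (next final)) × Typed N (closeUp f g) (T first) ps)
      ψ? g f = others? f ×-dec (bij? g (T final) (T (next final)) ×-dec typed? N (closeUp f g) (T first) ps)

      ψ-resp : ∀ g f f′ → (∀ i → i ≢ final → f i ≡ f′ i) →
               PermExcept final f T × Bij g (T final) (T (next final)) × Typed N (closeUp f g) (T first) ps →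
               PermExcept final f′ T × Bij g (T final) (T (next final)) × Typed N (closeUp f′ g) (T first) ps
      ψ-resp g f f′ f∼ (pe , b , ty) =
        (λ i i≢ → subst (λ h → Bij h (T i) (T (next i))) (f∼ i i≢) (pe i i≢)) , b ,
        typed-resp {B = N} {S = T first} {ps} (λ v _ → cong (subst (Fin ∘ n) next-final ∘ g) (run-resp {f} {f′} f∼ k′ ℕₚ.≤-refl v)) ty

      closedMass : Carrier
      closedMass = 𝔼 (iid (n first) (D (next final))) (λ h → ⟦ closed? next-final T h ⟧)

      conditional : ∀ f → 𝔼 (mapᴰ final) (λ g → ⟦ ψ? g f ⟧) ≈ ⟦ others? f ⟧ * closedMass
      conditional f = begin
        𝔼 (mapᴰ final) (λ g → ⟦ ψ? g f ⟧)
          ≈⟨ ≈-trans (𝔼-cong (mapᴰ final) (λ g → ⟦⟧-× (permExcept? final f T) (bt? g))) (𝔼-*ˡ (mapᴰ final) ⟦ others? f ⟧ (λ g → ⟦ bt? g ⟧)) ⟩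
        ⟦ others? f ⟧ * 𝔼 (mapᴰ final) (λ g → ⟦ bt? g ⟧)
          ≈⟨ ⟦⟧*-cong (others? f) pulled ⟩
        ⟦ others? f ⟧ * closedMass ∎
        where
        bt? : ∀ g → Dec (Bij g (T final) (T (next final)) × Typed N (closeUp f g) (T first) ps)
        bt? g = bij? g (T final) (T (next final)) ×-dec typed? N (closeUp f g) (T first) ps

        -- On this event `τ` is a bijection onto `T final`, so `g` is bijective on `T final` exactly
        -- when `g ∘ τ` is on `T first`, and the event reads `g` only through `g ∘ τ`.
        pulled : PermExcept final f T → 𝔼 (mapᴰ final) (λ g → ⟦ bt? g ⟧) ≈ closedMass
        pulled pe = ≈-trans same-event (𝔼-pullback (D (next final)) (T first) τ (proj₁ (proj₂ τ-bij)) Θ Θ-resp)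
          where
          τ : Fin (n first) → Fin (n final)
          τ = run f k′
          τ-bij : Bij τ (T first) (T final)
          τ-bij = run-bij-before {f} {T} pe k′ ℕₚ.≤-refl
          closedBy? : ∀ h → Dec (Closed {next final} next-final T h)
          closedBy? = closed? {next final} next-final T
          Θ : (Fin (n first) → Fin (n (next final))) → Carrier
          Θ h = ⟦ closedBy? h ⟧
          Θ-resp : ∀ h h′ → (∀ v → v ∈ T first → h v ≡ h′ v) → Θ h ≈ Θ h′
          Θ-resp h h′ h∼ = ⟦⟧-⇔ (closedBy? h) (closedBy? h′)
            (closed-resp {next final} next-final T h∼) (closed-resp {next final} next-final T (λ v v∈ → sym (h∼ v v∈)))
          same-event : 𝔼 (mapᴰ final) (λ g → ⟦ bt? g ⟧) ≈ 𝔼 (mapᴰ final) (λ g → Θ (g ∘ τ))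
          same-event = 𝔼-cong (mapᴰ final) (λ g → ⟦⟧-⇔ (bt? g) (closedBy? (g ∘ τ))
            (λ bt → bij-∘ {f = τ} {g} {T first} {T final} {T (next final)} τ-bij (proj₁ bt) , proj₂ bt)
            (λ bt → bij-∘⁻ {f = τ} {g} {T first} {T final} {T (next final)} τ-bij (proj₁ bt) , proj₂ bt))

    -- Its unique extension is the family of all recurrent points.
    ∅ : Family
    ∅ i = ⊥

    extends-∅⁻ : ∀ {f T} → Extends f ∅ T → Perm f T × Acyc f T
    extends-∅⁻ {f} {T} (_ , perm , acyc) = perm-cong {f} (λ i → p─⊥≡p (T i)) perm , acyc

    extends-∅⁺ : ∀ {f T} → Perm f T → Acyc f T → Extends f ∅ T
    extends-∅⁺ {f} {T} perm acyc = (λ i v∈ → contradiction v∈ ∉⊥) , perm-cong {f} (λ i → sym (p─⊥≡p (T i))) perm , acyc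

    -- Inserting the one-term sum over extensions of `∅` makes the recurrent family available as
    -- `T`. An event about iterated images becomes a condition read on `T` times one read off `T`.
    eventuallyCyclic-∑ : ∀ f → ⟦ eventuallyCyclic? lam (composite f) ⟧
                              ≈ ∑ families (λ T → ⟦ allSize? N T ⟧ * (⟦ perm? f T ×-dec compositeTyped? lam f T ⟧ * ⟦ acyc? f T ⟧))
    eventuallyCyclic-∑ f = begin
      ⟦ eventuallyCyclic? lam (composite f) ⟧
        ≈⟨ ∑-families-≡ (extends? f ∅) (closure f ∅) (extends-unique f ∅) (extends-cong f ∅) (λ _ → ⟦ eventuallyCyclic? lam (composite f) ⟧) (λ _ _ → ≈-refl) ⟨
      ∑ families (λ T → ⟦ extends? f ∅ T ⟧ * ⟦ eventuallyCyclic? lam (composite f) ⟧)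
        ≈⟨ ∑-cong families (λ T → ≈-trans (≈-sym (⟦⟧-× (extends? f ∅ T) (eventuallyCyclic? lam (composite f)))) (≈-trans
             (⟦⟧-⇔ (extends? f ∅ T ×-dec eventuallyCyclic? lam (composite f))
               (allSize? N T ×-dec ((perm? f T ×-dec compositeTyped? lam f T) ×-dec acyc? f T))
               (λ (ext , ec) → let (perm , acyc) = extends-∅⁻ {f} {T} ext; (size , ty) = eventuallyCyclic⁻ lam perm acyc ec in size , (perm , ty) , acyc)
               (λ (size , (perm , ty) , acyc) → extends-∅⁺ perm acyc , eventuallyCyclic⁺ lam perm acyc size ty))
             (≈-trans (⟦⟧-× (allSize? N T) ((perm? f T ×-dec compositeTyped? lam f T) ×-dec acyc? f T))
               (*-congˡ (⟦⟧-× (perm? f T ×-dec compositeTyped? lam f T) (acyc? f T)))))) ⟩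
      ∑ families (λ T → ⟦ allSize? N T ⟧ * (⟦ perm? f T ×-dec compositeTyped? lam f T ⟧ * ⟦ acyc? f T ⟧)) ∎

    permTyped-resp : ∀ T {f g} → (∀ i v → v ∈ T i → f i v ≡ g i v) → Perm f T × CompositeTyped lam f T → Perm g T × CompositeTyped lam g T
    permTyped-resp T {f} {g} f≡g (perm , ty) = perm-resp {f} {g} {T} f≡g perm , typed-resp {B = N} {S = T first} {ps} (composite-resp {f} {g} {T} f≡g perm) ty

    -- Prescribing the cycle type costs the same factor `z` for every recurrent family `T` of size
    -- `N`, so it comes out of the sum.
    Pr-eventuallyCyclic : z * 𝔼 tupleᴰ (λ f → ⟦ eventuallyCyclic? lam (composite f) ⟧) ≈ factorials N * Φ N
    Pr-eventuallyCyclic = begin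
      z * 𝔼 tupleᴰ (λ f → ⟦ eventuallyCyclic? lam (composite f) ⟧)
        ≈⟨ *-congˡ (≈-trans (𝔼-cong tupleᴰ eventuallyCyclic-∑) (𝔼-∑ tupleᴰ families term)) ⟩
      z * ∑ families (λ T → 𝔼 tupleᴰ (term T))
        ≈⟨ ∑-*ˡ families z (λ T → 𝔼 tupleᴰ (term T)) ⟨
      ∑ families (λ T → z * 𝔼 tupleᴰ (term T))
        ≈⟨ ∑-cong families value ⟩
      ∑ families (λ T → factorials N * (⟦ allSize? N T ⟧ * (μ T * Pr-acyc T)))
        ≈⟨ ∑-*ˡ families (factorials N) (λ T → ⟦ allSize? N T ⟧ * (μ T * Pr-acyc T)) ⟩
      factorials N * Φ N ∎
      where
      pt? : ∀ f T → Dec (Perm f T × CompositeTyped lam f T)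
      pt? f T = perm? f T ×-dec compositeTyped? lam f T

      term : Family → Tuple → Carrier
      term T f = ⟦ allSize? N T ⟧ * (⟦ pt? f T ⟧ * ⟦ acyc? f T ⟧)

      Pr-pt : Family → Carrier
      Pr-pt T = 𝔼 tupleᴰ (λ f → ⟦ pt? f T ⟧)

      pt-resp : ∀ T f g → (∀ i v → v ∈ T i → f i v ≡ g i v) → ⟦ pt? f T ⟧ ≈ ⟦ pt? g T ⟧
      pt-resp T f g f∼ = ⟦⟧-⇔ (pt? f T) (pt? g T) (permTyped-resp T {f} {g} f∼) (permTyped-resp T {g} {f} (λ i v v∈ → sym (f∼ i v v∈)))

      split : ∀ T → 𝔼 tupleᴰ (term T) ≈ ⟦ allSize? N T ⟧ * (Pr-pt T * Pr-acyc T)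
      split T = ≈-trans (𝔼-*ˡ tupleᴰ ⟦ allSize? N T ⟧ (λ f → ⟦ pt? f T ⟧ * ⟦ acyc? f T ⟧))
        (*-congˡ (independent-acyc {T} {T} (λ i v∈ → v∈) (λ f → ⟦ pt? f T ⟧) (pt-resp T)))

      value : ∀ T → z * 𝔼 tupleᴰ (term T) ≈ factorials N * (⟦ allSize? N T ⟧ * (μ T * Pr-acyc T))
      value T = begin
        z * 𝔼 tupleᴰ (term T)
          ≈⟨ *-congˡ (split T) ⟩
        z * (⟦ allSize? N T ⟧ * (Pr-pt T * Pr-acyc T))
          ≈⟨ solve 4 (λ z s q a → z :* (s :* (q :* a)) := s :* ((z :* q) :* a)) ≈-refl z ⟦ allSize? N T ⟧ (Pr-pt T) (Pr-acyc T) ⟩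
        ⟦ allSize? N T ⟧ * ((z * Pr-pt T) * Pr-acyc T)
          ≈⟨ ⟦⟧*-cong (allSize? N T) (λ sized → *-congʳ (Pr-permTyped T sized)) ⟩
        ⟦ allSize? N T ⟧ * ((factorials N * μ T) * Pr-acyc T)
          ≈⟨ solve 4 (λ s c m a → s :* ((c :* m) :* a) := c :* (s :* (m :* a))) ≈-refl ⟦ allSize? N T ⟧ (factorials N) (μ T) (Pr-acyc T) ⟩
        factorials N * (⟦ allSize? N T ⟧ * (μ T * Pr-acyc T)) ∎

    Pr-formula : factorials N * product (e N)
                 ≈ z * 𝔼 tupleᴰ (λ f → ⟦ eventuallyCyclic? lam (composite f) ⟧) + factorials (suc N) * product (e (suc N))
    Pr-formula = ≈-trans (Φ-recurrence N) (+-congʳ (≈-sym Pr-eventuallyCyclic))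

-- Weighted counts

P-factorial : ∀ {m k} → k ≤ m → (m P k) ℕ.* (m ℕ.∸ k) ! ≡ m !
P-factorial {m} {k} k≤m = trans (cong (ℕ._* (m ℕ.∸ k) !) (nPk≡n!/[n∸k]! k≤m))
  (m/n*n≡m {{(m ℕ.∸ k) ℕₚ.!≢0}} (m≤n⇒m!∣n! (ℕₚ.m∸n≤m m k)))

choose-P : ∀ m k → k ! ℕ.* (m choose k) ≡ m P k
choose-P m k with k ℕₚ.≤? m
... | no k≰m = trans (cong (k ! ℕ.*_) (k>n⇒nCk≡0 (ℕₚ.≰⇒> k≰m))) (trans (ℕₚ.*-zeroʳ (k !)) (sym (k>n⇒nPk≡0 (ℕₚ.≰⇒> k≰m))))
... | yes k≤m = ℕₚ.*-cancelʳ-≡ _ _ ((m ℕ.∸ k) !) {{(m ℕ.∸ k) ℕₚ.!≢0}} (trans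
      (cong (ℕ._* (m ℕ.∸ k) !) (ℕₚ.*-comm (k !) (m choose k)))
      (trans (ℕₚ.*-assoc (m choose k) (k !) _) (trans (C-factorial k≤m) (sym (P-factorial k≤m)))))

P-suc : ∀ {m k} → k < m → m P suc k ≡ (m ℕ.∸ k) ℕ.* (m P k)
P-suc {m} {k} k<m = ℕₚ.*-cancelʳ-≡ _ _ ((m ℕ.∸ suc k) !) {{(m ℕ.∸ suc k) ℕₚ.!≢0}} (trans (P-factorial k<m) (sym (trans
  (cong (ℕ._* (m ℕ.∸ suc k) !) (ℕₚ.*-comm (m ℕ.∸ k) (m P k)))
  (trans (ℕₚ.*-assoc (m P k) (m ℕ.∸ k) _) (trans (cong ((m P k) ℕ.*_) fact) (P-factorial (ℕₚ.<⇒≤ k<m)))))))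
  where
  fact : (m ℕ.∸ k) ℕ.* (m ℕ.∸ suc k) ! ≡ (m ℕ.∸ k) !
  fact = trans (cong (λ t → t ℕ.* (m ℕ.∸ suc k) !) eq) (cong _! (sym eq))
    where
    eq : m ℕ.∸ k ≡ suc (m ℕ.∸ suc k)
    eq = ℕₚ.+-∸-assoc 1 k<m

module Weighted {c ℓ} (R : CommutativeRing c ℓ) where

  open CommutativeRing R hiding (zero) renaming (refl to ≈-refl; sym to ≈-sym; trans to ≈-trans; reflexive to ≈-reflexive; _-_ to _⊟_)
  open FiniteSums R
  open Sums R
  open Counting R
  open Core R
  open Exp semiring using (_^_; ^-congˡ)
  open MonoidSum *-commutativeMonoid using () renaming
    (sum-cong-≋ to product-cong; ∑-distrib-+ to product-*; sum-replicate to product-replicate)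
  open RingProperties ring using (-‿distribʳ-*)
  open RingSolver commutativeSemiring using (solve; _:=_; _:+_; _:*_)
  open SetoidReasoning setoid

  -- Identities are derived in subtraction-free form and rearranged afterwards.
  moveʳ : ∀ {a b d} → a + b ≈ d → a ≈ d ⊟ b
  moveʳ {a} {b} {d} eq = begin
    a               ≈⟨ +-identityʳ a ⟨
    a + 0#          ≈⟨ +-congˡ (-‿inverseʳ b) ⟨
    a + (b + - b)   ≈⟨ +-assoc a b (- b) ⟨
    a + b + - b     ≈⟨ +-congʳ eq ⟩
    d ⊟ b           ∎

  *-distribˡ-⊟ : ∀ a b d → a * (b ⊟ d) ≈ a * b ⊟ a * d
  *-distribˡ-⊟ a b d = ≈-trans (distribˡ a b (- d)) (+-congˡ (≈-sym (-‿distribʳ-* a d)))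

  monomial-scale : ∀ {m} (x : Fin m → Carrier) b S → monomial (λ v → x v * b) S ≈ b ^ ∣ S ∣ * monomial x S
  monomial-scale x b S = ≈-trans (product-cong split) (≈-trans (product-* (λ v → if does (v ∈? S) then b else 1#) _) (*-congʳ (powers S)))
    where
    split : ∀ v → (if does (v ∈? S) then x v * b else 1#) ≈ (if does (v ∈? S) then b else 1#) * (if does (v ∈? S) then x v else 1#)
    split v with v ∈? S
    ... | yes _ = *-comm (x v) b
    ... | no _  = ≈-sym (*-identityˡ 1#)
    powers : ∀ {m} (S : Subset m) → product (λ v → if does (v ∈? S) then b else 1#) ≈ b ^ ∣ S ∣
    powers []            = ≈-refl
    powers (inside ∷ S)  = *-congˡ (powers S)
    powers (outside ∷ S) = ≈-trans (*-identityˡ _) (powers S)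

  elementary-scale : ∀ {m} (x : Fin m → Carrier) b j → elementary (λ v → x v * b) j ≈ b ^ j * elementary x j
  elementary-scale {m} x b j = begin
    elementary (λ v → x v * b) j
      ≈⟨ elementary-∑ (λ v → x v * b) j ⟩
    ∑ (subsets m) (λ S → ⟦ ∣ S ∣ ℕₚ.≟ j ⟧ * monomial (λ v → x v * b) S)
      ≈⟨ ∑-cong (subsets m) (λ S → ≈-trans (*-congˡ (monomial-scale x b S))
           (≈-trans (⟦⟧*-cong (∣ S ∣ ℕₚ.≟ j) (λ { refl → ≈-refl }))
             (solve 3 (λ s t u → s :* (t :* u) := t :* (s :* u)) ≈-refl ⟦ ∣ S ∣ ℕₚ.≟ j ⟧ (b ^ j) (monomial x S)))) ⟩
    ∑ (subsets m) (λ S → b ^ j * (⟦ ∣ S ∣ ℕₚ.≟ j ⟧ * monomial x S))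
      ≈⟨ ≈-trans (∑-*ˡ (subsets m) (b ^ j) _) (*-congˡ (≈-sym (elementary-∑ x j))) ⟩
    b ^ j * elementary x j ∎

  module _ (k : ℕ) .{{_ : NonZero k}} (n : Fin k → ℕ) {N : ℕ} (lam : Partition N)
           (x : ∀ i → Fin (n i) → Carrier) (b : ∀ i → Carrier) (ab≈1 : ∀ i → elementary (x i) 1 * b i ≈ 1#) where

    private
      module T = Tuples k n

      p : ∀ i → Fin (n i) → Carrier
      p i v = x i v * b i

      mass : ∀ i → sum (p i) ≈ 1#
      mass i = ≈-trans (≈-sym (SemiringSum.*-distribʳ-sum semiring (b i) (x i))) (≈-trans (*-congʳ (≈-sym (elementary-1 (x i)))) (ab≈1 i))

      open Balanced k n p mass using (tupleᴰ; factorials)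
      open Counted k n p mass lam using (ps; Pr-formula)

    a : Fin k → Carrier
    a i = elementary (x i) 1

    W : Carrier
    W = ∑ (T.EC lam) (λ (f : T.Tuple) → product (λ i → product (λ v → x (next i) (f i v))))

    -- Stands for the product of the powers of e₁(X_i) with exponent `n (prev i) - (N + 1)`. The
    -- positive power undoes the normalization, once for each vertex mapped into X_i; the power of
    -- `b i` is the one extracted in `e-N` and `e-sucN`.
    scale : Carrier
    scale = product (λ i → a i ^ n (prev i) * b i ^ suc N)

    private
      A B Z F : Carrier
      A = product (λ i → a i ^ n (prev i))
      B = product (λ i → b i ^ suc N)
      Z = nat (centralizer lam)
      F = factorials N

      EC? : ∀ (f : T.Tuple) → Dec (EventuallyCyclic lam (T.composite f))
      EC? f = eventuallyCyclic? lam (T.composite f)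

      unscale : ∀ i v → x i v ≈ a i * p i v
      unscale i v = ≈-sym (≈-trans (solve 3 (λ a x b → a :* (x :* b) := x :* (a :* b)) ≈-refl (a i) (x i v) (b i)) (≈-trans (*-congˡ (ab≈1 i)) (*-identityʳ _)))

      weight-scale : ∀ (f : T.Tuple) → product (λ i → product (λ v → x (next i) (f i v))) ≈ A * product (λ i → product (λ v → p (next i) (f i v)))
      weight-scale f = begin
        product (λ i → product (λ v → x (next i) (f i v)))
          ≈⟨ product-cong (λ i → ≈-trans (product-cong (λ v → unscale (next i) (f i v)))
               (≈-trans (product-* (λ v → a (next i)) (λ v → p (next i) (f i v))) (*-congʳ (product-replicate (n i))))) ⟩
        product (λ i → a (next i) ^ n i * product (λ v → p (next i) (f i v)))
          ≈⟨ product-* (λ i → a (next i) ^ n i) (λ i → product (λ v → p (next i) (f i v))) ⟩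
        product (λ i → a (next i) ^ n i) * product (λ i → product (λ v → p (next i) (f i v)))
          ≈⟨ *-congʳ (≈-trans (product-cong (λ i → ≈-reflexive (cong (λ j → a (next i) ^ n j) (sym (prev-next i))))) (product-next (λ i → a i ^ n (prev i)))) ⟩
        A * product (λ i → product (λ v → p (next i) (f i v))) ∎

      W-scale : W ≈ A * 𝔼 tupleᴰ (λ f → ⟦ EC? f ⟧)
      W-scale = begin
        W
          ≈⟨ ∑-filter EC? T.tuples (λ f → product (λ i → product (λ v → x (next i) (f i v)))) ⟩
        ∑ T.tuples (λ f → ⟦ EC? f ⟧ * product (λ i → product (λ v → x (next i) (f i v))))
          ≈⟨ ∑-cong T.tuples (λ f → ≈-trans (*-congˡ (weight-scale f))
               (solve 3 (λ s a w → s :* (a :* w) := a :* (w :* s)) ≈-refl ⟦ EC? f ⟧ A _)) ⟩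
        ∑ T.tuples (λ f → A * (product (λ i → product (λ v → p (next i) (f i v))) * ⟦ EC? f ⟧))
          ≈⟨ ∑-*ˡ T.tuples A _ ⟩
        A * 𝔼 tupleᴰ (λ f → ⟦ EC? f ⟧) ∎

      top bottom : Carrier
      top    = product (λ i → a i * elementary (x i) N)
      bottom = product (λ i → nat (suc N) * elementary (x i) (suc N))

      e-N : product (λ i → elementary (p i) N) ≈ B * top
      e-N = ≈-trans (product-cong (λ i → begin
          elementary (p i) N                                  ≈⟨ elementary-scale (x i) (b i) N ⟩
          b i ^ N * elementary (x i) N                        ≈⟨ *-identityˡ _ ⟨
          -- Inserting 1 as `a i * b i` raises the power of `b i` to `suc N`, as in `e-sucN`; this
          -- is the origin of the factor e₁ beside e_N.
          1# * (b i ^ N * elementary (x i) N)                 ≈⟨ *-congʳ (ab≈1 i) ⟨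
          (a i * b i) * (b i ^ N * elementary (x i) N)        ≈⟨ solve 4 (λ a b c d → (a :* b) :* (c :* d) := (b :* c) :* (a :* d)) ≈-refl (a i) (b i) _ _ ⟩
          b i ^ suc N * (a i * elementary (x i) N)            ∎))
        (product-* (λ i → b i ^ suc N) (λ i → a i * elementary (x i) N))

      -- Splitting `suc N !` as `suc N` times `N !` leaves the common factor `F` and produces the
      -- constant (N + 1)^k of the formula.
      e-sucN : factorials (suc N) * product (λ i → elementary (p i) (suc N)) ≈ F * (B * bottom)
      e-sucN = begin
        factorials (suc N) * product (λ i → elementary (p i) (suc N))
          ≈⟨ ≈-sym (product-* (λ _ → nat (suc N !)) (λ i → elementary (p i) (suc N))) ⟩
        product (λ i → nat (suc N !) * elementary (p i) (suc N))
          ≈⟨ product-cong (λ i → ≈-trans (*-cong (nat-* (suc N) (N !)) (elementary-scale (x i) (b i) (suc N)))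
               (solve 4 (λ s f b e → (s :* f) :* (b :* e) := f :* (b :* (s :* e))) ≈-refl (nat (suc N)) (nat (N !)) (b i ^ suc N) (elementary (x i) (suc N)))) ⟩
        product (λ i → nat (N !) * (b i ^ suc N * (nat (suc N) * elementary (x i) (suc N))))
          ≈⟨ ≈-trans (product-* (λ _ → nat (N !)) (λ i → b i ^ suc N * (nat (suc N) * elementary (x i) (suc N))))
               (*-congˡ (product-* (λ i → b i ^ suc N) (λ i → nat (suc N) * elementary (x i) (suc N)))) ⟩
        F * (B * bottom) ∎

    weighted-formula : nat (centralizer lam) * W ≈ product {k} (λ _ → nat (N !)) * scale *
      (product (λ i → a i * elementary (x i) N) ⊟ product (λ i → nat (suc N) * elementary (x i) (suc N)))
    weighted-formula = begin
      Z * W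
        ≈⟨ moveʳ sum-form ⟩
      F * scale * top ⊟ F * scale * bottom
        ≈⟨ *-distribˡ-⊟ (F * scale) top bottom ⟨
      F * scale * (top ⊟ bottom) ∎
      where
      E : Carrier
      E = 𝔼 tupleᴰ (λ f → ⟦ EC? f ⟧)
      scale-AB : scale ≈ A * B
      scale-AB = product-* (λ i → a i ^ n (prev i)) (λ i → b i ^ suc N)
      sum-form : Z * W + F * scale * bottom ≈ F * scale * top
      sum-form = begin
        Z * W + F * scale * bottom
          ≈⟨ +-cong (*-congˡ W-scale) (*-congʳ (*-congˡ scale-AB)) ⟩
        Z * (A * E) + F * (A * B) * bottom
          ≈⟨ solve 6 (λ z a e f b d → z :* (a :* e) :+ f :* (a :* b) :* d := a :* (z :* e :+ f :* (b :* d))) ≈-refl Z A E F B bottom ⟩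
        A * (Z * E + F * (B * bottom))
          ≈⟨ *-congˡ (+-congˡ e-sucN) ⟨
        A * (Z * E + factorials (suc N) * product (λ i → elementary (p i) (suc N)))
          ≈⟨ *-congˡ (≈-sym Pr-formula) ⟩
        A * (F * product (λ i → elementary (p i) N))
          ≈⟨ *-congˡ (*-congˡ e-N) ⟩
        A * (F * (B * top))
          ≈⟨ solve 4 (λ a f b t → a :* (f :* (b :* t)) := f :* (a :* b) :* t) ≈-refl A F B top ⟩
        F * (A * B) * top
          ≈⟨ *-congʳ (*-congˡ scale-AB) ⟨
        F * scale * top ∎

  monomial-1 : ∀ {m} (S : Subset m) → monomial (λ _ → 1#) S ≈ 1#
  monomial-1 S = product-1 one
    where
    one : ∀ v → (if does (v ∈? S) then 1# else 1#) ≈ 1#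
    one v with v ∈? S
    ... | yes _ = ≈-refl
    ... | no _  = ≈-refl

  elementary-at-1 : ∀ m j → elementary {m} (λ _ → 1#) j ≈ nat (m choose j)
  elementary-at-1 m j = begin
    elementary {m} (λ _ → 1#) j
      ≈⟨ elementary-∑ {m} (λ _ → 1#) j ⟩
    ∑ (subsets m) (λ S → ⟦ ∣ S ∣ ℕₚ.≟ j ⟧ * monomial (λ _ → 1#) S)
      ≈⟨ ∑-cong (subsets m) (λ S → ≈-trans (≈-trans (*-congˡ (monomial-1 S)) (*-comm _ 1#)) (*-congʳ (≈-sym (⟦⟧-yes (S ⊆? ⊤) ⊆⊤)))) ⟩
    ∑ (subsets m) (λ S → ⟦ S ⊆? ⊤ ⟧ * ⟦ ∣ S ∣ ℕₚ.≟ j ⟧)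
      ≈⟨ ∑-⊆ {m} ⊤ j ⟩
    nat (∣ ⊤ {m} ∣ choose j)
      ≈⟨ ≈-reflexive (cong (λ t → nat (t choose j)) (∣⊤∣≡n m)) ⟩
    nat (m choose j) ∎

  nat-⊟ : ∀ {m j} → j ≤ m → nat m ⊟ nat j ≈ nat (m ℕ.∸ j)
  nat-⊟ {m} {j} j≤m = ≈-sym (moveʳ (≈-trans (≈-sym (nat-+ (m ℕ.∸ j) j)) (≈-reflexive (cong nat (ℕₚ.m∸n+n≡m j≤m)))))

  elementary-P : ∀ m j → nat (j !) * elementary {m} (λ _ → 1#) j ≈ nat (m P j)
  elementary-P m j = ≈-trans (*-congˡ (elementary-at-1 m j)) (≈-trans (≈-sym (nat-* (j !) (m choose j))) (≈-reflexive (cong nat (choose-P m j))))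

  -- Both sides vanish when m ≤ j.
  elementary-suc-P : ∀ m j → nat (j !) * (nat (suc j) * elementary {m} (λ _ → 1#) (suc j)) ≈ nat (m P j) * (nat m ⊟ nat j)
  elementary-suc-P m j = ≈-trans
    (≈-trans (solve 3 (λ f s e → f :* (s :* e) := (s :* f) :* e) ≈-refl (nat (j !)) (nat (suc j)) _)
      (≈-trans (*-congʳ (≈-sym (nat-* (suc j) (j !)))) (elementary-P m (suc j))))
    (falling (ℕₚ.<-cmp j m))
    where
    falling : _ → nat (m P suc j) ≈ nat (m P j) * (nat m ⊟ nat j)
    falling (tri< j<m _ _) = begin
      nat (m P suc j)                     ≈⟨ ≈-reflexive (cong nat (P-suc j<m)) ⟩
      nat ((m ℕ.∸ j) ℕ.* (m P j))         ≈⟨ ≈-trans (nat-* (m ℕ.∸ j) (m P j)) (*-comm _ _) ⟩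
      nat (m P j) * nat (m ℕ.∸ j)         ≈⟨ *-congˡ (nat-⊟ (ℕₚ.<⇒≤ j<m)) ⟨
      nat (m P j) * (nat m ⊟ nat j)       ∎
    falling (tri≈ _ refl _) = ≈-trans (≈-reflexive (cong nat (k>n⇒nPk≡0 {j} {suc j} (ℕₚ.n<1+n j))))
      (≈-sym (≈-trans (*-congˡ (-‿inverseʳ (nat j))) (zeroʳ _)))
    falling (tri> _ _ m<j) = ≈-trans (≈-reflexive (cong nat (k>n⇒nPk≡0 {m} {suc j} (ℕₚ.m<n⇒m<1+n m<j))))
      (≈-sym (≈-trans (*-congʳ (≈-reflexive (cong nat (k>n⇒nPk≡0 m<j)))) (zeroˡ _)))

  nat-length : ∀ {A : Set} (xs : List A) {φ} → (∀ a → φ a ≈ 1#) → ∑ xs φ ≈ nat (length xs)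
  nat-length []       φ≈1 = ≈-refl
  nat-length (x ∷ xs) φ≈1 = +-cong (φ≈1 x) (nat-length xs φ≈1)

  nat-^ : ∀ m j → nat (m ℕ.^ j) ≈ nat m ^ j
  nat-^ m zero    = nat-1
  nat-^ m (suc j) = ≈-trans (nat-* m (m ℕ.^ j)) (*-congˡ (nat-^ m j))

  ^-inverse : ∀ {a b} → a * b ≈ 1# → ∀ j → a ^ j * b ^ j ≈ 1#
  ^-inverse {a} {b} ab≈1 zero    = *-identityˡ 1#
  ^-inverse {a} {b} ab≈1 (suc j) = ≈-trans (solve 4 (λ a c b d → (a :* c) :* (b :* d) := (a :* b) :* (c :* d)) ≈-refl a (a ^ j) b (b ^ j))
    (≈-trans (*-cong ab≈1 (^-inverse ab≈1 j)) (*-identityˡ 1#))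

  inverse-unique : ∀ {a b d} → a * b ≈ 1# → a * d ≈ 1# → b ≈ d
  inverse-unique {a} {b} {d} ab≈1 ad≈1 = begin
    b             ≈⟨ *-identityʳ b ⟨
    b * 1#        ≈⟨ *-congˡ ad≈1 ⟨
    b * (a * d)   ≈⟨ solve 3 (λ b a d → b :* (a :* d) := (a :* b) :* d) ≈-refl b a d ⟩
    (a * b) * d   ≈⟨ *-congʳ ab≈1 ⟩
    1# * d        ≈⟨ *-identityˡ d ⟩
    d             ∎

  -- `pw` is specified by its values on the two constructors of ℤ, so that the lemma serves both
  -- `power` and `_^ᶻ_`.
  power-⊖ : ∀ {a b} → a * b ≈ 1# → (pw : ℤ → Carrier) → (∀ m → pw (+ m) ≈ a ^ m) → (∀ m → pw -[1+ m ] ≈ b ^ suc m) →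
            ∀ m j → pw (m ℤ.⊖ j) ≈ a ^ m * b ^ j
  power-⊖ ab≈1 pw pos neg m       zero    = ≈-trans (pos m) (≈-sym (*-identityʳ _))
  power-⊖ ab≈1 pw pos neg zero    (suc j) = ≈-trans (neg j) (≈-sym (*-identityˡ _))
  power-⊖ {a} {b} ab≈1 pw pos neg (suc m) (suc j) = begin
    pw (suc m ℤ.⊖ suc j)          ≡⟨ cong pw (ℤₚ.[1+m]⊖[1+n]≡m⊖n m j) ⟩
    pw (m ℤ.⊖ j)                  ≈⟨ power-⊖ ab≈1 pw pos neg m j ⟩
    a ^ m * b ^ j                 ≈⟨ *-identityˡ _ ⟨
    1# * (a ^ m * b ^ j)          ≈⟨ *-congʳ ab≈1 ⟨
    (a * b) * (a ^ m * b ^ j)     ≈⟨ solve 4 (λ a b c d → (a :* b) :* (c :* d) := (a :* c) :* (b :* d)) ≈-refl a b (a ^ m) (b ^ j) ⟩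
    a ^ suc m * b ^ suc j         ∎

  -- The division by `z`, postponed to this point: `ζ` is its inverse and `s` plays the part of
  -- `f / z`.
  solve-scaled : ∀ {z ζ w f s y} → z * ζ ≈ 1# → s * z ≈ f → z * w ≈ f * y → w ≈ s * y
  solve-scaled {z} {ζ} {w} {f} {s} {y} zζ≈1 sz≈f zw≈fy = begin
    w                     ≈⟨ *-identityˡ w ⟨
    1# * w                ≈⟨ *-congʳ zζ≈1 ⟨
    (z * ζ) * w           ≈⟨ solve 3 (λ z t w → (z :* t) :* w := t :* (z :* w)) ≈-refl z ζ w ⟩
    ζ * (z * w)           ≈⟨ *-congˡ zw≈fy ⟩
    ζ * (f * y)           ≈⟨ *-congˡ (*-congʳ sz≈f) ⟨
    ζ * ((s * z) * y)     ≈⟨ solve 4 (λ t s z y → t :* ((s :* z) :* y) := (z :* t) :* (s :* y)) ≈-refl ζ s z y ⟩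
    (z * ζ) * (s * y)     ≈⟨ ≈-trans (*-congʳ zζ≈1) (*-identityˡ _) ⟩
    s * y                 ∎

  module _ (k : ℕ) .{{_ : NonZero k}} (n : Fin k → ℕ) {N : ℕ} (lam : Partition N)
           (b : Fin k → Carrier) (nb≈1 : ∀ i → nat (n i) * b i ≈ 1#) where

    private
      ones : ∀ i → Fin (n i) → Carrier
      ones i _ = 1#

      e₁≈n : ∀ i → elementary (ones i) 1 ≈ nat (n i)
      e₁≈n i = ≈-trans (elementary-at-1 (n i) 1) (≈-reflexive (cong nat (nC1≡n (n i))))

      scaled : Fin k → Carrier
      scaled i = nat (n i) ^ n (prev i) * b i ^ suc N

      falling : Fin k → Carrier
      falling i = nat (n i P N)

      F : Carrier
      F = product {k} (λ _ → nat (N !))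

    -- With all variables equal to 1 every tuple has weight 1 and e_j becomes a binomial
    -- coefficient, which `N !` turns into a falling factorial.
    count-formula : nat (centralizer lam) * nat (length (Tuples.EC k n lam)) ≈
      product (λ i → nat (n i) ^ n (prev i) * b i ^ suc N * nat (n i P N)) * (product (λ i → nat (n i)) ⊟ product (λ i → nat (n i) ⊟ nat N))
    count-formula = begin
      nat (centralizer lam) * nat (length (Tuples.EC k n lam))
        ≈⟨ *-congˡ (nat-length (Tuples.EC k n lam) (λ f → product-1 {k} (λ i → product-1 {n i} (λ v → ≈-refl)))) ⟨
      nat (centralizer lam) * W k n lam ones b ab≈1
        ≈⟨ weighted-formula k n lam ones b ab≈1 ⟩
      F * scale k n lam ones b ab≈1 * (top ⊟ bottom)
        ≈⟨ solve 3 (λ f s t → f :* s :* t := s :* (f :* t)) ≈-refl F _ (top ⊟ bottom) ⟩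
      scale k n lam ones b ab≈1 * (F * (top ⊟ bottom))
        ≈⟨ *-cong (product-cong (λ i → *-congʳ (^-congˡ (n (prev i)) (e₁≈n i)))) (*-distribˡ-⊟ F top bottom) ⟩
      product scaled * (F * top ⊟ F * bottom)
        ≈⟨ *-congˡ (+-cong F*top (-‿cong F*bottom)) ⟩
      product scaled * (product falling * product (λ i → nat (n i)) ⊟ product falling * product (λ i → nat (n i) ⊟ nat N))
        ≈⟨ *-congˡ (*-distribˡ-⊟ (product falling) _ _) ⟨
      product scaled * (product falling * (product (λ i → nat (n i)) ⊟ product (λ i → nat (n i) ⊟ nat N)))
        ≈⟨ ≈-trans (≈-sym (*-assoc _ _ _)) (*-congʳ (≈-sym (product-* scaled falling))) ⟩
      product (λ i → scaled i * falling i) * (product (λ i → nat (n i)) ⊟ product (λ i → nat (n i) ⊟ nat N)) ∎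
      where
      ab≈1 : ∀ i → elementary (ones i) 1 * b i ≈ 1#
      ab≈1 i = ≈-trans (*-congʳ (e₁≈n i)) (nb≈1 i)
      topFactor bottomFactor : Fin k → Carrier
      topFactor    i = elementary (ones i) 1 * elementary (ones i) N
      bottomFactor i = nat (suc N) * elementary (ones i) (suc N)
      top bottom : Carrier
      top    = product topFactor
      bottom = product bottomFactor
      F*top : F * top ≈ product falling * product (λ i → nat (n i))
      F*top = ≈-trans (≈-sym (product-* (λ _ → nat (N !)) topFactor)) (≈-trans
        (product-cong (λ i → ≈-trans (solve 3 (λ f a e → f :* (a :* e) := (f :* e) :* a) ≈-refl (nat (N !)) (elementary (ones i) 1) (elementary (ones i) N))
          (*-cong (elementary-P (n i) N) (e₁≈n i))))
        (product-* falling (λ i → nat (n i))))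
      F*bottom : F * bottom ≈ product falling * product (λ i → nat (n i) ⊟ nat N)
      F*bottom = ≈-trans (≈-sym (product-* (λ _ → nat (N !)) bottomFactor)) (≈-trans
        (product-cong (λ i → elementary-suc-P (n i) N))
        (product-* falling (λ i → nat (n i) ⊟ nat N)))

-- Natural numbers and reciprocals in ℚ

open import Data.Integer.Base using (_⊖_)
open import Data.Nat.Base using (_^_)
open import Data.Rational.Base using (_/_)
open import Data.Rational.Properties using (+-*-commutativeRing)

toℚᵘ-/ : ∀ i d → ℚ.toℚᵘ (i / suc d) ℚᵘ.≃ mkℚᵘ i d
toℚᵘ-/ i d = ℚₚ.toℚᵘ-fromℚᵘ (mkℚᵘ i d)

-- On unnormalised fractions this is a cross multiplication, and the gcd of the normal form does not
-- appear.
/-*-fromℕ : ∀ i d .{{_ : NonZero d}} → (i / d) ℚ.* fromℕ d ≡ i / 1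
/-*-fromℕ i (suc d) = ℚₚ.toℚᵘ-injective (begin
  ℚ.toℚᵘ ((i / suc d) ℚ.* fromℕ (suc d))         ≈⟨ ℚₚ.toℚᵘ-homo-* (i / suc d) (fromℕ (suc d)) ⟩
  ℚ.toℚᵘ (i / suc d) ℚᵘ.* ℚ.toℚᵘ (fromℕ (suc d)) ≈⟨ ℚᵘₚ.*-cong (toℚᵘ-/ i d) (toℚᵘ-/ (+ suc d) 0) ⟩
  mkℚᵘ i d ℚᵘ.* mkℚᵘ (+ suc d) 0                 ≈⟨ *≡* (solve 2 (λ i d → (i :* d) :* con (+ 1) := i :* (d :* con (+ 1))) refl i (+ suc d)) ⟩
  mkℚᵘ i 0                                       ≈⟨ toℚᵘ-/ i 0 ⟨
  ℚ.toℚᵘ (i / 1)                                 ∎)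
  where
  open SetoidReasoning ℚᵘₚ.≃-setoid
  open ℤSolver

fromℕ-suc : ∀ m → fromℕ (suc m) ≡ 1ℚ ℚ.+ fromℕ m
fromℕ-suc m = ℚₚ.toℚᵘ-injective (begin
  ℚ.toℚᵘ (fromℕ (suc m))              ≈⟨ toℚᵘ-/ (+ suc m) 0 ⟩
  mkℚᵘ (+ suc m) 0                    ≈⟨ *≡* (solve 1 (λ m → (con (+ 1) :+ m) :* con (+ 1) := (con (+ 1) :* con (+ 1) :+ m :* con (+ 1)) :* con (+ 1)) refl (+ m)) ⟩
  mkℚᵘ (+ 1) 0 ℚᵘ.+ mkℚᵘ (+ m) 0      ≈⟨ ℚᵘₚ.+-cong (toℚᵘ-/ (+ 1) 0) (toℚᵘ-/ (+ m) 0) ⟨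
  ℚ.toℚᵘ 1ℚ ℚᵘ.+ ℚ.toℚᵘ (fromℕ m)     ≈⟨ ℚₚ.toℚᵘ-homo-+ 1ℚ (fromℕ m) ⟨
  ℚ.toℚᵘ (1ℚ ℚ.+ fromℕ m)             ∎)
  where
  open SetoidReasoning ℚᵘₚ.≃-setoid
  open ℤSolver

module ℚSums = Sums +-*-commutativeRing

fromℕ≡nat : ∀ m → fromℕ m ≡ ℚSums.nat m
fromℕ≡nat zero    = refl
fromℕ≡nat (suc m) = trans (fromℕ-suc m) (cong (1ℚ ℚ.+_) (fromℕ≡nat m))

fromℕ-inverse : ∀ m .{{_ : NonZero m}} → fromℕ m ℚ.* ((+ 1) / m) ≡ 1ℚ
fromℕ-inverse m = trans (ℚₚ.*-comm (fromℕ m) ((+ 1) / m)) (/-*-fromℕ (+ 1) m)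

-- Specialization to ℚ⟨x⟩ and ℚ

module Homomorphism {c₁ ℓ₁ c₂ ℓ₂} (R : CommutativeRing c₁ ℓ₁) (Q : CommutativeRing c₂ ℓ₂) where

  private
    module R = CommutativeRing R
    module Q = CommutativeRing Q
    module FR = FiniteSums R
    module FQ = FiniteSums Q
    module S = Sums Q
    module W = Weighted Q

  module _ (h : R.Carrier → Q.Carrier)
           (h-+ : ∀ a b → h (a R.+ b) Q.≈ h a Q.+ h b) (h-* : ∀ a b → h (a R.* b) Q.≈ h a Q.* h b)
           (h-0 : h R.0# Q.≈ Q.0#) (h-1 : h R.1# Q.≈ Q.1#) where

    hom-product : ∀ {m} (φ : Fin m → R.Carrier) → h (FR.product φ) Q.≈ FQ.product (h ∘ φ)
    hom-product {zero}  φ = h-1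
    hom-product {suc m} φ = Q.trans (h-* (φ zero) _) (Q.*-congˡ (hom-product (φ ∘ suc)))

    hom-∑ : ∀ {A : Set} (xs : List A) φ → h (Sums.∑ R xs φ) Q.≈ S.∑ xs (h ∘ φ)
    hom-∑ []       φ = h-0
    hom-∑ (x ∷ xs) φ = Q.trans (h-+ (φ x) _) (Q.+-congˡ (hom-∑ xs φ))

    hom-elementary : ∀ {m} (x : Fin m → R.Carrier) j → h (FR.elementary x j) Q.≈ FQ.elementary (h ∘ x) j
    hom-elementary {m} x j = Q.trans (hom-∑ Ss (FR.monomial x)) (S.∑-cong Ss hom-monomial)
      where
      Ss : List (Subset m)
      Ss = filter (λ S → ∣ S ∣ ℕₚ.≟ j) (subsets m)
      hom-if : ∀ b a → h (if b then a else R.1#) Q.≈ (if b then h a else Q.1#)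
      hom-if true  a = Q.refl
      hom-if false a = h-1
      hom-monomial : ∀ S → h (FR.monomial x S) Q.≈ FQ.monomial (h ∘ x) S
      hom-monomial S = Q.trans (hom-product (λ v → if does (v ∈? S) then x v else R.1#))
        (MonoidSum.sum-cong-≋ Q.*-commutativeMonoid (λ v → hom-if (does (v ∈? S)) (x v)))

    module _ (k : ℕ) .{{_ : NonZero k}} (n : Fin k → ℕ) {N : ℕ} (lam : Partition N)
             (x : ∀ i → Fin (n i) → R.Carrier) (b : Fin k → Q.Carrier) (ab≈1 : ∀ i → h (FR.elementary (x i) 1) Q.* b i Q.≈ Q.1#) where

      private
        module T = Tuples k n
        open Exp Q.semiring using () renaming (_^_ to _^ᵠ_)
        open SetoidReasoning Q.setoid

        e : ℕ → Fin k → Q.Carrier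
        e j i = h (FR.elementary (x i) j)

        y : ∀ i → Fin (n i) → Q.Carrier
        y i v = h (x i v)

        e≈ : ∀ j i → FQ.elementary (y i) j Q.≈ e j i
        e≈ j i = Q.sym (hom-elementary (x i) j)

        ab≈1′ : ∀ i → FQ.elementary (y i) 1 Q.* b i Q.≈ Q.1#
        ab≈1′ i = Q.trans (Q.*-congʳ (e≈ 1 i)) (ab≈1 i)

        weight : T.Tuple → R.Carrier
        weight f = FR.product (λ i → FR.product (λ v → x (next i) (f i v)))

        weight≈ : ∀ f → h (weight f) Q.≈ FQ.product (λ i → FQ.product (λ v → y (next i) (f i v)))
        weight≈ f = Q.trans (hom-product (λ i → FR.product (λ v → x (next i) (f i v))))
          (MonoidSum.sum-cong-≋ Q.*-commutativeMonoid (λ i → hom-product (λ v → x (next i) (f i v))))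

        W′ : Q.Carrier
        W′ = W.W k n lam y b ab≈1′

        scale : Q.Carrier
        scale = W.scale k n lam y b ab≈1′

        nat-product : ∀ a → FQ.product {k} (λ _ → S.nat a) Q.≈ S.nat (a ^ k)
        nat-product a = Q.trans (MonoidSum.sum-replicate Q.*-commutativeMonoid k) (Q.sym (W.nat-^ a k))

        top bottom : Q.Carrier
        top    = FQ.product (λ i → FQ.elementary (y i) 1 Q.* FQ.elementary (y i) N)
        bottom = FQ.product (λ i → S.nat (suc N) Q.* FQ.elementary (y i) (suc N))

      -- The weights live in one ring and the inverses of e₁ in another, so the identity is applied
      -- in the target and compared with the image of the weight sum. `s`, `ζ`, `t` and `pw` stand
      -- for N!^k / z, 1 / z, (N + 1)^k and the powers of e₁, each given by its characterizing
      -- equation.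
      hom-weighted-formula : ∀ {s ζ t} (pw : Fin k → Q.Carrier) →
        s Q.* S.nat (centralizer lam) Q.≈ S.nat ((N !) ^ k) → S.nat (centralizer lam) Q.* ζ Q.≈ Q.1# → t Q.≈ S.nat (suc N ^ k) →
        (∀ i → pw i Q.≈ e 1 i ^ᵠ n (prev i) Q.* b i ^ᵠ suc N) →
        h (Sums.∑ R (T.EC lam) weight) Q.≈ s Q.* FQ.product pw Q.* (FQ.product (λ j → e 1 j Q.* e N j) Q.- t Q.* FQ.product (λ j → e (suc N) j))
      hom-weighted-formula {s} {ζ} {t} pw sz zζ t≈ pw≈ = begin
        h (Sums.∑ R (T.EC lam) weight)
          ≈⟨ Q.trans (hom-∑ (T.EC lam) weight) (S.∑-cong (T.EC lam) weight≈) ⟩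
        W′
          ≈⟨ W.solve-scaled zζ (Q.trans sz (Q.sym (nat-product (N !))))
               (Q.trans (W.weighted-formula k n lam y b ab≈1′) (Q.*-assoc (FQ.product {k} (λ _ → S.nat (N !))) scale (top Q.- bottom))) ⟩
        s Q.* (scale Q.* (top Q.- bottom))
          ≈⟨ Q.*-congˡ (Q.*-cong scale≈ (Q.+-cong top≈ (Q.-‿cong bottom≈))) ⟩
        s Q.* (FQ.product pw Q.* (FQ.product (λ j → e 1 j Q.* e N j) Q.- t Q.* FQ.product (λ j → e (suc N) j)))
          ≈⟨ Q.*-assoc _ _ _ ⟨
        s Q.* FQ.product pw Q.* (FQ.product (λ j → e 1 j Q.* e N j) Q.- t Q.* FQ.product (λ j → e (suc N) j)) ∎
        where
        scale≈ : scale Q.≈ FQ.product pw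
        scale≈ = MonoidSum.sum-cong-≋ Q.*-commutativeMonoid (λ i → Q.trans
          (Q.*-congʳ (Exp.^-congˡ Q.semiring (n (prev i)) (e≈ 1 i))) (Q.sym (pw≈ i)))
        top≈ : top Q.≈ FQ.product (λ j → e 1 j Q.* e N j)
        top≈ = MonoidSum.sum-cong-≋ Q.*-commutativeMonoid (λ i → Q.*-cong (e≈ 1 i) (e≈ N i))
        bottom≈ : bottom Q.≈ t Q.* FQ.product (λ j → e (suc N) j)
        bottom≈ = Q.trans (MonoidSum.∑-distrib-+ Q.*-commutativeMonoid (λ i → S.nat (suc N)) (λ i → FQ.elementary (y i) (suc N)))
          (Q.*-cong (Q.trans (nat-product (suc N)) (Q.sym t≈)) (MonoidSum.sum-cong-≋ Q.*-commutativeMonoid (λ i → e≈ (suc N) i)))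

module FractionProperties {c ℓ} (R : CommutativeRing c ℓ) where

  open Fractions R
  private
    module R = CommutativeRing R
    module F = CommutativeRing commutativeRing
    open Exp R.semiring using () renaming (_^_ to _^ᴿ_)
    open Exp F.semiring using () renaming (_^_ to _^ᶠ_)
    open RingSolver R.commutativeSemiring using (solve; _:=_; _:+_; _:*_; con)

  ι-cong : ∀ {a b} → a R.≈ b → ι a ≈ᶠ ι b
  ι-cong a≈b = cross (R.*-congʳ a≈b)

  ι-+ : ∀ a b → ι (a R.+ b) ≈ᶠ ι a +ᶠ ι b
  ι-+ a b = cross (solve 2 (λ a b → (a :+ b) :* (con 1 :* con 1) := (a :* con 1 :+ b :* con 1) :* con 1) R.refl a b)

  ι-* : ∀ a b → ι (a R.* b) ≈ᶠ ι a *ᶠ ι b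
  ι-* a b = cross (solve 2 (λ a b → (a :* b) :* (con 1 :* con 1) := (a :* b) :* con 1) R.refl a b)

  ι-^ : ∀ a m → ι (a ^ᴿ m) ≈ᶠ ι a ^ᶠ m
  ι-^ a zero    = cross R.refl
  ι-^ a (suc m) = F.trans {ι (a R.* a ^ᴿ m)} {ι a *ᶠ ι (a ^ᴿ m)} {ι a *ᶠ ι a ^ᶠ m}
    (ι-* a (a ^ᴿ m)) (F.*-congˡ {ι a} {ι (a ^ᴿ m)} {ι a ^ᶠ m} (ι-^ a m))

  module _ (q : R.Carrier) (rq : Regular q) where

    reciprocal : Fraction
    reciprocal = fraction R.1# q rq

    reciprocal-inverse : ι q *ᶠ reciprocal ≈ᶠ ι R.1#
    reciprocal-inverse = cross (solve 1 (λ q → (q :* con 1) :* con 1 := con 1 :* (con 1 :* q)) R.refl q)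

    reciprocal-^ : ∀ m → fraction R.1# (q ^ᴿ m) (regular-^ rq m) ≈ᶠ reciprocal ^ᶠ m
    reciprocal-^ zero    = cross R.refl
    reciprocal-^ (suc m) = F.trans {fraction R.1# (q ^ᴿ suc m) (regular-^ rq (suc m))} {reciprocal *ᶠ fraction R.1# (q ^ᴿ m) (regular-^ rq m)} {reciprocal *ᶠ reciprocal ^ᶠ m}
      (cross (solve 2 (λ q r → con 1 :* (q :* r) := (con 1 :* con 1) :* (q :* r)) R.refl q (q ^ᴿ m)))
      (F.*-congˡ {reciprocal} {fraction R.1# (q ^ᴿ m) (regular-^ rq m)} {reciprocal ^ᶠ m} (reciprocal-^ m))

    power-reciprocal : ∀ m j → power q rq (m ⊖ j) ≈ᶠ ι q ^ᶠ m *ᶠ reciprocal ^ᶠ j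
    power-reciprocal = Weighted.power-⊖ commutativeRing {ι q} {reciprocal} reciprocal-inverse (power q rq) (ι-^ q) (λ m → reciprocal-^ (suc m))

module _ (k N : ℕ) .{{_ : NonZero k}} .{{_ : NonZero N}} (lam : Partition N)
         (n : Fin k → ℕ) (nonempty : ∀ i → NonZero (n i)) where

  open Tuples k n

  private
    module Q = CommutativeRing ℚ⟨x⟩
    module Poly = Polynomials Vertex
    module S = Sums ℚ⟨x⟩
    module FS = FiniteSums ℚ⟨x⟩
    module FP = FractionProperties ℚ[x]

    z : ℕ
    z = centralizer lam

    instance
      z≢0 : NonZero z
      z≢0 = centralizer-nonZero lam

    scalar-* : ∀ a b → scalar (a ℚ.* b) ≈ scalar a * scalar b
    scalar-* a b = Q.trans {scalar (a ℚ.* b)} {ι (Poly.con a Poly.* Poly.con b)} {scalar a * scalar b}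
      (FP.ι-cong (Poly.con-* a b)) (FP.ι-* (Poly.con a) (Poly.con b))

    scalar-fromℕ : ∀ m → scalar (fromℕ m) ≈ S.nat m
    scalar-fromℕ zero    = Q.refl {Q.0#}
    scalar-fromℕ (suc m) rewrite fromℕ-suc m =
      Q.trans {scalar (1ℚ ℚ.+ fromℕ m)} {ι (Poly.con 1ℚ Poly.+ Poly.con (fromℕ m))} {S.nat (suc m)} (FP.ι-cong (Poly.con-+ 1ℚ (fromℕ m)))
        (Q.trans {ι (Poly.con 1ℚ Poly.+ Poly.con (fromℕ m))} {Q.1# Q.+ scalar (fromℕ m)} {S.nat (suc m)} (FP.ι-+ (Poly.con 1ℚ) (Poly.con (fromℕ m)))
          (Q.+-congˡ {Q.1#} {scalar (fromℕ m)} {S.nat m} (scalar-fromℕ m)))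

    scalar-/ : ∀ m → scalar ((+ m) / z) * S.nat z ≈ S.nat m
    scalar-/ m = Q.trans {scalar ((+ m) / z) * S.nat z} {scalar ((+ m) / z) * scalar (fromℕ z)} {S.nat m}
      (Q.*-congˡ {scalar ((+ m) / z)} {S.nat z} {scalar (fromℕ z)} (Q.sym {scalar (fromℕ z)} {S.nat z} (scalar-fromℕ z)))
      (Q.trans {scalar ((+ m) / z) * scalar (fromℕ z)} {scalar (fromℕ m)} {S.nat m}
        (subst (λ r → scalar ((+ m) / z) * scalar (fromℕ z) ≈ scalar r) (/-*-fromℕ (+ m) z)
          (Q.sym {scalar (((+ m) / z) ℚ.* fromℕ z)} {scalar ((+ m) / z) * scalar (fromℕ z)} (scalar-* ((+ m) / z) (fromℕ z))))
        (scalar-fromℕ m))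

    z-inverse : S.nat z * scalar ((+ 1) / z) ≈ Q.1#
    z-inverse = Q.trans {S.nat z * scalar ((+ 1) / z)} {scalar ((+ 1) / z) * S.nat z} {Q.1#} (Q.*-comm (S.nat z) (scalar ((+ 1) / z)))
      (Q.trans {scalar ((+ 1) / z) * S.nat z} {S.nat 1} {Q.1#} (scalar-/ 1) S.nat-1)

    reg : ∀ i → Regular (e 1 i)
    reg = e₁-regular nonempty

    pw : Fin k → Fraction
    pw i = power (e 1 i) (reg i) (n (prev i) ⊖ suc N)

  -- Nonempty sets make e₁(X_i) cancellable, so its reciprocal is a fraction and serves as the
  -- inverse that the general identity asks for.
  weightSum-formula : ι (weightSum lam) ≈ scalar ((+ ((N !) ^ k)) / z) * FS.product pw
    * (FS.product (λ j → ι (e 1 j) * ι (e N j)) - scalar (fromℕ (suc N ^ k)) * FS.product (λ j → ι (e (suc N) j)))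
  weightSum-formula = Homomorphism.hom-weighted-formula ℚ[x] ℚ⟨x⟩ ι FP.ι-+ FP.ι-* (Q.refl {Q.0#}) (Q.refl {Q.1#}) k n lam x
    (λ i → FP.reciprocal (e 1 i) (reg i)) (λ i → FP.reciprocal-inverse (e 1 i) (reg i))
    {scalar ((+ ((N !) ^ k)) / z)} {scalar ((+ 1) / z)} {scalar (fromℕ (suc N ^ k))} pw
    (scalar-/ ((N !) ^ k)) z-inverse (scalar-fromℕ (suc N ^ k))
    (λ i → FP.power-reciprocal (e 1 i) (reg i) (n (prev i)) (suc N))

  private
    module R = CommutativeRing +-*-commutativeRing
    module V = Weighted +-*-commutativeRing
    open FiniteSums +-*-commutativeRing using () renaming (product to ∏ℚ)
    open Exp R.semiring using () renaming (_^_ to _^ʳ_)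

    inv : Fin k → ℚ
    inv i = ((+ 1) / n i) {{nonempty i}}

    nat-inv : ∀ i → ℚSums.nat (n i) ℚ.* inv i ≡ 1ℚ
    nat-inv i = trans (cong (ℚ._* inv i) (sym (fromℕ≡nat (n i)))) (fromℕ-inverse (n i) {{nonempty i}})

    ^ᶻ-power : ∀ i m j → (n i ^ᶻ (m ⊖ j)) {{nonempty i}} ≡ ℚSums.nat (n i) ^ʳ m ℚ.* inv i ^ʳ j
    ^ᶻ-power i = V.power-⊖ {ℚSums.nat (n i)} {inv i} (nat-inv i) (λ t → (n i ^ᶻ t) {{nonempty i}})
      (λ m → trans (fromℕ≡nat (n i ^ m)) (V.nat-^ (n i) m))
      -- `_^ᶻ_` takes the reciprocal of a power, not a power of the reciprocal; both are inverses of
      -- the same number.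
      (λ m → V.inverse-unique {ℚSums.nat (n i) ^ʳ suc m} {((+ 1) / (n i ^ suc m)) {{nz (suc m)}}} {inv i ^ʳ suc m}
        (trans (cong (ℚ._* ((+ 1) / (n i ^ suc m)) {{nz (suc m)}}) (trans (sym (V.nat-^ (n i) (suc m))) (sym (fromℕ≡nat (n i ^ suc m)))))
          (fromℕ-inverse (n i ^ suc m) {{nz (suc m)}}))
        (V.^-inverse {ℚSums.nat (n i)} {inv i} (nat-inv i) (suc m)))
      where
      nz : ∀ m → NonZero (n i ^ m)
      nz m = ℕₚ.m^n≢0 (n i) m {{nonempty i}}

  count-EC : fromℕ (length (EC lam)) ≡ ((+ 1) / z) ℚ.* ∏ℚ (λ i → (n i ^ᶻ (n (prev i) ⊖ suc N)) {{nonempty i}} ℚ.* fromℕ (n i P N))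
             ℚ.* (∏ℚ (λ j → fromℕ (n j)) ℚ.- ∏ℚ (λ j → fromℕ (n j) ℚ.- fromℕ N))
  count-EC = begin
    fromℕ (length (EC lam))                  ≡⟨ fromℕ≡nat (length (EC lam)) ⟩
    ℚSums.nat (length (EC lam))              ≡⟨ V.solve-scaled {ℚSums.nat z} {(+ 1) / z} {ℚSums.nat (length (EC lam))} {1ℚ} {(+ 1) / z} {∏ℚ scaled ℚ.* difference}
                                                  nat-z (trans (ℚₚ.*-comm ((+ 1) / z) (ℚSums.nat z)) nat-z)
                                                  (trans (V.count-formula k n lam inv nat-inv) (sym (ℚₚ.*-identityˡ (∏ℚ scaled ℚ.* difference)))) ⟩
    ((+ 1) / z) ℚ.* (∏ℚ scaled ℚ.* difference)   ≡⟨ cong (((+ 1) / z) ℚ.*_) (cong₂ ℚ._*_ scaled≡ difference≡) ⟩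
    ((+ 1) / z) ℚ.* (∏ℚ scaled′ ℚ.* difference′) ≡⟨ ℚₚ.*-assoc ((+ 1) / z) (∏ℚ scaled′) difference′ ⟨
    ((+ 1) / z) ℚ.* ∏ℚ scaled′ ℚ.* difference′   ∎
    where
    open ≡.≡-Reasoning
    scaled scaled′ : Fin k → ℚ
    scaled  i = ℚSums.nat (n i) ^ʳ n (prev i) ℚ.* inv i ^ʳ suc N ℚ.* ℚSums.nat (n i P N)
    scaled′ i = (n i ^ᶻ (n (prev i) ⊖ suc N)) {{nonempty i}} ℚ.* fromℕ (n i P N)
    difference difference′ : ℚ
    difference  = ∏ℚ (λ j → ℚSums.nat (n j)) ℚ.- ∏ℚ (λ j → ℚSums.nat (n j) ℚ.- ℚSums.nat N)
    difference′ = ∏ℚ (λ j → fromℕ (n j)) ℚ.- ∏ℚ (λ j → fromℕ (n j) ℚ.- fromℕ N)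
    scaled≡ : ∏ℚ scaled ≡ ∏ℚ scaled′
    scaled≡ = MonoidSum.sum-cong-≗ R.*-commutativeMonoid (λ i → cong₂ ℚ._*_ (sym (^ᶻ-power i (n (prev i)) (suc N))) (sym (fromℕ≡nat (n i P N))))
    difference≡ : difference ≡ difference′
    difference≡ = cong₂ ℚ._-_ (MonoidSum.sum-cong-≗ R.*-commutativeMonoid (λ i → sym (fromℕ≡nat (n i))))
      (MonoidSum.sum-cong-≗ R.*-commutativeMonoid (λ i → cong₂ ℚ._-_ (sym (fromℕ≡nat (n i))) (sym (fromℕ≡nat N))))
    nat-z : ℚSums.nat z ℚ.* ((+ 1) / z) ≡ 1ℚ
    nat-z = trans (cong (ℚ._* ((+ 1) / z)) (sym (fromℕ≡nat z))) (fromℕ-inverse z)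

proposition5p2 : (k N : ℕ) .{{_ : NonZero k}} .{{_ : NonZero N}} (lam : Partition N)
    (n : Fin k → ℕ) (nonempty : ∀ i → NonZero (n i)) →
    let open Tuples k n
        open FiniteSums ℚ⟨x⟩ using () renaming (product to ∏)
        open FiniteSums +-*-commutativeRing using () renaming (product to ∏ℚ)
    in
      ι (weightSum lam)
        ≈ scalar (((+ ((N !) ^ k)) / centralizer lam) {{centralizer-nonZero lam}})
          * ∏ (λ i → power (e 1 i) (e₁-regular nonempty i) (n (prev i) ⊖ suc N))
          * (∏ (λ j → ι (e 1 j) * ι (e N j))
             - scalar (fromℕ (suc N ^ k)) * ∏ (λ j → ι (e (suc N) j)))
      × fromℕ (length (EC lam))
        ≡ ((+ 1) / centralizer lam) {{centralizer-nonZero lam}}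
          ℚ.* ∏ℚ (λ i → (n i ^ᶻ (n (prev i) ⊖ suc N)) {{nonempty i}} ℚ.* fromℕ (n i P N))
          ℚ.* (∏ℚ (λ j → fromℕ (n j)) ℚ.- ∏ℚ (λ j → fromℕ (n j) ℚ.- fromℕ N))
proposition5p2 k N lam n nonempty = weightSum-formula k N lam n nonempty , count-EC k N lam n nonempty
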